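{- For all integers $m \geq 93$ and $n \geq 31m$, \[\mu(n,n-m) = 2n - \left\lfloor \frac{n}{m} \right\rfloor.\]
   Context: All digraphs are finite, without loops and without multiple arcs (both arcs $uv$ and $vu$ may be present). For digraphs $D=(V,A)$ and $D'=(V',A')$ with $|V| \leq |V'|$, a packing of $D$ and $D'$ is an injection $f: V \to V'$ such that there is no arc $uv \in A$ with $f(u)f(v) \in A'$; if such an injection exists we say $D$ and $D'$ pack. For integers $n$ and $k$ with $1 \leq k \leq n(n-1)$, $\mu(n,k)$ denotes the smallest number such that there exist digraphs $D$ and $D'$, both on $n$ vertices, with $|A(D)| = k$ and $|A(D')| = \mu(n,k)$ which do not pack. -}

module Defs where

open import Data.Nat using (ℕ; _<_)
open import Data.Bool using (Bool; true; false; if_then_else_)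
open import Data.Fin using (Fin)
open import Data.List using (map; allFin)
open import Data.Nat.ListAction using (sum)
open import Data.Product using (Σ; _×_)
open import Relation.Binary.PropositionalEquality using (_≡_)
open import Relation.Nullary using (¬_)
open import Function.Definitions using (Injective)

-- A digraph on the vertex set Fin n: arc relation given by a Boolean
-- adjacency function (uv is an arc iff arc u v ≡ true), with no loops.
-- Multiple arcs are excluded automatically; both uv and vu may be present.
record Digraph (n : ℕ) : Set where
  field
    arc      : Fin n → Fin n → Bool
    loopless : ∀ u → arc u u ≡ false
open Digraph public

arcCount : ∀ {n} → Digraph n → ℕ
arcCount {n} D =
  sum (map (λ u → sum (map (λ v → if arc D u v then 1 else 0) (allFin n))) (allFin n))

IsPacking : ∀ {n} → Digraph n → Digraph n → (Fin n → Fin n) → Set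
IsPacking D D' f =
  Injective _≡_ _≡_ f × (∀ u v → arc D u v ≡ true → arc D' (f u) (f v) ≡ false)

Pack : ∀ {n} → Digraph n → Digraph n → Set
Pack {n} D D' = Σ (Fin n → Fin n) (IsPacking D D')

NonPackable : ℕ → ℕ → ℕ → Set
NonPackable n k j =
  Σ (Digraph n) λ D → Σ (Digraph n) λ D' →
    (arcCount D ≡ k) × (arcCount D' ≡ j) × ¬ Pack D D'

IsMu : ℕ → ℕ → ℕ → Set
IsMu n k j = NonPackable n k j × (∀ i → i < j → ¬ NonPackable n k i)

{-# OPTIONS --safe #-}
-- Let g have n − m arcs and let h have fewer than 2n − q arcs, q = ⌊n/m⌋. At least m ≥ 93 components of
-- g are trees, and the smallest one has at most q vertices. If some vertex y of h has degree at least
-- 8n/5, a smallest tree is put on y and on vertices with few arcs; so few arcs of h remain that a random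
-- bijection of the rest has less than one collision on average. Otherwise the trees are used up on the
-- vertices of large degree: a vertex of h of out- or indegree at least n/3 gets a sink or a source of a
-- tree, all of which is placed at once; a vertex of h of degree at least n/25 gets a leaf, which forbids
-- only the arcs at that vertex as positions of the neighbour of the leaf; a vertex of g of degree at least
-- n/3 goes to a vertex of h whose neighbours have been covered by leaves. Then a random bijection of the
-- rest has on average fewer than 5 violations, even if weighted with the number of exchanges of two
-- positions that are unsuitable for repairing them, and all violations can be removed by such exchanges.
--
-- Conversely, disjoint stars whose centres have indegree at least q − 1 do not pack with a vertex that
-- dominates all others and is dominated by all but q − 2 of them.
module Submission where

-- A random bijection has about n * 2n / n² = 2 collisions on average, so averaging alone gives no
-- packing and collisions must be repaired. A repair needs a partner for the exchange, and the
-- number of unsuitable partners is a sum of degrees of neighbours; this is why large degrees are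
-- removed first. The treatments differ in what they leave behind. A leaf put at p can bar its
-- neighbour from the whole out- or in-neighbourhood of p, which is affordable only up to n/3. A
-- tree placed as a whole bars nothing, but needs room outside the smaller of the two neighbourhoods
-- of y; from degree 8n/5 on this room may be missing. The constant 93 is a supply of trees: whole
-- trees and leaves on large vertices use at most 49, two vertices of large degree in g at most 5
-- each, and the last leaf is taken when at most 57 trees are used, so that 36 are left and the
-- smallest has at most n/36 vertices. The rounding errors are absorbed by n ≥ 31 * 93 = 2883.

open import Defs

-- Certified linear arithmetic over the natural numbers

module Linear where

  open import Data.Bool using (Bool; true; false; T)
  open import Data.Fin using (Fin)
  import Data.Fin as Fin
  import Data.Fin.Properties as Fin
  open import Data.List using (List; []; _∷_; foldr)
  import Data.List.Properties as List
  open import Data.Maybe using (Maybe; just; nothing)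
  open import Data.Nat
  open import Data.Nat.Properties
  open import Data.Product using (_×_; _,_)
  open import Data.Unit using (⊤)
  open import Data.Vec using (Vec; lookup; allFin)
  import Data.Vec as Vec
  open import Data.Vec.N-ary using (N-ary; _$ⁿ_)
  open import Relation.Binary.PropositionalEquality
  open import Relation.Nullary using (yes; no)

  infixl 6 _:+_
  infixl 7 _:*_
  infix 4 _:≤_ _:<_
  infix 3 _⇒_

  data Ex (n : ℕ) : Set where
    var       : Fin n → Ex n
    con       : ℕ → Ex n
    _:+_ _:*_ : Ex n → Ex n → Ex n

  record Ineq (n : ℕ) : Set where
    constructor _:≤_
    field lhs rhs : Ex n
  open Ineq

  _:<_ : ∀ {n} → Ex n → Ex n → Ineq n
  l :< r = con 1 :+ l :≤ r

  record Sequent (n : ℕ) : Set where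
    constructor _⇒_
    field
      hyps : List (Ineq n)
      goal : Ineq n
  open Sequent

  module _ {n : ℕ} where

    Mono Poly : Set
    Mono = List (Fin n)
    Poly = List (ℕ × Mono)

    insert : Fin n → Mono → Mono
    insert x [] = x ∷ []
    insert x (y ∷ m) with x Fin.≤? y
    ... | yes _ = x ∷ y ∷ m
    ... | no  _ = y ∷ insert x m

    addTerm : ℕ → Mono → Poly → Poly
    addTerm c m [] = (c , m) ∷ []
    addTerm c m ((d , m′) ∷ P) with List.≡-dec Fin._≟_ m m′
    ... | yes _ = (c + d , m′) ∷ P
    ... | no  _ = (d , m′) ∷ addTerm c m P

    _⊞_ : Poly → Poly → Poly
    []            ⊞ Q = Q
    ((c , m) ∷ P) ⊞ Q = addTerm c m (P ⊞ Q)

    scale : ℕ → Mono → Poly → Poly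
    scale c m [] = []
    scale c m ((d , m′) ∷ P) = (c * d , foldr insert m′ m) ∷ scale c m P

    _⊠_ : Poly → Poly → Poly
    []            ⊠ Q = []
    ((c , m) ∷ P) ⊠ Q = scale c m Q ⊞ (P ⊠ Q)

    norm : Ex n → Poly
    norm (var x)  = (1 , x ∷ []) ∷ []
    norm (con c)  = (c , []) ∷ []
    norm (e :+ f) = norm e ⊞ norm f
    norm (e :* f) = norm e ⊠ norm f

    remove : ℕ → Mono → Poly → Maybe Poly
    remove zero m P = just P
    remove (suc c) m [] = nothing
    remove (suc c) m ((d , m′) ∷ P) with List.≡-dec Fin._≟_ m m′ | suc c ≤? d | remove (suc c) m P
    ... | yes _ | yes _ | _       = just ((d ∸ suc c , m′) ∷ P)
    ... | yes _ | no  _ | _       = nothing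
    ... | no  _ | _     | just P′ = just ((d , m′) ∷ P′)
    ... | no  _ | _     | nothing = nothing

    leq : Poly → Poly → Bool
    leq [] Q = true
    leq ((c , m) ∷ P) Q with remove c m Q
    ... | just Q′ = leq P Q′
    ... | nothing = false

    left right : List (Ineq n) → List ℕ → Ex n
    left  (h ∷ hs) (c ∷ cs) = con c :* lhs h :+ left hs cs
    left  _        _        = con 0
    right (h ∷ hs) (c ∷ cs) = con c :* rhs h :+ right hs cs
    right _        _        = con 0

    -- The hypotheses enter crossed, their right sides together with the left side of the goal, so
    -- nothing is subtracted in ℕ. `leq` compares coefficient by coefficient, so products of
    -- variables act as further nonnegative unknowns.
    check : Sequent n → ℕ → List ℕ → Bool
    check (hs ⇒ g) d cs =
      leq (norm (con (suc d) :* lhs g :+ right hs cs)) (norm (con (suc d) :* rhs g :+ left hs cs))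

    module _ (ρ : Vec ℕ n) where

      ⟦_⟧ : Ex n → ℕ
      ⟦ var x ⟧  = lookup ρ x
      ⟦ con c ⟧  = c
      ⟦ e :+ f ⟧ = ⟦ e ⟧ + ⟦ f ⟧
      ⟦ e :* f ⟧ = ⟦ e ⟧ * ⟦ f ⟧

      ⟦_⟧I : Ineq n → Set
      ⟦ l :≤ r ⟧I = ⟦ l ⟧ ≤ ⟦ r ⟧

      ⟦_⟧H : List (Ineq n) → Set
      ⟦ [] ⟧H     = ⊤
      ⟦ h ∷ hs ⟧H = ⟦ h ⟧I × ⟦ hs ⟧H

      ⟦_⟧M : Mono → ℕ
      ⟦ [] ⟧M    = 1
      ⟦ x ∷ m ⟧M = lookup ρ x * ⟦ m ⟧M

      ⟦_⟧P : Poly → ℕ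
      ⟦ [] ⟧P          = 0
      ⟦ (c , m) ∷ P ⟧P = c * ⟦ m ⟧M + ⟦ P ⟧P

      private
        x[yz] : ∀ x y z → x * (y * z) ≡ y * (x * z)
        x[yz] x y z = trans (sym (*-assoc x y z)) (trans (cong (_* z) (*-comm x y)) (*-assoc y x z))

        x+[y+z] : ∀ x y z → x + (y + z) ≡ y + (x + z)
        x+[y+z] x y z = trans (sym (+-assoc x y z)) (trans (cong (_+ z) (+-comm x y)) (+-assoc y x z))

      insert-sound : ∀ x m → ⟦ insert x m ⟧M ≡ lookup ρ x * ⟦ m ⟧M
      insert-sound x [] = refl
      insert-sound x (y ∷ m) with x Fin.≤? y
      ... | yes _ = refl
      ... | no  _ = trans (cong (lookup ρ y *_) (insert-sound x m)) (x[yz] (lookup ρ y) (lookup ρ x) ⟦ m ⟧M)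

      insertAll-sound : ∀ m m′ → ⟦ foldr insert m′ m ⟧M ≡ ⟦ m ⟧M * ⟦ m′ ⟧M
      insertAll-sound [] m′ = sym (*-identityˡ _)
      insertAll-sound (x ∷ m) m′ = trans (insert-sound x (foldr insert m′ m))
        (trans (cong (lookup ρ x *_) (insertAll-sound m m′)) (sym (*-assoc (lookup ρ x) ⟦ m ⟧M ⟦ m′ ⟧M)))

      addTerm-sound : ∀ c m P → ⟦ addTerm c m P ⟧P ≡ c * ⟦ m ⟧M + ⟦ P ⟧P
      addTerm-sound c m [] = refl
      addTerm-sound c m ((d , m′) ∷ P) with List.≡-dec Fin._≟_ m m′
      ... | yes refl = trans (cong (_+ ⟦ P ⟧P) (*-distribʳ-+ ⟦ m ⟧M c d)) (+-assoc (c * ⟦ m ⟧M) _ _)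
      ... | no  _    = trans (cong (d * ⟦ m′ ⟧M +_) (addTerm-sound c m P)) (x+[y+z] (d * ⟦ m′ ⟧M) (c * ⟦ m ⟧M) ⟦ P ⟧P)

      ⊞-sound : ∀ P Q → ⟦ P ⊞ Q ⟧P ≡ ⟦ P ⟧P + ⟦ Q ⟧P
      ⊞-sound [] Q = refl
      ⊞-sound ((c , m) ∷ P) Q = trans (addTerm-sound c m (P ⊞ Q))
        (trans (cong (c * ⟦ m ⟧M +_) (⊞-sound P Q)) (sym (+-assoc (c * ⟦ m ⟧M) _ _)))

      scale-sound : ∀ c m P → ⟦ scale c m P ⟧P ≡ c * ⟦ m ⟧M * ⟦ P ⟧P
      scale-sound c m [] = sym (*-zeroʳ (c * ⟦ m ⟧M))
      scale-sound c m ((d , m′) ∷ P) = begin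
        c * d * ⟦ foldr insert m′ m ⟧M + ⟦ scale c m P ⟧P
          ≡⟨ cong₂ _+_ (cong (c * d *_) (insertAll-sound m m′)) (scale-sound c m P) ⟩
        c * d * (⟦ m ⟧M * ⟦ m′ ⟧M) + c * ⟦ m ⟧M * ⟦ P ⟧P
          ≡⟨ cong (_+ c * ⟦ m ⟧M * ⟦ P ⟧P) ([m*n]*[o*p]≡[m*o]*[n*p] c d ⟦ m ⟧M ⟦ m′ ⟧M) ⟩
        c * ⟦ m ⟧M * (d * ⟦ m′ ⟧M) + c * ⟦ m ⟧M * ⟦ P ⟧P
          ≡⟨ sym (*-distribˡ-+ (c * ⟦ m ⟧M) _ _) ⟩
        c * ⟦ m ⟧M * (d * ⟦ m′ ⟧M + ⟦ P ⟧P) ∎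
        where open ≡-Reasoning

      ⊠-sound : ∀ P Q → ⟦ P ⊠ Q ⟧P ≡ ⟦ P ⟧P * ⟦ Q ⟧P
      ⊠-sound [] Q = refl
      ⊠-sound ((c , m) ∷ P) Q = trans (⊞-sound (scale c m Q) (P ⊠ Q))
        (trans (cong₂ _+_ (scale-sound c m Q) (⊠-sound P Q)) (sym (*-distribʳ-+ ⟦ Q ⟧P (c * ⟦ m ⟧M) ⟦ P ⟧P)))

      norm-sound : ∀ e → ⟦ norm e ⟧P ≡ ⟦ e ⟧
      norm-sound (var x) = trans (+-identityʳ _) (trans (*-identityˡ _) (*-identityʳ _))
      norm-sound (con c) = trans (+-identityʳ _) (*-identityʳ c)
      norm-sound (e :+ f) = trans (⊞-sound (norm e) (norm f)) (cong₂ _+_ (norm-sound e) (norm-sound f))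
      norm-sound (e :* f) = trans (⊠-sound (norm e) (norm f)) (cong₂ _*_ (norm-sound e) (norm-sound f))

      remove-sound : ∀ c m P {P′} → remove c m P ≡ just P′ → ⟦ P ⟧P ≡ c * ⟦ m ⟧M + ⟦ P′ ⟧P
      remove-sound zero m P refl = refl
      remove-sound (suc c) m ((d , m′) ∷ P) eq
        with List.≡-dec Fin._≟_ m m′ | suc c ≤? d | remove (suc c) m P in eqP | eq
      ... | yes refl | yes c<d | _ | refl = begin
        d * ⟦ m ⟧M + ⟦ P ⟧P
          ≡⟨ cong (λ x → x * ⟦ m ⟧M + ⟦ P ⟧P) (sym (m+[n∸m]≡n c<d)) ⟩
        (suc c + (d ∸ suc c)) * ⟦ m ⟧M + ⟦ P ⟧P
          ≡⟨ cong (_+ ⟦ P ⟧P) (*-distribʳ-+ ⟦ m ⟧M (suc c) (d ∸ suc c)) ⟩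
        suc c * ⟦ m ⟧M + (d ∸ suc c) * ⟦ m ⟧M + ⟦ P ⟧P
          ≡⟨ +-assoc (suc c * ⟦ m ⟧M) _ _ ⟩
        suc c * ⟦ m ⟧M + ((d ∸ suc c) * ⟦ m ⟧M + ⟦ P ⟧P) ∎
        where open ≡-Reasoning
      ... | no _ | _ | just P′ | refl =
        trans (cong (d * ⟦ m′ ⟧M +_) (remove-sound (suc c) m P eqP)) (x+[y+z] (d * ⟦ m′ ⟧M) (suc c * ⟦ m ⟧M) ⟦ P′ ⟧P)

      leq-sound : ∀ P Q → T (leq P Q) → ⟦ P ⟧P ≤ ⟦ Q ⟧P
      leq-sound [] Q _ = z≤n
      leq-sound ((c , m) ∷ P) Q ok with remove c m Q in eq
      ... | just Q′ = ≤-trans (+-monoʳ-≤ (c * ⟦ m ⟧M) (leq-sound P Q′ ok))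
                              (≤-reflexive (sym (remove-sound c m Q eq)))

      left≤right : ∀ hs cs → ⟦ hs ⟧H → ⟦ left hs cs ⟧ ≤ ⟦ right hs cs ⟧
      left≤right [] _ _ = z≤n
      left≤right (_ ∷ _) [] _ = z≤n
      left≤right (h ∷ hs) (c ∷ cs) (p , ps) = +-mono-≤ (*-monoʳ-≤ c p) (left≤right hs cs ps)

      check-sound : ∀ s d cs → T (check s d cs) → ⟦ hyps s ⟧H → ⟦ goal s ⟧I
      check-sound (hs ⇒ l :≤ r) d cs ok ps = *-cancelˡ-≤ (suc d) (+-cancelʳ-≤ ⟦ right hs cs ⟧ _ _ (begin
        suc d * ⟦ l ⟧ + ⟦ right hs cs ⟧
          ≡⟨ sym (norm-sound (con (suc d) :* l :+ right hs cs)) ⟩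
        ⟦ norm (con (suc d) :* l :+ right hs cs) ⟧P
          ≤⟨ leq-sound (norm (con (suc d) :* l :+ right hs cs)) (norm (con (suc d) :* r :+ left hs cs)) ok ⟩
        ⟦ norm (con (suc d) :* r :+ left hs cs) ⟧P
          ≡⟨ norm-sound (con (suc d) :* r :+ left hs cs) ⟩
        suc d * ⟦ r ⟧ + ⟦ left hs cs ⟧
          ≤⟨ +-monoʳ-≤ (suc d * ⟦ r ⟧) (left≤right hs cs ps) ⟩
        suc d * ⟦ r ⟧ + ⟦ right hs cs ⟧ ∎))
        where open ≤-Reasoning

  -- Linear arithmetic by certificates: for an assignment ρ of the variables, suc d times the goal has to be
  -- the sum of the hypotheses with coefficients cs up to nonnegative terms, monomials being compared after
  -- normalisation. The checks are closed terms, hence decided by evaluation.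
  vars : ∀ n → Vec (Ex n) n
  vars n = Vec.map var (allFin n)

  lin : ∀ {n} (ρ : Vec ℕ n) (f : N-ary n (Ex n) (Sequent n)) (d : ℕ) (cs : List ℕ) →
    {_ : T (check (f $ⁿ vars n) d cs)} → ⟦ ρ ⟧H (hyps (f $ⁿ vars n)) → ⟦ ρ ⟧I (goal (f $ⁿ vars n))
  lin {n} ρ f d cs {ok} = check-sound ρ (f $ⁿ vars n) d cs ok

open Linear

open import Data.Bool using (false; if_then_else_; true)
open import Data.Empty using (⊥; ⊥-elim)
open import Data.Fin as Fin using (Fin; toℕ)
import Data.Fin.Properties as Fin
open import Data.List using (List; []; _++_; _∷_; allFin; concat; length; map; upTo)
open import Data.List.Membership.Propositional using (_∈_)
open import Data.List.Membership.Propositional.Properties using (∈-++⁺ʳ; ∈-++⁺ˡ; ∈-++⁻; ∈-allFin; ∈-concat⁺′; ∈-concat⁻′; ∈-map⁺; ∈-map⁻; ∈-∃++)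
open import Data.List.Properties using (++-assoc; ++-identityʳ; length-++; length-map; length-tabulate; map-++)
open import Data.List.Relation.Binary.Permutation.Propositional using (_↭_; prep; refl; swap; trans; ↭-reflexive; ↭-sym; ↭-trans)
open import Data.List.Relation.Binary.Permutation.Propositional.Properties using (++⁺; ++⁺ʳ; ++⁺ˡ; All-resp-↭; map⁺; shift; shifts; ↭-length; ∈-resp-↭)
open import Data.List.Relation.Unary.All as All using (All; []; _∷_)
open import Data.List.Relation.Unary.AllPairs using ([]; _∷_)
open import Data.List.Relation.Unary.Any using (here; there)
open import Data.List.Relation.Unary.Unique.Propositional using (Unique)
open import Data.List.Relation.Unary.Unique.Propositional.Properties using (allFin⁺)
open import Data.Nat
open import Data.Nat.DivMod using (/-monoˡ-≤; _%_; m%n<n; m*n/n≡m; m/n*n≤m; m≡m%n+[m/n]*n)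
open import Data.Nat.ListAction using (sum)
open import Data.Nat.Properties
open import Data.Product using (_,_; _×_; proj₁; proj₂; Σ; ∃)
open import Data.Sum using (_⊎_; inj₁; inj₂)
open import Data.Unit using (tt)
open import Data.Vec using ([]; _∷_)
open import Function using (id)
open import Relation.Binary.Definitions using (tri<; tri>; tri≈)
open import Relation.Binary.PropositionalEquality as ≡ using (_≡_; _≢_; cong; cong₂; subst; sym)
open import Relation.Nullary using (Dec; no; yes; ¬_)

-- Finite sums over lists

module Sums where

  private variable
    A B : Set
    x : A
    xs ys : List A
    f k : A → ℕ

  ∑ : List A → (A → ℕ) → ℕ
  ∑ []       f = 0
  ∑ (x ∷ xs) f = f x + ∑ xs f

  ∑-syntax : List A → (A → ℕ) → ℕ
  ∑-syntax = ∑
  syntax ∑-syntax xs (λ x → e) = ∑[ x ∈ xs ] e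
  infix 5 ∑-syntax

  ∑-cong : ∀ (xs : List A) → (∀ x → f x ≡ k x) → ∑ xs f ≡ ∑ xs k
  ∑-cong []       eq = ≡.refl
  ∑-cong (x ∷ xs) eq = cong₂ _+_ (eq x) (∑-cong xs eq)

  ∑-cong-∈ : ∀ (xs : List A) → (∀ {x} → x ∈ xs → f x ≡ k x) → ∑ xs f ≡ ∑ xs k
  ∑-cong-∈ []       eq = ≡.refl
  ∑-cong-∈ (x ∷ xs) eq = cong₂ _+_ (eq (here ≡.refl)) (∑-cong-∈ xs (λ i → eq (there i)))

  ∑-mono-∈ : ∀ (xs : List A) → (∀ {x} → x ∈ xs → f x ≤ k x) → ∑ xs f ≤ ∑ xs k
  ∑-mono-∈ []       le = z≤n
  ∑-mono-∈ (x ∷ xs) le = +-mono-≤ (le (here ≡.refl)) (∑-mono-∈ xs (λ i → le (there i)))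

  ∑-mono : ∀ (xs : List A) → (∀ x → f x ≤ k x) → ∑ xs f ≤ ∑ xs k
  ∑-mono xs le = ∑-mono-∈ xs (λ {x} _ → le x)

  ∑-+ : ∀ (xs : List A) (f k : A → ℕ) → (∑[ x ∈ xs ] f x + k x) ≡ ∑ xs f + ∑ xs k
  ∑-+ []       f k = ≡.refl
  ∑-+ (x ∷ xs) f k = (≤-antisym
      (lin ((f x) ∷ (k x) ∷ (∑ xs f) ∷ (∑ xs k) ∷ (∑[ y ∈ xs ] f y + k y) ∷ [])
        (λ a b p q r → (r :≤ p :+ q) ∷ [] ⇒ a :+ b :+ r :≤ a :+ p :+ (b :+ q))
        0 (1 ∷ [])
        (≤-reflexive (∑-+ xs f k) , tt))
      (lin ((f x) ∷ (k x) ∷ (∑ xs f) ∷ (∑ xs k) ∷ (∑[ y ∈ xs ] f y + k y) ∷ [])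
        (λ a b p q r → (p :+ q :≤ r) ∷ [] ⇒ a :+ p :+ (b :+ q) :≤ a :+ b :+ r)
        0 (1 ∷ [])
        (≤-reflexive (sym (∑-+ xs f k)) , tt)))

  ∑-*ˡ : ∀ (xs : List A) c (f : A → ℕ) → (∑[ x ∈ xs ] c * f x) ≡ c * ∑ xs f
  ∑-*ˡ []       c f = sym (*-zeroʳ c)
  ∑-*ˡ (x ∷ xs) c f = ≡.trans (cong (c * f x +_) (∑-*ˡ xs c f)) (sym (*-distribˡ-+ c (f x) (∑ xs f)))

  ∑-*ʳ : ∀ (xs : List A) c (f : A → ℕ) → (∑[ x ∈ xs ] f x * c) ≡ ∑ xs f * c
  ∑-*ʳ xs c f = ≡.trans (∑-cong xs (λ x → *-comm (f x) c)) (≡.trans (∑-*ˡ xs c f) (*-comm c _))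

  ∑-const : ∀ (xs : List A) c → (∑[ _ ∈ xs ] c) ≡ length xs * c
  ∑-const []       c = ≡.refl
  ∑-const (x ∷ xs) c = cong (c +_) (∑-const xs c)

  ∑-0 : ∀ (xs : List A) → (∑[ _ ∈ xs ] 0) ≡ 0
  ∑-0 xs = ≡.trans (∑-const xs 0) (*-zeroʳ (length xs))

  ∑-zero-∈ : ∀ (xs : List A) → (∀ {x} → x ∈ xs → f x ≡ 0) → ∑ xs f ≡ 0
  ∑-zero-∈ xs eq = ≡.trans (∑-cong-∈ xs eq) (∑-0 xs)

  ∑-++ : ∀ (xs ys : List A) (f : A → ℕ) → ∑ (xs ++ ys) f ≡ ∑ xs f + ∑ ys f
  ∑-++ []       ys f = ≡.refl
  ∑-++ (x ∷ xs) ys f = ≡.trans (cong (f x +_) (∑-++ xs ys f)) (sym (+-assoc (f x) _ _))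

  ∑-map : ∀ (h : A → B) (xs : List A) (f : B → ℕ) → ∑ (map h xs) f ≡ (∑[ x ∈ xs ] f (h x))
  ∑-map h []       f = ≡.refl
  ∑-map h (x ∷ xs) f = cong (f (h x) +_) (∑-map h xs f)

  ∑-concat : ∀ (xss : List (List A)) (f : A → ℕ) → ∑ (concat xss) f ≡ (∑[ xs ∈ xss ] ∑ xs f)
  ∑-concat []         f = ≡.refl
  ∑-concat (xs ∷ xss) f = ≡.trans (∑-++ xs (concat xss) f) (cong (∑ xs f +_) (∑-concat xss f))

  ∑-↭ : ∀ {xs ys : List A} (f : A → ℕ) → xs ↭ ys → ∑ xs f ≡ ∑ ys f
  ∑-↭ f refl         = ≡.refl
  ∑-↭ f (prep x p)   = cong (f x +_) (∑-↭ f p)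
  ∑-↭ f (swap {xs} {ys} x y p) = (≤-antisym
      (lin ((f x) ∷ (f y) ∷ (∑ xs f) ∷ (∑ ys f) ∷ [])
        (λ a b p q → (p :≤ q) ∷ [] ⇒ a :+ (b :+ p) :≤ b :+ (a :+ q))
        0 (1 ∷ [])
        (≤-reflexive (∑-↭ f p) , tt))
      (lin ((f x) ∷ (f y) ∷ (∑ xs f) ∷ (∑ ys f) ∷ [])
        (λ a b p q → (q :≤ p) ∷ [] ⇒ b :+ (a :+ q) :≤ a :+ (b :+ p))
        0 (1 ∷ [])
        (≤-reflexive (sym (∑-↭ f p)) , tt)))
  ∑-↭ f (trans p q)  = ≡.trans (∑-↭ f p) (∑-↭ f q)

  ∑-swap : ∀ (xs : List A) (ys : List B) (f : A → B → ℕ) →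
    (∑[ x ∈ xs ] ∑[ y ∈ ys ] f x y) ≡ (∑[ y ∈ ys ] ∑[ x ∈ xs ] f x y)
  ∑-swap []       ys f = sym (∑-0 ys)
  ∑-swap (x ∷ xs) ys f = ≡.trans (cong (∑ ys (f x) +_) (∑-swap xs ys f)) (sym (∑-+ ys (f x) _))

  ∑-∈ : ∀ (f : A → ℕ) → x ∈ xs → f x ≤ ∑ xs f
  ∑-∈ f (here ≡.refl) = m≤m+n _ _
  ∑-∈ {xs = y ∷ ys} f (there i) = ≤-trans (∑-∈ f i) (m≤n+m _ (f y))

  ∑≡0⇒∈ : ∀ (f : A → ℕ) → ∑ xs f ≡ 0 → x ∈ xs → f x ≡ 0
  ∑≡0⇒∈ f eq i = n≤0⇒n≡0 (≤-trans (∑-∈ f i) (≤-reflexive eq))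

  ∑>0⇒∃ : ∀ (xs : List A) (f : A → ℕ) → 0 < ∑ xs f → ∃ λ x → x ∈ xs × 0 < f x
  ∑>0⇒∃ (x ∷ xs) f pos with f x in eq
  ... | suc _ = x , here ≡.refl , ≤-trans (s≤s z≤n) (≤-reflexive (sym eq))
  ... | zero with ∑>0⇒∃ xs f pos
  ...   | y , i , p = y , there i , p

  ∑<⇒∃< : ∀ (xs : List A) (f k : A → ℕ) → ∑ xs f < ∑ xs k → ∃ λ x → x ∈ xs × f x < k x
  ∑<⇒∃< (x ∷ xs) f k lt with f x <? k x
  ... | yes p = x , here ≡.refl , p
  ... | no ¬p with ∑<⇒∃< xs f k (+-cancelˡ-< (k x) _ _ (<-≤-trans (≤-<-trans (+-monoˡ-≤ (∑ xs f) (≮⇒≥ ¬p)) lt) ≤-refl))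
  ...   | y , i , p = y , there i , p

  ∑<length⇒∃ : ∀ (xs : List A) (f : A → ℕ) → ∑ xs f < length xs → ∃ λ x → x ∈ xs × f x ≡ 0
  ∑<length⇒∃ xs f lt
    with ∑<⇒∃< xs f (λ _ → 1) (<-≤-trans lt (≤-reflexive (sym (≡.trans (∑-const xs 1) (*-identityʳ _)))))
  ... | x , i , s≤s p = x , i , n≤0⇒n≡0 p

  ∈⇒↭ : x ∈ xs → ∃ λ ys → xs ↭ x ∷ ys
  ∈⇒↭ {x = x} i with ∈-∃++ i
  ... | ys , zs , ≡.refl = ys ++ zs , shift x ys zs

  ∑∑-∷ : ∀ (x : A) xs (f : A → A → ℕ) →
    (∑[ y ∈ x ∷ xs ] ∑[ z ∈ x ∷ xs ] f y z) ≡ f x x + (∑[ y ∈ xs ] f x y + f y x) + (∑[ y ∈ xs ] ∑[ z ∈ xs ] f y z)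
  ∑∑-∷ x xs f = (≤-antisym
      (lin ((f x x) ∷ (∑ xs (f x)) ∷ (∑[ y ∈ xs ] f y x) ∷ (∑[ y ∈ xs ] ∑ xs (f y)) ∷ (∑[ y ∈ xs ] f x y + f y x) ∷
          (∑[ y ∈ xs ] ∑ (x ∷ xs) (f y)) ∷ [])
        (λ a b c d e g → (b :+ c :≤ e) ∷ (g :≤ c :+ d) ∷ [] ⇒ a :+ b :+ g :≤ a :+ e :+ d)
        0 (1 ∷ 1 ∷ [])
        (≤-reflexive (sym (∑-+ xs (f x) (λ y → f y x))) , ≤-reflexive (∑-+ xs (λ y → f y x) (λ y → ∑ xs (f y))) , tt))
      (lin ((f x x) ∷ (∑ xs (f x)) ∷ (∑[ y ∈ xs ] f y x) ∷ (∑[ y ∈ xs ] ∑ xs (f y)) ∷ (∑[ y ∈ xs ] f x y + f y x) ∷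
          (∑[ y ∈ xs ] ∑ (x ∷ xs) (f y)) ∷ [])
        (λ a b c d e g → (e :≤ b :+ c) ∷ (c :+ d :≤ g) ∷ [] ⇒ a :+ e :+ d :≤ a :+ b :+ g)
        0 (1 ∷ 1 ∷ [])
        (≤-reflexive (∑-+ xs (f x) (λ y → f y x)) , ≤-reflexive (sym (∑-+ xs (λ y → f y x) (λ y → ∑ xs (f y)))) , tt)))

  ∑∑-↭ : ∀ {xs ys : List A} (f : A → A → ℕ) → xs ↭ ys →
    (∑[ x ∈ xs ] ∑[ y ∈ xs ] f x y) ≡ (∑[ x ∈ ys ] ∑[ y ∈ ys ] f x y)
  ∑∑-↭ {xs = xs} f p = ≡.trans (∑-cong xs (λ x → ∑-↭ (f x) p)) (∑-↭ _ p)

  -- One step in the enumeration of injections: a value for the next element, with the values left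
  -- for the others.
  picks : List A → List (A × List A)
  picks []       = []
  picks (x ∷ xs) = (x , xs) ∷ map (λ (y , ys) → y , x ∷ ys) (picks xs)

  picks⇒↭ : ∀ {p} → p ∈ picks xs → xs ↭ proj₁ p ∷ proj₂ p
  picks⇒↭ {xs = x ∷ xs} (here ≡.refl) = refl
  picks⇒↭ {xs = x ∷ xs} (there i) with ∈-map⁻ _ i
  ... | (y , ys) , j , ≡.refl = trans (prep x (picks⇒↭ j)) (swap x y refl)

  ∑-picks : ∀ (xs : List A) (f : A → ℕ) → (∑[ p ∈ picks xs ] f (proj₁ p)) ≡ ∑ xs f
  ∑-picks []       f = ≡.refl
  ∑-picks (x ∷ xs) f = cong (f x +_) (≡.trans (∑-map _ (picks xs) _) (∑-picks xs f))

  length-picks : ∀ (xs : List A) → length (picks xs) ≡ length xs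
  length-picks xs = ≡.trans (sym (*-identityʳ _)) (≡.trans (sym (∑-const (picks xs) 1))
    (≡.trans (∑-picks xs (λ _ → 1)) (≡.trans (∑-const xs 1) (*-identityʳ _))))

open Sums

-- Sums over all injections

picks-length : ∀ {A : Set} {xs : List A} {p} → p ∈ picks xs → length (proj₂ p) ≡ length xs ∸ 1
picks-length i = sym (cong (_∸ 1) (↭-length (picks⇒↭ i)))

private
  mult : ∀ (S T N j : ℕ) → S + j * T ≡ N * T → S ≤ (N ∸ j) * T
  mult S T N j eq = ≤-trans (≤-reflexive (≡.trans (sym (m+n∸n≡m S (j * T))) (cong (_∸ j * T) eq)))
    (≤-reflexive (sym (*-distribʳ-∸ T N j)))

module _ {A : Set} where

  -- Each element is missing from exactly one remainder, so the left side plus `∑ xs f` is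
  -- `length xs * ∑ xs f`.
  picks-∑ : ∀ (xs : List A) f → (∑[ p ∈ picks xs ] ∑ (proj₂ p) f) ≤ (length xs ∸ 1) * ∑ xs f
  picks-∑ xs f = mult S T N 1 (≤-antisym
      (lin (S ∷ T ∷ (N * T) ∷ (∑[ p ∈ picks xs ] f (proj₁ p) + ∑ (proj₂ p) f) ∷ (∑[ p ∈ picks xs ] f (proj₁ p)) ∷ [])
        (λ S T NT s t → (t :+ S :≤ s) ∷ (T :≤ t) ∷ (s :≤ NT) ∷ [] ⇒ S :+ con 1 :* T :≤ NT)
        0 (1 ∷ 1 ∷ 1 ∷ [])
        (≤-reflexive (sym (∑-+ (picks xs) (λ p → f (proj₁ p)) (λ p → ∑ (proj₂ p) f))) ,
            ≤-reflexive (sym (∑-picks xs f)) , ≤-reflexive total , tt))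
      (lin (S ∷ T ∷ (N * T) ∷ (∑[ p ∈ picks xs ] f (proj₁ p) + ∑ (proj₂ p) f) ∷ (∑[ p ∈ picks xs ] f (proj₁ p)) ∷ [])
        (λ S T NT s t → (s :≤ t :+ S) ∷ (t :≤ T) ∷ (NT :≤ s) ∷ [] ⇒ NT :≤ S :+ con 1 :* T)
        0 (1 ∷ 1 ∷ 1 ∷ [])
        (≤-reflexive (∑-+ (picks xs) (λ p → f (proj₁ p)) (λ p → ∑ (proj₂ p) f)) , ≤-reflexive (∑-picks xs f) ,
            ≤-reflexive (sym total) , tt)))
    where
    S = ∑[ p ∈ picks xs ] ∑ (proj₂ p) f
    T = ∑ xs f
    N = length xs
    total : (∑[ p ∈ picks xs ] f (proj₁ p) + ∑ (proj₂ p) f) ≡ N * T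
    total = ≡.trans (∑-cong-∈ (picks xs) (λ i → sym (∑-↭ f (picks⇒↭ i))))
      (≡.trans (∑-const (picks xs) T) (cong (_* T) (length-picks xs)))

  -- A pair of distinct elements is destroyed by exactly two choices; the vanishing diagonal
  -- disposes of the pairs that only one choice destroys.
  picks-∑∑ : ∀ (xs : List A) (f : A → A → ℕ) → (∀ x → f x x ≡ 0) →
    (∑[ p ∈ picks xs ] ∑[ y ∈ proj₂ p ] ∑[ z ∈ proj₂ p ] f y z) ≤ (length xs ∸ 2) * (∑[ y ∈ xs ] ∑[ z ∈ xs ] f y z)
  picks-∑∑ xs f 0f = mult S T N 2 (≤-antisym
      (lin (S ∷ T ∷ (N * T) ∷ (∑[ p ∈ picks xs ] r p + c p) ∷ (∑[ p ∈ picks xs ] r p) ∷ (∑[ p ∈ picks xs ] c p) ∷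
          (∑[ p ∈ picks xs ] r p + c p + s p) ∷ [])
        (λ S T NT a b d s → (a :+ S :≤ s) ∷ (b :+ d :≤ a) ∷ (T :≤ b) ∷ (T :≤ d) ∷ (s :≤ NT) ∷ [] ⇒
            S :+ con 2 :* T :≤ NT)
        0 (1 ∷ 1 ∷ 1 ∷ 1 ∷ 1 ∷ [])
        (≤-reflexive (sym (∑-+ (picks xs) (λ p → r p + c p) s)) , ≤-reflexive (sym (∑-+ (picks xs) r c)) ,
            ≤-reflexive (sym rows) , ≤-reflexive (sym cols) , ≤-reflexive total , tt))
      (lin (S ∷ T ∷ (N * T) ∷ (∑[ p ∈ picks xs ] r p + c p) ∷ (∑[ p ∈ picks xs ] r p) ∷ (∑[ p ∈ picks xs ] c p) ∷
          (∑[ p ∈ picks xs ] r p + c p + s p) ∷ [])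
        (λ S T NT a b d s → (s :≤ a :+ S) ∷ (a :≤ b :+ d) ∷ (b :≤ T) ∷ (d :≤ T) ∷ (NT :≤ s) ∷ [] ⇒
            NT :≤ S :+ con 2 :* T)
        0 (1 ∷ 1 ∷ 1 ∷ 1 ∷ 1 ∷ [])
        (≤-reflexive (∑-+ (picks xs) (λ p → r p + c p) s) , ≤-reflexive (∑-+ (picks xs) r c) , ≤-reflexive rows ,
            ≤-reflexive cols , ≤-reflexive (sym total) , tt)))
    where
    r c s : A × List A → ℕ
    r p = ∑ xs (f (proj₁ p))
    c p = ∑[ y ∈ xs ] f y (proj₁ p)
    s p = ∑[ y ∈ proj₂ p ] ∑[ z ∈ proj₂ p ] f y z
    S = ∑ (picks xs) s
    T = ∑[ y ∈ xs ] ∑[ z ∈ xs ] f y z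
    N = length xs
    rows : ∑ (picks xs) r ≡ T
    rows = ∑-picks xs (λ x → ∑ xs (f x))
    cols : ∑ (picks xs) c ≡ T
    cols = ≡.trans (∑-picks xs (λ x → ∑[ y ∈ xs ] f y x)) (∑-swap xs xs (λ x y → f y x))
    split : ∀ {p} → p ∈ picks xs → r p + c p + s p ≡ T
    split {x , ys} i = (≤-antisym
        (lin ((r (x , ys)) ∷ (c (x , ys)) ∷ (s (x , ys)) ∷ T ∷ (f x x) ∷ (∑ ys (f x)) ∷ (∑[ y ∈ ys ] f y x) ∷
            (∑[ y ∈ ys ] f x y + f y x) ∷ (∑[ y ∈ x ∷ ys ] ∑[ z ∈ x ∷ ys ] f y z) ∷ [])
          (λ r c s T o a b ab t → (o :≤ con 0) ∷ (r :≤ o :+ a) ∷ (c :≤ o :+ b) ∷ (t :≤ T) ∷ (o :+ ab :+ s :≤ t) ∷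
              (a :+ b :≤ ab) ∷ [] ⇒ r :+ c :+ s :≤ T)
          0 (1 ∷ 1 ∷ 1 ∷ 1 ∷ 1 ∷ 1 ∷ [])
          (≤-reflexive (0f x) , ≤-reflexive (∑-↭ (f x) (picks⇒↭ i)) , ≤-reflexive (∑-↭ (λ y → f y x) (picks⇒↭ i)) ,
              ≤-reflexive (sym (∑∑-↭ f (picks⇒↭ i))) , ≤-reflexive (sym (∑∑-∷ x ys f)) ,
              ≤-reflexive (sym (∑-+ ys (f x) (λ y → f y x))) , tt))
        (lin ((r (x , ys)) ∷ (c (x , ys)) ∷ (s (x , ys)) ∷ T ∷ (f x x) ∷ (∑ ys (f x)) ∷ (∑[ y ∈ ys ] f y x) ∷
            (∑[ y ∈ ys ] f x y + f y x) ∷ (∑[ y ∈ x ∷ ys ] ∑[ z ∈ x ∷ ys ] f y z) ∷ [])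
          (λ r c s T o a b ab t → (o :+ a :≤ r) ∷ (o :+ b :≤ c) ∷ (T :≤ t) ∷ (t :≤ o :+ ab :+ s) ∷ (ab :≤ a :+ b) ∷
              [] ⇒ T :≤ r :+ c :+ s)
          0 (1 ∷ 1 ∷ 1 ∷ 1 ∷ 1 ∷ [])
          (≤-reflexive (sym (∑-↭ (f x) (picks⇒↭ i))) , ≤-reflexive (sym (∑-↭ (λ y → f y x) (picks⇒↭ i))) ,
              ≤-reflexive (∑∑-↭ f (picks⇒↭ i)) , ≤-reflexive (∑∑-∷ x ys f) ,
              ≤-reflexive (∑-+ ys (f x) (λ y → f y x)) , tt)))
    total : (∑[ p ∈ picks xs ] r p + c p + s p) ≡ N * T
    total = ≡.trans (∑-cong-∈ (picks xs) split) (≡.trans (∑-const (picks xs) T) (cong (_* T) (length-picks xs)))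

  ∑∑∑-∷ : ∀ (x : A) xs (f : A → A → A → ℕ) →
    (∀ y z → f y y z ≡ 0) → (∀ y z → f y z y ≡ 0) → (∀ y z → f z y y ≡ 0) →
    (∑[ w ∈ x ∷ xs ] ∑[ y ∈ x ∷ xs ] ∑[ z ∈ x ∷ xs ] f w y z) ≡
    (∑[ y ∈ xs ] ∑[ z ∈ xs ] f x y z + f y x z + f y z x) + (∑[ w ∈ xs ] ∑[ y ∈ xs ] ∑[ z ∈ xs ] f w y z)
  ∑∑∑-∷ x xs f f₁ f₂ f₃ = begin
    (∑[ y ∈ x ∷ xs ] ∑[ z ∈ x ∷ xs ] f x y z) + (∑[ w ∈ xs ] ∑[ y ∈ x ∷ xs ] ∑[ z ∈ x ∷ xs ] f w y z)
      ≡⟨ cong₂ _+_ first (∑-cong xs rest) ⟩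
    X + (∑[ w ∈ xs ] Y w + Z w + W w)
      ≡⟨ cong (X +_) (≡.trans (∑-+ xs (λ w → Y w + Z w) W) (cong (_+ ∑ xs W) (∑-+ xs Y Z))) ⟩
    X + (∑ xs Y + ∑ xs Z + ∑ xs W)
      ≡⟨ (≤-antisym
          (lin (X ∷ (∑ xs Y) ∷ (∑ xs Z) ∷ (∑ xs W) ∷ [])
            (λ X y z w → [] ⇒ X :+ (y :+ z :+ w) :≤ X :+ y :+ z :+ w)
            0 []
            tt)
          (lin (X ∷ (∑ xs Y) ∷ (∑ xs Z) ∷ (∑ xs W) ∷ [])
            (λ X y z w → [] ⇒ X :+ y :+ z :+ w :≤ X :+ (y :+ z :+ w))
            0 []
            tt)) ⟩
    X + ∑ xs Y + ∑ xs Z + ∑ xs W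
      ≡⟨ cong (_+ ∑ xs W) (sym gather) ⟩
    (∑[ y ∈ xs ] ∑[ z ∈ xs ] f x y z + f y x z + f y z x) + ∑ xs W ∎
    where
    open ≡.≡-Reasoning
    X = ∑[ y ∈ xs ] ∑[ z ∈ xs ] f x y z
    Y Z W : A → ℕ
    Y w = ∑[ z ∈ xs ] f w x z
    Z w = ∑[ y ∈ xs ] f w y x
    W w = ∑[ y ∈ xs ] ∑[ z ∈ xs ] f w y z
    first : (∑[ y ∈ x ∷ xs ] ∑[ z ∈ x ∷ xs ] f x y z) ≡ X
    first = (≤-antisym
        (lin ((∑[ y ∈ x ∷ xs ] ∑[ z ∈ x ∷ xs ] f x y z) ∷ X ∷ (f x x x) ∷ (∑[ y ∈ xs ] f x x y + f x y x) ∷ [])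
          (λ a X o m → (a :≤ o :+ m :+ X) ∷ (o :≤ con 0) ∷ (m :≤ con 0) ∷ [] ⇒ a :≤ X)
          0 (1 ∷ 1 ∷ 1 ∷ [])
          (≤-reflexive (∑∑-∷ x xs (f x)) , ≤-reflexive (f₁ x x) ,
              ≤-reflexive (∑-zero-∈ xs (λ {y} _ → cong₂ _+_ (f₁ x y) (f₂ x y))) , tt))
        (lin ((∑[ y ∈ x ∷ xs ] ∑[ z ∈ x ∷ xs ] f x y z) ∷ X ∷ (f x x x) ∷ (∑[ y ∈ xs ] f x x y + f x y x) ∷ [])
          (λ a X o m → (o :+ m :+ X :≤ a) ∷ [] ⇒ X :≤ a)
          0 (1 ∷ [])
          (≤-reflexive (sym (∑∑-∷ x xs (f x))) , tt)))
    rest : ∀ w → (∑[ y ∈ x ∷ xs ] ∑[ z ∈ x ∷ xs ] f w y z) ≡ Y w + Z w + W w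
    rest w = (≤-antisym
        (lin ((∑[ y ∈ x ∷ xs ] ∑[ z ∈ x ∷ xs ] f w y z) ∷ (Y w) ∷ (Z w) ∷ (W w) ∷ (f w x x) ∷
            (∑[ y ∈ xs ] f w x y + f w y x) ∷ [])
          (λ a Y Z W o m → (a :≤ o :+ m :+ W) ∷ (o :≤ con 0) ∷ (m :≤ Y :+ Z) ∷ [] ⇒ a :≤ Y :+ Z :+ W)
          0 (1 ∷ 1 ∷ 1 ∷ [])
          (≤-reflexive (∑∑-∷ x xs (f w)) , ≤-reflexive (f₃ x w) , ≤-reflexive (∑-+ xs (f w x) (λ y → f w y x)) , tt))
        (lin ((∑[ y ∈ x ∷ xs ] ∑[ z ∈ x ∷ xs ] f w y z) ∷ (Y w) ∷ (Z w) ∷ (W w) ∷ (f w x x) ∷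
            (∑[ y ∈ xs ] f w x y + f w y x) ∷ [])
          (λ a Y Z W o m → (o :+ m :+ W :≤ a) ∷ (Y :+ Z :≤ m) ∷ [] ⇒ Y :+ Z :+ W :≤ a)
          0 (1 ∷ 1 ∷ [])
          (≤-reflexive (sym (∑∑-∷ x xs (f w))) , ≤-reflexive (sym (∑-+ xs (f w x) (λ y → f w y x))) , tt)))
    gather : (∑[ y ∈ xs ] ∑[ z ∈ xs ] f x y z + f y x z + f y z x) ≡ X + ∑ xs Y + ∑ xs Z
    gather = ≡.trans (∑-cong xs (λ y → ≡.trans (∑-+ xs (λ z → f x y z + f y x z) (λ z → f y z x))
        (cong (_+ Z y) (∑-+ xs (f x y) (f y x)))))
      (≡.trans (∑-+ xs (λ y → ∑ xs (f x y) + Y y) Z) (cong (_+ ∑ xs Z) (∑-+ xs (λ y → ∑ xs (f x y)) Y)))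

  -- As for pairs: three choices destroy a triple of distinct elements, and the other triples have
  -- weight 0.
  picks-∑∑∑ : ∀ (xs : List A) (f : A → A → A → ℕ) →
    (∀ y z → f y y z ≡ 0) → (∀ y z → f y z y ≡ 0) → (∀ y z → f z y y ≡ 0) →
    (∑[ p ∈ picks xs ] ∑[ w ∈ proj₂ p ] ∑[ y ∈ proj₂ p ] ∑[ z ∈ proj₂ p ] f w y z) ≤
    (length xs ∸ 3) * (∑[ w ∈ xs ] ∑[ y ∈ xs ] ∑[ z ∈ xs ] f w y z)
  picks-∑∑∑ xs f f₁ f₂ f₃ = mult S T N 3 (≤-antisym
      (lin (S ∷ T ∷ (N * T) ∷ (∑ (picks xs) a) ∷ (∑ (picks xs) b) ∷ (∑ (picks xs) c) ∷
          (∑[ p ∈ picks xs ] a p + b p) ∷ (∑[ p ∈ picks xs ] a p + b p + c p) ∷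
          (∑[ p ∈ picks xs ] a p + b p + c p + s p) ∷ [])
        (λ S T NT a b c ab abc s → (abc :+ S :≤ s) ∷ (ab :+ c :≤ abc) ∷ (a :+ b :≤ ab) ∷ (T :≤ a) ∷ (T :≤ b) ∷
            (T :≤ c) ∷ (s :≤ NT) ∷ [] ⇒ S :+ con 3 :* T :≤ NT)
        0 (1 ∷ 1 ∷ 1 ∷ 1 ∷ 1 ∷ 1 ∷ 1 ∷ [])
        (≤-reflexive (sym (∑-+ (picks xs) (λ p → a p + b p + c p) s)) ,
            ≤-reflexive (sym (∑-+ (picks xs) (λ p → a p + b p) c)) , ≤-reflexive (sym (∑-+ (picks xs) a b)) ,
            ≤-reflexive (sym as) , ≤-reflexive (sym bs) , ≤-reflexive (sym cs) , ≤-reflexive total , tt))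
      (lin (S ∷ T ∷ (N * T) ∷ (∑ (picks xs) a) ∷ (∑ (picks xs) b) ∷ (∑ (picks xs) c) ∷
          (∑[ p ∈ picks xs ] a p + b p) ∷ (∑[ p ∈ picks xs ] a p + b p + c p) ∷
          (∑[ p ∈ picks xs ] a p + b p + c p + s p) ∷ [])
        (λ S T NT a b c ab abc s → (s :≤ abc :+ S) ∷ (abc :≤ ab :+ c) ∷ (ab :≤ a :+ b) ∷ (a :≤ T) ∷ (b :≤ T) ∷
            (c :≤ T) ∷ (NT :≤ s) ∷ [] ⇒ NT :≤ S :+ con 3 :* T)
        0 (1 ∷ 1 ∷ 1 ∷ 1 ∷ 1 ∷ 1 ∷ 1 ∷ [])
        (≤-reflexive (∑-+ (picks xs) (λ p → a p + b p + c p) s) , ≤-reflexive (∑-+ (picks xs) (λ p → a p + b p) c) ,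
            ≤-reflexive (∑-+ (picks xs) a b) , ≤-reflexive as , ≤-reflexive bs , ≤-reflexive cs ,
            ≤-reflexive (sym total) , tt)))
    where
    a b c s : A × List A → ℕ
    a p = ∑[ y ∈ xs ] ∑[ z ∈ xs ] f (proj₁ p) y z
    b p = ∑[ y ∈ xs ] ∑[ z ∈ xs ] f y (proj₁ p) z
    c p = ∑[ y ∈ xs ] ∑[ z ∈ xs ] f y z (proj₁ p)
    s p = ∑[ w ∈ proj₂ p ] ∑[ y ∈ proj₂ p ] ∑[ z ∈ proj₂ p ] f w y z
    S = ∑ (picks xs) s
    T = ∑[ w ∈ xs ] ∑[ y ∈ xs ] ∑[ z ∈ xs ] f w y z
    N = length xs
    as : ∑ (picks xs) a ≡ T
    as = ∑-picks xs (λ x → ∑[ y ∈ xs ] ∑[ z ∈ xs ] f x y z)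
    bs : ∑ (picks xs) b ≡ T
    bs = ≡.trans (∑-picks xs (λ x → ∑[ y ∈ xs ] ∑[ z ∈ xs ] f y x z)) (∑-swap xs xs (λ x y → ∑ xs (f y x)))
    cs : ∑ (picks xs) c ≡ T
    cs = ≡.trans (∑-picks xs (λ x → ∑[ y ∈ xs ] ∑[ z ∈ xs ] f y z x))
        (≡.trans (∑-swap xs xs (λ x y → ∑[ z ∈ xs ] f y z x))
      (∑-cong xs (λ y → ∑-swap xs xs (λ x z → f y z x))))
    off : ∀ {x ys} → xs ↭ x ∷ ys → (k : A → A → ℕ) → k x x ≡ 0 → (∀ y → k x y ≡ 0) → (∀ y → k y x ≡ 0) →
      (∑[ y ∈ xs ] ∑[ z ∈ xs ] k y z) ≡ (∑[ y ∈ ys ] ∑[ z ∈ ys ] k y z)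
    off {x} {ys} p k k₀ k₁ k₂ = (≤-antisym
        (lin ((∑[ y ∈ xs ] ∑[ z ∈ xs ] k y z) ∷ (∑[ y ∈ x ∷ ys ] ∑[ z ∈ x ∷ ys ] k y z) ∷
            (∑[ y ∈ ys ] ∑[ z ∈ ys ] k y z) ∷ (k x x) ∷ (∑[ y ∈ ys ] k x y + k y x) ∷ [])
          (λ l m r o t → (l :≤ m) ∷ (m :≤ o :+ t :+ r) ∷ (o :≤ con 0) ∷ (t :≤ con 0) ∷ [] ⇒ l :≤ r)
          0 (1 ∷ 1 ∷ 1 ∷ 1 ∷ [])
          (≤-reflexive (∑∑-↭ k p) , ≤-reflexive (∑∑-∷ x ys k) , ≤-reflexive k₀ ,
              ≤-reflexive (∑-zero-∈ ys (λ {y} _ → cong₂ _+_ (k₁ y) (k₂ y))) , tt))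
        (lin ((∑[ y ∈ xs ] ∑[ z ∈ xs ] k y z) ∷ (∑[ y ∈ x ∷ ys ] ∑[ z ∈ x ∷ ys ] k y z) ∷
            (∑[ y ∈ ys ] ∑[ z ∈ ys ] k y z) ∷ (k x x) ∷ (∑[ y ∈ ys ] k x y + k y x) ∷ [])
          (λ l m r o t → (m :≤ l) ∷ (o :+ t :+ r :≤ m) ∷ [] ⇒ r :≤ l)
          0 (1 ∷ 1 ∷ [])
          (≤-reflexive (sym (∑∑-↭ k p)) , ≤-reflexive (sym (∑∑-∷ x ys k)) , tt)))
    split : ∀ {p} → p ∈ picks xs → a p + b p + c p + s p ≡ T
    split {x , ys} i = (≤-antisym
        (lin ((a (x , ys)) ∷ (b (x , ys)) ∷ (c (x , ys)) ∷ (s (x , ys)) ∷ T ∷ (∑[ y ∈ ys ] ∑ ys (f x y)) ∷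
            (∑[ y ∈ ys ] ∑ ys (f y x)) ∷ (∑[ y ∈ ys ] ∑[ z ∈ ys ] f y z x) ∷
            (∑[ y ∈ ys ] ∑[ z ∈ ys ] f x y z + f y x z + f y z x) ∷
            (∑[ w ∈ x ∷ ys ] ∑[ y ∈ x ∷ ys ] ∑[ z ∈ x ∷ ys ] f w y z) ∷ [])
          (λ a b c s T a′ b′ c′ d t → (a :≤ a′) ∷ (b :≤ b′) ∷ (c :≤ c′) ∷ (t :≤ T) ∷ (d :+ s :≤ t) ∷
              (a′ :+ b′ :+ c′ :≤ d) ∷ [] ⇒ a :+ b :+ c :+ s :≤ T)
          0 (1 ∷ 1 ∷ 1 ∷ 1 ∷ 1 ∷ 1 ∷ [])
          (≤-reflexive (off p (f x) (f₁ x x) (f₁ x) (f₂ x)) ,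
              ≤-reflexive (off p (λ y z → f y x z) (f₁ x x) (f₁ x) (λ y → f₃ x y)) ,
              ≤-reflexive (off p (λ y z → f y z x) (f₁ x x) (f₂ x) (λ y → f₃ x y)) , ≤-reflexive (sym T≡t) ,
              ≤-reflexive (sym (∑∑∑-∷ x ys f f₁ f₂ f₃)) , ≤-reflexive (sym d≡) , tt))
        (lin ((a (x , ys)) ∷ (b (x , ys)) ∷ (c (x , ys)) ∷ (s (x , ys)) ∷ T ∷ (∑[ y ∈ ys ] ∑ ys (f x y)) ∷
            (∑[ y ∈ ys ] ∑ ys (f y x)) ∷ (∑[ y ∈ ys ] ∑[ z ∈ ys ] f y z x) ∷
            (∑[ y ∈ ys ] ∑[ z ∈ ys ] f x y z + f y x z + f y z x) ∷
            (∑[ w ∈ x ∷ ys ] ∑[ y ∈ x ∷ ys ] ∑[ z ∈ x ∷ ys ] f w y z) ∷ [])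
          (λ a b c s T a′ b′ c′ d t → (a′ :≤ a) ∷ (b′ :≤ b) ∷ (c′ :≤ c) ∷ (T :≤ t) ∷ (t :≤ d :+ s) ∷
              (d :≤ a′ :+ b′ :+ c′) ∷ [] ⇒ T :≤ a :+ b :+ c :+ s)
          0 (1 ∷ 1 ∷ 1 ∷ 1 ∷ 1 ∷ 1 ∷ [])
          (≤-reflexive (sym (off p (f x) (f₁ x x) (f₁ x) (f₂ x))) ,
              ≤-reflexive (sym (off p (λ y z → f y x z) (f₁ x x) (f₁ x) (λ y → f₃ x y))) ,
              ≤-reflexive (sym (off p (λ y z → f y z x) (f₁ x x) (f₂ x) (λ y → f₃ x y))) , ≤-reflexive T≡t ,
              ≤-reflexive (∑∑∑-∷ x ys f f₁ f₂ f₃) , ≤-reflexive d≡ , tt)))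
      where
      p = picks⇒↭ i
      T≡t : T ≡ (∑[ w ∈ x ∷ ys ] ∑[ y ∈ x ∷ ys ] ∑[ z ∈ x ∷ ys ] f w y z)
      T≡t = ≡.trans (∑-cong xs (λ w → ∑∑-↭ (f w) p)) (∑-↭ _ p)
      d≡ : (∑[ y ∈ ys ] ∑[ z ∈ ys ] f x y z + f y x z + f y z x) ≡
        (∑[ y ∈ ys ] ∑ ys (f x y)) + (∑[ y ∈ ys ] ∑ ys (f y x)) + (∑[ y ∈ ys ] ∑[ z ∈ ys ] f y z x)
      d≡ = ≡.trans (∑-cong ys (λ y → ≡.trans (∑-+ ys (λ z → f x y z + f y x z) (λ z → f y z x))
          (cong (_+ (∑[ z ∈ ys ] f y z x)) (∑-+ ys (f x y) (f y x)))))
        (≡.trans (∑-+ ys (λ y → ∑ ys (f x y) + ∑ ys (f y x)) (λ y → ∑[ z ∈ ys ] f y z x))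
          (cong (_+ (∑[ y ∈ ys ] ∑[ z ∈ ys ] f y z x)) (∑-+ ys (λ y → ∑ ys (f x y)) (λ y → ∑ ys (f y x)))))
    total : (∑[ p ∈ picks xs ] a p + b p + c p + s p) ≡ N * T
    total = ≡.trans (∑-cong-∈ (picks xs) split) (≡.trans (∑-const (picks xs) T) (cong (_* T) (length-picks xs)))

  picks-⊆ : ∀ {xs : List A} {p} (f : A → ℕ) → p ∈ picks xs → ∑ (proj₂ p) f ≤ ∑ xs f
  picks-⊆ {p = p} f i = ≤-trans (m≤n+m _ (f (proj₁ p))) (≤-reflexive (sym (∑-↭ f (picks⇒↭ i))))

-- The number of injections of a k-set into an n-set; ff₁, ff₂ and ff₃ count those
-- with one, two or three prescribed values.
ff ff₁ ff₂ ff₃ : ℕ → ℕ → ℕ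
ff zero    n = 1
ff (suc k) n = n * ff k (n ∸ 1)
ff₁ zero    n = 0
ff₁ (suc k) n = ff k (n ∸ 1)
ff₂ zero    n = 0
ff₂ (suc k) n = ff₁ k (n ∸ 1)
ff₃ zero    n = 0
ff₃ (suc k) n = ff₂ k (n ∸ 1)

-- The first element takes one of the `n ∸ 1` values that are not prescribed. Equality fails only
-- for `k = 0`, where nothing can be prescribed.
ff₁-step : ∀ k n → (n ∸ 1) * ff₁ k (n ∸ 1) ≤ ff₁ (suc k) n
ff₁-step zero    n = ≤-trans (≤-reflexive (*-zeroʳ (n ∸ 1))) z≤n
ff₁-step (suc k) n = ≤-refl

ff₂-step : ∀ k n → (n ∸ 1 ∸ 1) * ff₂ k (n ∸ 1) ≤ ff₂ (suc k) n
ff₂-step zero    n = ≤-trans (≤-reflexive (*-zeroʳ (n ∸ 1 ∸ 1))) z≤n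
ff₂-step (suc k) n = ff₁-step k (n ∸ 1)

ff₃-step : ∀ k n → (n ∸ 1 ∸ 1 ∸ 1) * ff₃ k (n ∸ 1) ≤ ff₃ (suc k) n
ff₃-step zero    n = ≤-trans (≤-reflexive (*-zeroʳ (n ∸ 1 ∸ 1 ∸ 1))) z≤n
ff₃-step (suc k) n = ff₂-step k (n ∸ 1)

module _ {A B : Set} where

  Al : Set
  Al = List (A × B)

  -- The sum of Y over all injections of us into ps, an injection being recorded as a list of pairs.
  𝔼 : List A → List B → (Al → ℕ) → ℕ
  𝔼 []       ps Y = Y []
  𝔼 (u ∷ us) ps Y = ∑[ pk ∈ picks ps ] 𝔼 us (proj₂ pk) (λ al → Y ((u , proj₁ pk) ∷ al))

  𝔼-cong : ∀ us ps {Y Z : Al → ℕ} → (∀ al → Y al ≡ Z al) → 𝔼 us ps Y ≡ 𝔼 us ps Z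
  𝔼-cong []       ps eq = eq []
  𝔼-cong (u ∷ us) ps eq = ∑-cong (picks ps) (λ pk → 𝔼-cong us (proj₂ pk) (λ al → eq _))

  𝔼-+ : ∀ us ps (Y Z : Al → ℕ) → 𝔼 us ps (λ al → Y al + Z al) ≡ 𝔼 us ps Y + 𝔼 us ps Z
  𝔼-+ []       ps Y Z = ≡.refl
  𝔼-+ (u ∷ us) ps Y Z = ≡.trans (∑-cong (picks ps) (λ pk → 𝔼-+ us (proj₂ pk) _ _)) (∑-+ (picks ps) _ _)

  𝔼-* : ∀ us ps c (Y : Al → ℕ) → 𝔼 us ps (λ al → c * Y al) ≡ c * 𝔼 us ps Y
  𝔼-* []       ps c Y = ≡.refl
  𝔼-* (u ∷ us) ps c Y = ≡.trans (∑-cong (picks ps) (λ pk → 𝔼-* us (proj₂ pk) c _)) (∑-*ˡ (picks ps) c _)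

  𝔼-const : ∀ us ps c → 𝔼 us ps (λ _ → c) ≡ ff (length us) (length ps) * c
  𝔼-const []       ps c = sym (*-identityˡ c)
  𝔼-const (u ∷ us) ps c = begin
    (∑[ pk ∈ picks ps ] 𝔼 us (proj₂ pk) (λ _ → c))
      ≡⟨ ∑-cong-∈ (picks ps) (λ {pk} i → ≡.trans (𝔼-const us (proj₂ pk) c)
          (cong (λ n → ff (length us) n * c) (picks-length i))) ⟩
    (∑[ pk ∈ picks ps ] ff (length us) (length ps ∸ 1) * c)
      ≡⟨ ≡.trans (∑-const (picks ps) _) (cong (_* (ff (length us) (length ps ∸ 1) * c)) (length-picks ps)) ⟩
    length ps * (ff (length us) (length ps ∸ 1) * c)
      ≡⟨ sym (*-assoc (length ps) _ c) ⟩
    length ps * ff (length us) (length ps ∸ 1) * c ∎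
    where open ≡.≡-Reasoning

  record Injects (us : List A) (ps : List B) (al : Al) : Set where
    constructor injects
    field
      rest    : List B
      firsts  : map proj₁ al ≡ us
      seconds : ps ↭ map proj₂ al ++ rest

  -- First moment method. Comparing two sums, instead of an average with a number, avoids division
  -- by the number of injections.
  𝔼⇒∃ : ∀ us ps (Y Z : Al → ℕ) → 𝔼 us ps Y < 𝔼 us ps Z → ∃ λ al → Injects us ps al × Y al < Z al
  𝔼⇒∃ []       ps Y Z lt = [] , injects ps ≡.refl refl , lt
  𝔼⇒∃ (u ∷ us) ps Y Z lt with ∑<⇒∃< (picks ps) _ _ lt
  ... | (p , ps′) , i , lt′ with 𝔼⇒∃ us ps′ _ _ lt′
  ...   | al , injects r e q , lt″ = (u , p) ∷ al , injects r (cong (u ∷_) e) (↭-trans (picks⇒↭ i) (prep p q)) , lt″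

  private
    step : ∀ (ps : List B) n {F : B × List B → ℕ} {a : B × List B → ℕ} {X Y coef} →
      (∀ {pk} → pk ∈ picks ps → F pk ≤ coef * a pk) → ∑ (picks ps) a ≤ n * X → n * coef ≤ Y → ∑ (picks ps) F ≤ Y * X
    step ps n {F} {a} {X} {Y} {coef} le ale cle = begin
      ∑ (picks ps) F                 ≤⟨ ∑-mono-∈ (picks ps) le ⟩
      (∑[ pk ∈ picks ps ] coef * a pk) ≡⟨ ∑-*ˡ (picks ps) coef a ⟩
      coef * ∑ (picks ps) a          ≤⟨ *-monoʳ-≤ coef ale ⟩
      coef * (n * X)                 ≡⟨ ≡.trans (sym (*-assoc coef n X)) (cong (_* X) (*-comm coef n)) ⟩
      n * coef * X                   ≤⟨ *-monoˡ-≤ X cle ⟩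
      Y * X ∎
      where open ≤-Reasoning

    at : ∀ {ps : List B} {pk} (φ : ℕ → ℕ) {x} → pk ∈ picks ps → x ≤ φ (length (proj₂ pk)) → x ≤ φ (length ps ∸ 1)
    at φ {x} i le = ≡.subst (λ n → x ≤ φ n) (picks-length i) le

  -- Linearity: a pair (u , p) lies in `ff₁` of the injections, whatever u and p are.
  𝔼₁ : ∀ us ps (c : A × B → ℕ) →
    𝔼 us ps (λ al → ∑ al c) ≤ ff₁ (length us) (length ps) * (∑[ u ∈ us ] ∑[ p ∈ ps ] c (u , p))
  𝔼₁ []       ps c = z≤n
  𝔼₁ (u ∷ us) ps c = begin
    (∑[ pk ∈ picks ps ] 𝔼 us (proj₂ pk) (λ al → c (u , proj₁ pk) + ∑ al c))
      ≡⟨ ≡.trans (∑-cong (picks ps) (λ pk → 𝔼-+ us (proj₂ pk) _ _)) (∑-+ (picks ps) _ _) ⟩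
    (∑[ pk ∈ picks ps ] 𝔼 us (proj₂ pk) (λ _ → c (u , proj₁ pk))) + (∑[ pk ∈ picks ps ] 𝔼 us (proj₂ pk) (λ al → ∑ al c))
      ≤⟨ +-mono-≤ first second ⟩
    f * (∑[ p ∈ ps ] c (u , p)) + f * T
      ≡⟨ sym (*-distribˡ-+ f _ T) ⟩
    f * ((∑[ p ∈ ps ] c (u , p)) + T) ∎
    where
    open ≤-Reasoning
    f = ff (length us) (length ps ∸ 1)
    T = ∑[ v ∈ us ] ∑[ p ∈ ps ] c (v , p)
    first = begin
      (∑[ pk ∈ picks ps ] 𝔼 us (proj₂ pk) (λ _ → c (u , proj₁ pk)))
        ≤⟨ ∑-mono-∈ (picks ps) (λ {pk} i → at (λ n → ff (length us) n * c (u , proj₁ pk)) i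
            (≤-reflexive (𝔼-const us (proj₂ pk) _))) ⟩
      (∑[ pk ∈ picks ps ] f * c (u , proj₁ pk)) ≡⟨ ∑-*ˡ (picks ps) f _ ⟩
      f * (∑[ pk ∈ picks ps ] c (u , proj₁ pk)) ≡⟨ cong (f *_) (∑-picks ps (λ p → c (u , p))) ⟩
      f * (∑[ p ∈ ps ] c (u , p)) ∎
    second = step ps (length ps ∸ 1)
      (λ {pk} i → at (λ n → ff₁ (length us) n * (∑[ v ∈ us ] ∑[ p ∈ proj₂ pk ] c (v , p))) i (𝔼₁ us (proj₂ pk) c))
      (begin
        (∑[ pk ∈ picks ps ] ∑[ v ∈ us ] ∑[ p ∈ proj₂ pk ] c (v , p)) ≡⟨ ∑-swap (picks ps) us _ ⟩
        (∑[ v ∈ us ] ∑[ pk ∈ picks ps ] ∑[ p ∈ proj₂ pk ] c (v , p)) ≤⟨ ∑-mono us (λ v → picks-∑ ps (λ p → c (v , p))) ⟩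
        (∑[ v ∈ us ] (length ps ∸ 1) * (∑[ p ∈ ps ] c (v , p)))      ≡⟨ ∑-*ˡ us (length ps ∸ 1) _ ⟩
        (length ps ∸ 1) * T ∎)
      (ff₁-step (length us) (length ps))

  T₂ : List A → List B → (A × B → A × B → ℕ) → ℕ
  T₂ us ps c = ∑[ u ∈ us ] ∑[ v ∈ us ] ∑[ p ∈ ps ] ∑[ q ∈ ps ] c (u , p) (v , q)

  -- Two entries of an injection have distinct positions, so pairs with equal positions must not
  -- count; the hypothesis makes `c` vanish there, which also covers an entry paired with itself.
  -- Pairs with equal vertices stay in `T₂`, whence only an inequality.
  𝔼₂ : ∀ us ps (c : A × B → A × B → ℕ) → (∀ u v p → c (u , p) (v , p) ≡ 0) →
    𝔼 us ps (λ al → ∑[ e ∈ al ] ∑[ e′ ∈ al ] c e e′) ≤ ff₂ (length us) (length ps) * T₂ us ps c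
  𝔼₂ []       ps c 0c = z≤n
  𝔼₂ (u ∷ us) ps c 0c = begin
    (∑[ pk ∈ picks ps ] 𝔼 us (proj₂ pk) (λ al → ∑[ e ∈ (u , proj₁ pk) ∷ al ] ∑[ e′ ∈ (u , proj₁ pk) ∷ al ] c e e′))
      ≡⟨ ∑-cong (picks ps) (λ pk → ≡.trans (𝔼-cong us (proj₂ pk) (λ al → expand (proj₁ pk) al))
          (𝔼-+ us (proj₂ pk) _ _)) ⟩
    (∑[ pk ∈ picks ps ] 𝔼 us (proj₂ pk) (λ al → ∑ al (c′ (proj₁ pk))) + 𝔼 us (proj₂ pk) (λ al → ∑[ e ∈ al ] ∑ al (c e)))
      ≡⟨ ∑-+ (picks ps) _ _ ⟩
    (∑[ pk ∈ picks ps ] 𝔼 us (proj₂ pk) (λ al → ∑ al (c′ (proj₁ pk)))) + (∑[ pk ∈ picks ps ] 𝔼 us (proj₂ pk) (λ al →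
        ∑[ e ∈ al ] ∑ al (c e)))
      ≤⟨ +-mono-≤ first second ⟩
    f * D + f * T₂ us ps c
      ≡⟨ sym (*-distribˡ-+ f D _) ⟩
    f * (D + T₂ us ps c)
      ≤⟨ *-monoʳ-≤ f (≤-trans (≤-trans (m≤n+m _ (k u u)) (≤-reflexive (sym (+-assoc (k u u) D _))))
          (≤-reflexive (sym (∑∑-∷ u us k)))) ⟩
    f * T₂ (u ∷ us) ps c ∎
    where
    open ≤-Reasoning
    f = ff₁ (length us) (length ps ∸ 1)
    k : A → A → ℕ
    k v w = ∑[ p ∈ ps ] ∑[ q ∈ ps ] c (v , p) (w , q)
    D = ∑[ v ∈ us ] k u v + k v u
    c′ : B → A × B → ℕ
    c′ p e = c (u , p) e + c e (u , p)
    expand : ∀ p al → (∑[ e ∈ (u , p) ∷ al ] ∑[ e′ ∈ (u , p) ∷ al ] c e e′) ≡ ∑ al (c′ p) + (∑[ e ∈ al ] ∑ al (c e))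
    expand p al = ≡.trans (∑∑-∷ (u , p) al c) (cong (λ z → z + ∑ al (c′ p) + (∑[ e ∈ al ] ∑ al (c e))) (0c u u p))
    first = begin
      (∑[ pk ∈ picks ps ] 𝔼 us (proj₂ pk) (λ al → ∑ al (c′ (proj₁ pk))))
        ≤⟨ ∑-mono-∈ (picks ps) (λ {pk} i → ≤-trans
             (at (λ n → ff₁ (length us) n * (∑[ v ∈ us ] ∑[ q ∈ proj₂ pk ] c′ (proj₁ pk) (v , q))) i
                 (𝔼₁ us (proj₂ pk) (c′ (proj₁ pk))))
             (*-monoʳ-≤ f (∑-mono us (λ v → picks-⊆ (λ q → c′ (proj₁ pk) (v , q)) i)))) ⟩
      (∑[ pk ∈ picks ps ] f * (∑[ v ∈ us ] ∑[ q ∈ ps ] c′ (proj₁ pk) (v , q)))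
        ≡⟨ ≡.trans (∑-*ˡ (picks ps) f _) (cong (f *_) (∑-picks ps (λ p → ∑[ v ∈ us ] ∑[ q ∈ ps ] c′ p (v , q)))) ⟩
      f * (∑[ p ∈ ps ] ∑[ v ∈ us ] ∑[ q ∈ ps ] c′ p (v , q))
        ≡⟨ cong (f *_) (∑-swap ps us _) ⟩
      f * (∑[ v ∈ us ] ∑[ p ∈ ps ] ∑[ q ∈ ps ] c′ p (v , q))
        ≡⟨ cong (f *_) (∑-cong us (λ v → ≡.trans (∑-cong ps (λ p → ∑-+ ps _ _)) (≡.trans (∑-+ ps _ _)
             (cong (k u v +_) (∑-swap ps ps (λ p q → c (v , q) (u , p))))))) ⟩
      f * D ∎
    second = step ps (length ps ∸ 1 ∸ 1)
      (λ {pk} i → at (λ n → ff₂ (length us) n * T₂ us (proj₂ pk) c) i (𝔼₂ us (proj₂ pk) c 0c))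
      (begin
        (∑[ pk ∈ picks ps ] T₂ us (proj₂ pk) c)
          ≡⟨ ≡.trans (∑-swap (picks ps) us _) (∑-cong us (λ v → ∑-swap (picks ps) us _)) ⟩
        (∑[ v ∈ us ] ∑[ w ∈ us ] ∑[ pk ∈ picks ps ] ∑[ p ∈ proj₂ pk ] ∑[ q ∈ proj₂ pk ] c (v , p) (w , q))
          ≤⟨ ∑-mono us (λ v → ∑-mono us (λ w → picks-∑∑ ps (λ p q → c (v , p) (w , q)) (λ p → 0c v w p))) ⟩
        (∑[ v ∈ us ] ∑[ w ∈ us ] (length ps ∸ 2) * k v w)
          ≡⟨ ≡.trans (∑-cong us (λ v → ∑-*ˡ us (length ps ∸ 2) (k v))) (∑-*ˡ us (length ps ∸ 2) _) ⟩
        (length ps ∸ 2) * T₂ us ps c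
          ≡⟨ cong (_* T₂ us ps c) (sym (∸-+-assoc (length ps) 1 1)) ⟩
        (length ps ∸ 1 ∸ 1) * T₂ us ps c ∎)
      (ff₂-step (length us) (length ps))

  T₃ : List A → List B → (A × B → A × B → A × B → ℕ) → ℕ
  T₃ us ps c = ∑[ u ∈ us ] ∑[ v ∈ us ] ∑[ w ∈ us ] ∑[ p ∈ ps ] ∑[ q ∈ ps ] ∑[ r ∈ ps ] c (u , p) (v , q) (w , r)

  -- In `𝔼₃` the weight of a triple of vertices need not vanish for repeated vertices; the terms in
  -- which `x` occurs more than once are simply dropped.
  ∑∑∑-∷-≥ : ∀ (x : A) xs (f : A → A → A → ℕ) →
    (∑[ y ∈ xs ] ∑[ z ∈ xs ] f x y z + f y x z + f y z x) + (∑[ w ∈ xs ] ∑[ y ∈ xs ] ∑[ z ∈ xs ] f w y z) ≤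
    (∑[ w ∈ x ∷ xs ] ∑[ y ∈ x ∷ xs ] ∑[ z ∈ x ∷ xs ] f w y z)
  ∑∑∑-∷-≥ x xs f = begin
    (∑[ y ∈ xs ] ∑[ z ∈ xs ] f x y z + f y x z + f y z x) + ∑ xs W
      ≡⟨ cong (_+ ∑ xs W) gather ⟩
    X + ∑ xs Y + ∑ xs W
      ≡⟨ ≡.trans (+-assoc X _ _) (cong (X +_) (sym (∑-+ xs Y W))) ⟩
    X + (∑[ w ∈ xs ] Y w + W w)
      ≤⟨ +-mono-≤ (le x) (∑-mono xs (λ w → ge w)) ⟩
    (∑[ y ∈ x ∷ xs ] ∑[ z ∈ x ∷ xs ] f x y z) + (∑[ w ∈ xs ] ∑[ y ∈ x ∷ xs ] ∑[ z ∈ x ∷ xs ] f w y z) ∎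
    where
    open ≤-Reasoning
    X = ∑[ y ∈ xs ] ∑[ z ∈ xs ] f x y z
    Y W : A → ℕ
    Y y = ∑[ z ∈ xs ] f y x z + f y z x
    W w = ∑[ y ∈ xs ] ∑[ z ∈ xs ] f w y z
    gather : (∑[ y ∈ xs ] ∑[ z ∈ xs ] f x y z + f y x z + f y z x) ≡ X + ∑ xs Y
    gather = ≡.trans (∑-cong xs (λ y → ≡.trans (∑-cong xs (λ z → +-assoc (f x y z) _ _)) (∑-+ xs (f x y) _)))
        (∑-+ xs _ Y)
    ge : ∀ w → Y w + W w ≤ (∑[ y ∈ x ∷ xs ] ∑[ z ∈ x ∷ xs ] f w y z)
    ge w = ≤-trans (+-monoˡ-≤ (W w) (m≤n+m (Y w) (f w x x))) (≤-reflexive (sym (∑∑-∷ x xs (f w))))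
    le : ∀ w → W w ≤ (∑[ y ∈ x ∷ xs ] ∑[ z ∈ x ∷ xs ] f w y z)
    le w = ≤-trans (m≤n+m (W w) (Y w)) (ge w)

  𝔼₃ : ∀ us ps (c : A × B → A × B → A × B → ℕ) →
    (∀ u v w p q → c (u , p) (v , p) (w , q) ≡ 0) → (∀ u v w p q → c (u , p) (v , q) (w , p) ≡ 0) →
    (∀ u v w p q → c (u , q) (v , p) (w , p) ≡ 0) →
    𝔼 us ps (λ al → ∑[ e ∈ al ] ∑[ e′ ∈ al ] ∑[ e″ ∈ al ] c e e′ e″) ≤ ff₃ (length us) (length ps) * T₃ us ps c
  𝔼₃ []       ps c c₁ c₂ c₃ = z≤n
  𝔼₃ (u ∷ us) ps c c₁ c₂ c₃ = begin
    (∑[ pk ∈ picks ps ] 𝔼 us (proj₂ pk) (λ al → ∑[ x ∈ (u , proj₁ pk) ∷ al ] ∑[ y ∈ (u , proj₁ pk) ∷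
        al ] ∑[ z ∈ (u , proj₁ pk) ∷ al ] c x y z))
      ≡⟨ ∑-cong (picks ps) (λ pk → ≡.trans (𝔼-cong us (proj₂ pk) (λ al →
           ∑∑∑-∷ (u , proj₁ pk) al c (λ _ _ → c₁ _ _ _ _ _) (λ _ _ → c₂ _ _ _ _ _) (λ _ _ → c₃ _ _ _ _ _)))
               (𝔼-+ us (proj₂ pk) _ _)) ⟩
    (∑[ pk ∈ picks ps ] 𝔼 us (proj₂ pk) (λ al → ∑[ y ∈ al ] ∑ al (c′ (proj₁ pk) y)) + 𝔼 us (proj₂ pk) (λ al →
        ∑[ x ∈ al ] ∑[ y ∈ al ] ∑ al (c x y)))
      ≡⟨ ∑-+ (picks ps) _ _ ⟩
    (∑[ pk ∈ picks ps ] 𝔼 us (proj₂ pk) (λ al → ∑[ y ∈ al ] ∑ al (c′ (proj₁ pk) y))) + (∑[ pk ∈ picks ps ] 𝔼 us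
        (proj₂ pk) (λ al → ∑[ x ∈ al ] ∑[ y ∈ al ] ∑ al (c x y)))
      ≤⟨ +-mono-≤ first second ⟩
    f * D + f * T₃ us ps c
      ≡⟨ sym (*-distribˡ-+ f D _) ⟩
    f * (D + T₃ us ps c)
      ≤⟨ *-monoʳ-≤ f (∑∑∑-∷-≥ u us k) ⟩
    f * T₃ (u ∷ us) ps c ∎
    where
    open ≤-Reasoning
    f = ff₂ (length us) (length ps ∸ 1)
    k : A → A → A → ℕ
    k x y z = ∑[ p ∈ ps ] ∑[ q ∈ ps ] ∑[ r ∈ ps ] c (x , p) (y , q) (z , r)
    D = ∑[ v ∈ us ] ∑[ w ∈ us ] k u v w + k v u w + k v w u
    c′ : B → A × B → A × B → ℕ
    c′ p y z = c (u , p) y z + c y (u , p) z + c y z (u , p)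
    sum3 : ∀ (F G H : B → ℕ) → (∑[ q ∈ ps ] F q + G q + H q) ≡ ∑ ps F + ∑ ps G + ∑ ps H
    sum3 F G H = ≡.trans (∑-+ ps _ H) (cong (_+ ∑ ps H) (∑-+ ps F G))
    collect : ∀ v w → (∑[ p ∈ ps ] ∑[ q ∈ ps ] ∑[ r ∈ ps ] c′ p (v , q) (w , r)) ≡ k u v w + k v u w + k v w u
    collect v w = ≡.trans (∑-cong ps (λ p → ≡.trans (∑-cong ps (λ q → sum3 _ _ _)) (sum3 _ _ _))) (≡.trans (sum3 _ _ _)
      (cong₂ _+_ (cong (k u v w +_) (∑-swap ps ps (λ p q → ∑[ r ∈ ps ] c (v , q) (u , p) (w , r))))
        (≡.trans (∑-swap ps ps (λ p q → ∑[ r ∈ ps ] c (v , q) (w , r) (u , p)))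
          (∑-cong ps (λ q → ∑-swap ps ps (λ p r → c (v , q) (w , r) (u , p)))))))
    first = begin
      (∑[ pk ∈ picks ps ] 𝔼 us (proj₂ pk) (λ al → ∑[ y ∈ al ] ∑ al (c′ (proj₁ pk) y)))
        ≤⟨ ∑-mono-∈ (picks ps) (λ {pk} i → ≤-trans
             (at (λ n → ff₂ (length us) n * T₂ us (proj₂ pk) (c′ (proj₁ pk))) i
               (𝔼₂ us (proj₂ pk) (c′ (proj₁ pk)) (λ v w q → cong₂ _+_
                   (cong₂ _+_ (c₃ u v w q (proj₁ pk)) (c₂ v u w q (proj₁ pk))) (c₁ v w u q (proj₁ pk)))))
             (*-monoʳ-≤ f (∑-mono us (λ v → ∑-mono us (λ w → ≤-trans
               (picks-⊆ (λ q → ∑[ r ∈ proj₂ pk ] c′ (proj₁ pk) (v , q) (w , r)) i)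
               (∑-mono ps (λ q → picks-⊆ (λ r → c′ (proj₁ pk) (v , q) (w , r)) i))))))) ⟩
      (∑[ pk ∈ picks ps ] f * T₂ us ps (c′ (proj₁ pk)))
        ≡⟨ ≡.trans (∑-*ˡ (picks ps) f _) (cong (f *_) (∑-picks ps (λ p → T₂ us ps (c′ p)))) ⟩
      f * (∑[ p ∈ ps ] T₂ us ps (c′ p))
        ≡⟨ cong (f *_) (≡.trans (∑-swap ps us _) (∑-cong us (λ v → ∑-swap ps us _))) ⟩
      f * (∑[ v ∈ us ] ∑[ w ∈ us ] ∑[ p ∈ ps ] ∑[ q ∈ ps ] ∑[ r ∈ ps ] c′ p (v , q) (w , r))
        ≡⟨ cong (f *_) (∑-cong us (λ v → ∑-cong us (λ w → collect v w))) ⟩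
      f * D ∎
    second = step ps (length ps ∸ 1 ∸ 1 ∸ 1)
      (λ {pk} i → at (λ n → ff₃ (length us) n * T₃ us (proj₂ pk) c) i (𝔼₃ us (proj₂ pk) c c₁ c₂ c₃))
      (begin
        (∑[ pk ∈ picks ps ] T₃ us (proj₂ pk) c)
          ≡⟨ ≡.trans (∑-swap (picks ps) us _) (∑-cong us (λ v →
              ≡.trans (∑-swap (picks ps) us _) (∑-cong us (λ w → ∑-swap (picks ps) us _)))) ⟩
        (∑[ v ∈ us ] ∑[ w ∈ us ] ∑[ x ∈ us ] ∑[ pk ∈ picks ps ] ∑[ p ∈ proj₂ pk ] ∑[ q ∈ proj₂ pk ]
            ∑[ r ∈ proj₂ pk ] c (v , p) (w , q) (x , r))
          ≤⟨ ∑-mono us (λ v → ∑-mono us (λ w → ∑-mono us (λ x → picks-∑∑∑ ps (λ p q r → c (v , p) (w , q) (x , r))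
               (λ _ _ → c₁ _ _ _ _ _) (λ _ _ → c₂ _ _ _ _ _) (λ _ _ → c₃ _ _ _ _ _)))) ⟩
        (∑[ v ∈ us ] ∑[ w ∈ us ] ∑[ x ∈ us ] (length ps ∸ 3) * k v w x)
          ≡⟨ ≡.trans (∑-cong us (λ v → ≡.trans (∑-cong us (λ w → ∑-*ˡ us (length ps ∸ 3) (k v w)))
              (∑-*ˡ us (length ps ∸ 3) _))) (∑-*ˡ us (length ps ∸ 3) _) ⟩
        (length ps ∸ 3) * T₃ us ps c
          ≡⟨ cong (_* T₃ us ps c) (sym (≡.trans (cong (_∸ 1) (∸-+-assoc (length ps) 1 1))
              (∸-+-assoc (length ps) 2 1))) ⟩
        (length ps ∸ 1 ∸ 1 ∸ 1) * T₃ us ps c ∎)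
      (ff₃-step (length us) (length ps))

-- Degrees and arcs

module _ {V : Set} where

  outdeg indeg deg : (V → V → ℕ) → List V → V → ℕ
  outdeg g xs u = ∑[ v ∈ xs ] g u v
  indeg  g xs u = ∑[ v ∈ xs ] g v u
  deg    g xs u = outdeg g xs u + indeg g xs u

  arcs : (V → V → ℕ) → List V → ℕ
  arcs g xs = ∑ xs (outdeg g xs)

  ∑-indeg : ∀ (g : V → V → ℕ) xs → ∑ xs (indeg g xs) ≡ arcs g xs
  ∑-indeg g xs = ∑-swap xs xs (λ u v → g v u)

  ∑-deg : ∀ (g : V → V → ℕ) xs → ∑ xs (deg g xs) ≡ 2 * arcs g xs
  ∑-deg g xs = (≤-antisym
      (lin ((∑ xs (deg g xs)) ∷ (∑ xs (indeg g xs)) ∷ (arcs g xs) ∷ [])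
        (λ d i a → (d :≤ a :+ i) ∷ (i :≤ a) ∷ [] ⇒ d :≤ con 2 :* a)
        0 (1 ∷ 1 ∷ [])
        (≤-reflexive (∑-+ xs (outdeg g xs) (indeg g xs)) , ≤-reflexive (∑-indeg g xs) , tt))
      (lin ((∑ xs (deg g xs)) ∷ (∑ xs (indeg g xs)) ∷ (arcs g xs) ∷ [])
        (λ d i a → (a :+ i :≤ d) ∷ (a :≤ i) ∷ [] ⇒ con 2 :* a :≤ d)
        0 (1 ∷ 1 ∷ [])
        (≤-reflexive (sym (∑-+ xs (outdeg g xs) (indeg g xs))) , ≤-reflexive (sym (∑-indeg g xs)) , tt)))

  arcs-∷ : ∀ (g : V → V → ℕ) u xs → g u u ≡ 0 → arcs g (u ∷ xs) ≡ deg g xs u + arcs g xs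
  arcs-∷ g u xs 0g = (≤-antisym
      (lin ((arcs g (u ∷ xs)) ∷ (arcs g xs) ∷ (g u u) ∷ (outdeg g xs u) ∷ (indeg g xs u) ∷
          (∑[ v ∈ xs ] g u v + g v u) ∷ [])
        (λ a b o d e m → (a :≤ o :+ m :+ b) ∷ (o :≤ con 0) ∷ (m :≤ d :+ e) ∷ [] ⇒ a :≤ d :+ e :+ b)
        0 (1 ∷ 1 ∷ 1 ∷ [])
        (≤-reflexive (∑∑-∷ u xs g) , ≤-reflexive 0g , ≤-reflexive (∑-+ xs (g u) (λ v → g v u)) , tt))
      (lin ((arcs g (u ∷ xs)) ∷ (arcs g xs) ∷ (g u u) ∷ (outdeg g xs u) ∷ (indeg g xs u) ∷
          (∑[ v ∈ xs ] g u v + g v u) ∷ [])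
        (λ a b o d e m → (o :+ m :+ b :≤ a) ∷ (d :+ e :≤ m) ∷ [] ⇒ d :+ e :+ b :≤ a)
        0 (1 ∷ 1 ∷ [])
        (≤-reflexive (sym (∑∑-∷ u xs g)) , ≤-reflexive (sym (∑-+ xs (g u) (λ v → g v u))) , tt)))

  arcs-↭ : ∀ (g : V → V → ℕ) {xs ys} → xs ↭ ys → arcs g xs ≡ arcs g ys
  arcs-↭ g p = ∑∑-↭ g p

  deg-↭ : ∀ (g : V → V → ℕ) {xs ys} u → xs ↭ ys → deg g xs u ≡ deg g ys u
  deg-↭ g u p = cong₂ _+_ (∑-↭ (g u) p) (∑-↭ (λ v → g v u) p)

⟦_⟧ᵈ : ∀ {P : Set} → Dec P → ℕ
⟦ yes _ ⟧ᵈ = 1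
⟦ no  _ ⟧ᵈ = 0

⟦⟧ᵈ≤1 : ∀ {P : Set} (d : Dec P) → ⟦ d ⟧ᵈ ≤ 1
⟦⟧ᵈ≤1 (yes _) = ≤-refl
⟦⟧ᵈ≤1 (no  _) = z≤n

⟦⟧ᵈ≡0 : ∀ {P : Set} (d : Dec P) → ⟦ d ⟧ᵈ ≡ 0 → P → ⊥
⟦⟧ᵈ≡0 (no ¬p) _ = ¬p

Markov : ∀ {V : Set} (xs : List V) (f : V → ℕ) c → c * (∑[ x ∈ xs ] ⟦ c ≤? f x ⟧ᵈ) ≤ ∑ xs f
Markov xs f c = ≤-trans (≤-reflexive (sym (∑-*ˡ xs c _))) (∑-mono xs pointwise)
  where
  pointwise : ∀ x → c * ⟦ c ≤? f x ⟧ᵈ ≤ f x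
  pointwise x with c ≤? f x
  ... | yes p = ≤-trans (≤-reflexive (*-identityʳ c)) p
  ... | no  _ = ≤-trans (≤-reflexive (*-zeroʳ c)) z≤n

≤1-* : ∀ {a} b → a ≤ 1 → a * b ≤ b
≤1-* {zero}        b _ = z≤n
≤1-* {suc zero}    b _ = ≤-reflexive (+-identityʳ b)
≤1-* {suc (suc _)} b (s≤s ())

*-≡0 : ∀ {a b} → 0 < a → a * b ≡ 0 → b ≡ 0
*-≡0 {suc a} {zero} _ eq = ≡.refl

>0-* : ∀ {a} b → 0 < a → b ≤ a * b
>0-* {suc a} b _ = m≤m+n b (a * b)

>0-*ˡ : ∀ a b → 0 < a * b → 0 < a
>0-*ˡ (suc a) b _ = s≤s z≤n

>0-*ʳ : ∀ a b → 0 < a * b → 0 < b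
>0-*ʳ a (suc b) _ = s≤s z≤n
>0-*ʳ a zero    p = ⊥-elim (n≮0 (<-≤-trans p (≤-reflexive (*-zeroʳ a))))

>0-+ : ∀ a b → 0 < a + b → (a ≡ 0 → 0 < b)
>0-+ zero b p _ = p

module Lighter {n : ℕ} (d : Fin n → ℕ) where

  -- The endpoint of smaller degree, ties being broken by the vertex number.
  λ′ : Fin n → Fin n → ℕ
  λ′ v u with <-cmp (d v) (d u) | <-cmp (toℕ v) (toℕ u)
  ... | tri< _ _ _ | _          = 1
  ... | tri≈ _ _ _ | tri< _ _ _ = 1
  ... | tri≈ _ _ _ | _          = 0
  ... | tri> _ _ _ | _          = 0

  λ′-exclusive : ∀ v u → λ′ v u + λ′ u v ≤ 1
  λ′-exclusive v u with <-cmp (d v) (d u) | <-cmp (toℕ v) (toℕ u) | <-cmp (d u) (d v) | <-cmp (toℕ u) (toℕ v)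
  ... | tri< a _ _ | _ | tri< b _ _ | _ = ⊥-elim (<-asym a b)
  ... | tri< a _ _ | _ | tri≈ _ b _ | _ = ⊥-elim (<-irrefl (sym b) a)
  ... | tri< a _ _ | _ | tri> _ _ _ | _ = ≤-refl
  ... | tri≈ _ a _ | _ | tri< b _ _ | _ = ⊥-elim (<-irrefl (sym a) b)
  ... | tri≈ _ _ _ | tri< c _ _ | tri≈ _ _ _ | tri< e _ _ = ⊥-elim (<-asym c e)
  ... | tri≈ _ _ _ | tri< c _ _ | tri≈ _ _ _ | tri≈ _ _ _ = ≤-refl
  ... | tri≈ _ _ _ | tri< c _ _ | tri≈ _ _ _ | tri> _ _ _ = ≤-refl
  ... | tri≈ _ _ _ | tri≈ _ _ _ | tri≈ _ _ _ | tri< _ _ _ = ≤-refl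
  ... | tri≈ _ _ _ | tri≈ _ _ _ | tri≈ _ _ _ | tri≈ _ _ _ = z≤n
  ... | tri≈ _ _ _ | tri≈ _ _ _ | tri≈ _ _ _ | tri> _ _ _ = z≤n
  ... | tri≈ _ _ _ | tri> _ _ _ | tri≈ _ _ _ | tri< _ _ _ = ≤-refl
  ... | tri≈ _ _ _ | tri> _ _ _ | tri≈ _ _ _ | tri≈ _ _ _ = z≤n
  ... | tri≈ _ _ _ | tri> _ _ _ | tri≈ _ _ _ | tri> _ _ _ = z≤n
  ... | tri≈ _ _ _ | tri< _ _ _ | tri> _ _ _ | _ = ≤-refl
  ... | tri≈ _ _ _ | tri≈ _ _ _ | tri> _ _ _ | _ = z≤n
  ... | tri≈ _ _ _ | tri> _ _ _ | tri> _ _ _ | _ = z≤n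
  ... | tri> _ _ _ | _ | tri< _ _ _ | _ = ≤-refl
  ... | tri> _ _ _ | _ | tri≈ _ _ _ | tri< _ _ _ = ≤-refl
  ... | tri> _ _ _ | _ | tri≈ _ _ _ | tri≈ _ _ _ = z≤n
  ... | tri> _ _ _ | _ | tri≈ _ _ _ | tri> _ _ _ = z≤n
  ... | tri> _ _ _ | _ | tri> _ _ _ | _ = z≤n

  λ′-total : ∀ v u → v ≢ u → λ′ v u ≡ 0 → 0 < λ′ u v
  λ′-total v u v≢u eq with <-cmp (d v) (d u) | <-cmp (toℕ v) (toℕ u) | <-cmp (d u) (d v) | <-cmp (toℕ u) (toℕ v)
  ... | tri≈ _ a _ | _ | tri< b _ _ | _ = s≤s z≤n
  ... | tri≈ _ a _ | _ | tri> _ _ b | _ = ⊥-elim (<-irrefl a b)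
  ... | tri≈ _ _ _ | tri≈ _ c _ | tri≈ _ _ _ | _ = ⊥-elim (v≢u (Fin.toℕ-injective c))
  ... | tri≈ _ _ _ | tri> _ _ c | tri≈ _ _ _ | tri< _ _ _ = s≤s z≤n
  ... | tri≈ _ _ _ | tri> _ _ c | tri≈ _ _ _ | tri≈ c′ _ _ = ⊥-elim (c′ c)
  ... | tri≈ _ _ _ | tri> _ _ c | tri≈ _ _ _ | tri> c′ _ _ = ⊥-elim (c′ c)
  ... | tri> _ _ _ | _ | tri< _ _ _ | _ = s≤s z≤n
  ... | tri> _ _ a | _ | tri≈ b _ _ | _ = ⊥-elim (b a)
  ... | tri> _ _ a | _ | tri> b _ _ | _ = ⊥-elim (b a)

  λ′⇒≤ : ∀ v u → 0 < λ′ v u → d v ≤ d u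
  λ′⇒≤ v u pos with <-cmp (d v) (d u) | <-cmp (toℕ v) (toℕ u)
  ... | tri< a _ _ | _          = <⇒≤ a
  ... | tri≈ _ a _ | tri< _ _ _ = ≤-reflexive a

  -- Summing a symmetric weight over pairs with the lighter endpoint first counts every pair at most once.
  ∑∑-λ′ : ∀ {A : Set} (xs : List A) (π : A → Fin n) (f : A → A → ℕ) →
    (∑[ x ∈ xs ] ∑[ y ∈ xs ] λ′ (π x) (π y) * (f x y + f y x)) ≤ (∑[ x ∈ xs ] ∑[ y ∈ xs ] f x y)
  ∑∑-λ′ xs π f = begin
    (∑[ x ∈ xs ] ∑[ y ∈ xs ] λ′ (π x) (π y) * (f x y + f y x))
      ≡⟨ ∑-cong xs (λ x → ≡.trans (∑-cong xs (λ y → *-distribˡ-+ (λ′ (π x) (π y)) (f x y) (f y x))) (∑-+ xs _ _)) ⟩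
    (∑[ x ∈ xs ] (∑[ y ∈ xs ] λ′ (π x) (π y) * f x y) + (∑[ y ∈ xs ] λ′ (π x) (π y) * f y x))
      ≡⟨ ∑-+ xs _ _ ⟩
    (∑[ x ∈ xs ] ∑[ y ∈ xs ] λ′ (π x) (π y) * f x y) + (∑[ x ∈ xs ] ∑[ y ∈ xs ] λ′ (π x) (π y) * f y x)
      ≡⟨ cong ((∑[ x ∈ xs ] ∑[ y ∈ xs ] λ′ (π x) (π y) * f x y) +_) (∑-swap xs xs (λ x y → λ′ (π x) (π y) * f y x)) ⟩
    (∑[ x ∈ xs ] ∑[ y ∈ xs ] λ′ (π x) (π y) * f x y) + (∑[ x ∈ xs ] ∑[ y ∈ xs ] λ′ (π y) (π x) * f x y)
      ≡⟨ ≡.trans (sym (∑-+ xs _ _)) (∑-cong xs (λ x → ≡.trans (sym (∑-+ xs _ _))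
          (∑-cong xs (λ y → sym (*-distribʳ-+ (f x y) (λ′ (π x) (π y)) _))))) ⟩
    (∑[ x ∈ xs ] ∑[ y ∈ xs ] (λ′ (π x) (π y) + λ′ (π y) (π x)) * f x y)
      ≤⟨ ∑-mono xs (λ x → ∑-mono xs (λ y → ≤1-* (f x y) (λ′-exclusive (π x) (π y)))) ⟩
    (∑[ x ∈ xs ] ∑[ y ∈ xs ] f x y) ∎
    where open ≤-Reasoning

-- Layer-cake form of a degree: a sum weighted with degrees becomes a sum over thresholds, each of
-- which only asks how many vertices exceed it.
∑-threshold : ∀ D d → d ≤ D → (∑[ k ∈ upTo D ] ⟦ suc k ≤? d ⟧ᵈ) ≡ d
∑-threshold D d d≤D = ≡.trans (∑-upTo D) (m≥n⇒m⊓n≡n d≤D)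
  where
  open import Data.List.Properties using (upTo-∷ʳ)
  ∑-upTo : ∀ D → (∑[ k ∈ upTo D ] ⟦ suc k ≤? d ⟧ᵈ) ≡ D ⊓ d
  ∑-upTo zero    = ≡.refl
  ∑-upTo (suc D) = ≡.trans (cong (λ ks → ∑[ k ∈ ks ] ⟦ suc k ≤? d ⟧ᵈ) (sym (upTo-∷ʳ D)))
    (≡.trans (∑-++ (upTo D) (D ∷ []) _) (≡.trans (cong₂ _+_ (∑-upTo D) (+-identityʳ _)) (last D)))
    where
    last : ∀ D → D ⊓ d + ⟦ suc D ≤? d ⟧ᵈ ≡ suc D ⊓ d
    last D with suc D ≤? d
    ... | yes D<d = ≡.trans (cong (_+ 1) (m≤n⇒m⊓n≡m (<⇒≤ D<d))) (≡.trans (+-comm D 1) (sym (m≤n⇒m⊓n≡m D<d)))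
    ... | no  D≮d = ≡.trans (+-identityʳ _) (≡.trans (m≥n⇒m⊓n≡n (≮⇒≥ D≮d))
        (sym (m≥n⇒m⊓n≡n (≤-trans (≮⇒≥ D≮d) (n≤1+n D)))))

module _ {n : ℕ} (g : Fin n → Fin n → ℕ) (us : List (Fin n)) (g≤1 : ∀ u v → g u v ≤ 1) where

  open Lighter (deg g us)

  -- With nₖ vertices of degree > k, at most min (a, nₖ²) ≤ s nₖ arcs have both ends of degree > k.
  ∑-min-degree : ∀ s → arcs g us ≤ s * s →
    (∑[ v ∈ us ] ∑[ u ∈ us ] λ′ v u * (g v u + g u v) * deg g us v) ≤ s * (2 * arcs g us)
  ∑-min-degree s a≤s² = begin
    (∑[ v ∈ us ] ∑[ u ∈ us ] λ′ v u * (g v u + g u v) * d v)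
      ≡⟨ ∑-cong-∈ us (λ {v} i → ∑-cong us (λ u → ≡.trans
          (cong (λ′ v u * (g v u + g u v) *_) (sym (∑-threshold D (d v) (∑-∈ d i))))
           (sym (∑-*ˡ ks (λ′ v u * (g v u + g u v)) (λ k → t k v))))) ⟩
    (∑[ v ∈ us ] ∑[ u ∈ us ] ∑[ k ∈ ks ] λ′ v u * (g v u + g u v) * t k v)
      ≡⟨ ≡.trans (∑-cong us (λ v → ∑-swap us ks _)) (∑-swap us ks _) ⟩
    (∑[ k ∈ ks ] ∑[ v ∈ us ] ∑[ u ∈ us ] λ′ v u * (g v u + g u v) * t k v)
      ≤⟨ ∑-mono ks (λ k → ∑-mono us (λ v → ∑-mono us (λ u → both k v u))) ⟩
    (∑[ k ∈ ks ] ∑[ v ∈ us ] ∑[ u ∈ us ] λ′ v u * (f k v u + f k u v))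
      ≤⟨ ∑-mono ks (λ k → ∑∑-λ′ us (λ v → v) (f k)) ⟩
    (∑[ k ∈ ks ] ∑[ v ∈ us ] ∑[ u ∈ us ] f k v u)
      ≤⟨ ∑-mono ks level ⟩
    (∑[ k ∈ ks ] s * ∑ us (t k))
      ≡⟨ ∑-*ˡ ks s _ ⟩
    s * (∑[ k ∈ ks ] ∑ us (t k))
      ≡⟨ cong (s *_) (≡.trans (∑-swap ks us t) (∑-cong-∈ us (λ {v} i → ∑-threshold D (d v) (∑-∈ d i)))) ⟩
    s * ∑ us d
      ≡⟨ cong (s *_) (∑-deg g us) ⟩
    s * (2 * arcs g us) ∎
    where
    open ≤-Reasoning
    d = deg g us
    D = ∑ us d
    ks = upTo D
    t : ℕ → Fin n → ℕ
    t k v = ⟦ suc k ≤? d v ⟧ᵈ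
    f : ℕ → Fin n → Fin n → ℕ
    f k v u = g v u * (t k v * t k u)
    -- If the lighter end `v` has degree above k, so has `u`, since `λ′ v u` is positive only for
    -- `d v ≤ d u`.
    both : ∀ k v u → λ′ v u * (g v u + g u v) * t k v ≤ λ′ v u * (f k v u + f k u v)
    both k v u with λ′ v u in eq
    ... | zero    = z≤n
    ... | suc l = ≤-trans (≤-reflexive (*-assoc (suc l) (g v u + g u v) (t k v))) (*-monoʳ-≤ (suc l) heavy)
      where
      heavy : (g v u + g u v) * t k v ≤ f k v u + f k u v
      heavy with suc k ≤? d v
      ... | no  _ = ≤-trans (≤-reflexive (*-zeroʳ (g v u + g u v))) z≤n
      ... | yes p with suc k ≤? d u
      ...   | yes _ = (lin ((g v u) ∷ (g u v) ∷ [])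
            (λ x y → [] ⇒ (x :+ y) :* con 1 :≤ x :* (con 1 :* con 1) :+ y :* (con 1 :* con 1))
            0 []
            tt)
      ...   | no ¬p = ⊥-elim (¬p (≤-trans p (λ′⇒≤ v u (≤-trans (s≤s z≤n) (≤-reflexive (sym eq))))))
    level : ∀ k → (∑[ v ∈ us ] ∑[ u ∈ us ] f k v u) ≤ s * ∑ us (t k)
    level k with ∑ us (t k) ≤? s
    ... | yes m≤s = begin
      (∑[ v ∈ us ] ∑[ u ∈ us ] f k v u) ≤⟨ ∑-mono us (λ v → ∑-mono us (λ u → ≤1-* (t k v * t k u) (g≤1 v u))) ⟩
      (∑[ v ∈ us ] ∑[ u ∈ us ] t k v * t k u) ≡⟨ ≡.trans (∑-cong us (λ v → ∑-*ˡ us (t k v) (t k))) (∑-*ʳ us _ (t k)) ⟩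
      ∑ us (t k) * ∑ us (t k) ≤⟨ *-monoˡ-≤ (∑ us (t k)) m≤s ⟩
      s * ∑ us (t k) ∎
    ... | no  m≰s = begin
      (∑[ v ∈ us ] ∑[ u ∈ us ] f k v u) ≤⟨ ∑-mono us (λ v → ∑-mono us (λ u → ≤-trans (*-monoʳ-≤ (g v u)
          (≤-trans (≤1-* (t k u) (⟦⟧ᵈ≤1 (suc k ≤? d v))) (⟦⟧ᵈ≤1 (suc k ≤? d u))))
              (≤-reflexive (*-identityʳ (g v u))))) ⟩
      arcs g us ≤⟨ a≤s² ⟩
      s * s ≤⟨ *-monoʳ-≤ s (<⇒≤ (≰⇒> m≰s)) ⟩
      s * ∑ us (t k) ∎

-- Alignments and exchanges

ne : ∀ {n} → Fin n → Fin n → ℕ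
ne a b with a Fin.≟ b
... | yes _ = 0
... | no  _ = 1

ne≤1 : ∀ {n} (a b : Fin n) → ne a b ≤ 1
ne≤1 a b with a Fin.≟ b
... | yes _ = z≤n
... | no  _ = ≤-refl

ne-refl : ∀ {n} (a : Fin n) → ne a a ≡ 0
ne-refl a with a Fin.≟ a
... | yes _ = ≡.refl
... | no ¬p = ⊥-elim (¬p ≡.refl)

ne-≢ : ∀ {n} {a b : Fin n} → a ≢ b → ne a b ≡ 1
ne-≢ {a = a} {b} ¬p with a Fin.≟ b
... | yes p = ⊥-elim (¬p p)
... | no _  = ≡.refl

Unique-resp-↭ : ∀ {A : Set} {xs ys : List A} → xs ↭ ys → Unique xs → Unique ys
Unique-resp-↭ refl           u = u
Unique-resp-↭ (prep x p)     (px ∷ u) = All-resp-↭ p px ∷ Unique-resp-↭ p u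
Unique-resp-↭ (swap x y p)   ((x≢y ∷ px) ∷ py ∷ u) = ((λ eq → x≢y (sym eq)) ∷ All-resp-↭ p py) ∷ All-resp-↭ p px ∷
    Unique-resp-↭ p u
Unique-resp-↭ (_↭_.trans p q) u = Unique-resp-↭ q (Unique-resp-↭ p u)

Unique-∉ : ∀ {A : Set} {x y : A} {xs} → Unique (x ∷ xs) → y ∈ xs → x ≢ y
Unique-∉ (px ∷ _) i = All.lookup px i

module Packing {n : ℕ} (g h : Fin n → Fin n → ℕ) where

  private V = Fin n

  E : Set
  E = V × V

  gh cross : E → E → ℕ
  gh (v , p) (w , r) = g v w * h p r
  cross e e′ = gh e e′ + gh e′ e

  -- A positive value `S v p` keeps v away from p. This is how the arcs to vertices that have
  -- already been placed are remembered.
  record Packs (us ps : List V) (S : V → V → ℕ) : Set where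
    constructor packs
    field
      al      : List E
      firsts  : map proj₁ al ↭ us
      seconds : map proj₂ al ↭ ps
      allowed : ∀ {e} → e ∈ al → S (proj₁ e) (proj₂ e) ≡ 0
      clean   : ∀ {e e′} → e ∈ al → e′ ∈ al → gh e e′ ≡ 0

  -- Δ and η bound the degrees on the two sides, η also the rows of `S` and C its columns; at most
  -- `cnt` vertices have degree above ζ. K is the price of one violation: it has to pay for what an
  -- exchange adds to the sum of another event, 2Δ + ζ, and for the exchanges to be avoided on
  -- account of that event, Δ + `cnt`. `N≥` says that the entries outnumber the total cost, where 4K
  -- is 5K less the K freed by the repaired violation.
  module Swaps
    (g≤1 : ∀ u v → g u v ≤ 1) (h≤1 : ∀ p q → h p q ≤ 1) (g0 : ∀ u → g u u ≡ 0) (h0 : ∀ p → h p p ≡ 0)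
    (us ps : List V) (S : V → V → ℕ) (us! : Unique us) (ps! : Unique ps)
    (Δ η ζ C K cnt : ℕ)
    (deg-h : ∀ {p} → p ∈ ps → deg h ps p ≤ Δ) (deg-g : ∀ {u} → u ∈ us → deg g us u ≤ η)
    (rows : ∀ {v} → v ∈ us → (∑[ p ∈ ps ] S v p) ≤ η) (cols : ∀ {p} → p ∈ ps → (∑[ v ∈ us ] S v p) ≤ C)
    (few-big : (∑[ w ∈ us ] ⟦ suc ζ ≤? deg g us w ⟧ᵈ) ≤ cnt)
    (K≥₁ : 2 * Δ + ζ ≤ K) (K≥₂ : Δ + cnt ≤ K) (N≥ : C + 2 * Δ + η + 4 * K + 1 ≤ length us)
    where

    open Lighter (deg g us)

    S′ : E → ℕ
    S′ e = S (proj₁ e) (proj₂ e)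

    row : V → ℕ
    row v = ∑[ p ∈ ps ] S v p

    viol : List E → ℕ
    viol al = ∑ al S′ + (∑[ e ∈ al ] ∑ al (gh e))

    -- `ne` in `ρ′` drops the entries with the position of e, and `κ` those that share the vertex or
    -- the position of the partner u. Equal positions then have weight 0, as `𝔼₂` and `𝔼₃` require.
    -- The entry u itself is lost in this way; it costs at most Δ + η.
    evt ρ ρ₁ ρ₂ ρ′ κ : E → E → ℕ
    evt e u = λ′ (proj₁ e) (proj₁ u) * cross e u
    ρ₁ (v , p) (w , r) = g v w * indeg h ps r + g w v * outdeg h ps r
    ρ₂ (v , p) (w , r) = h p r * indeg g us w + h r p * outdeg g us w
    ρ e z = ρ₁ e z + ρ₂ e z
    ρ′ e z = ne (proj₂ e) (proj₂ z) * ρ e z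
    κ u z = ne (proj₁ u) (proj₁ z) * ne (proj₂ u) (proj₂ z)

    -- For e = (v , p) the sum of ρ e bounds the number of entries whose exchange with e creates a collision:
    -- v would be joined to the position of a neighbour w (ρ₁), or the vertex put at p has a neighbour whose
    -- position is joined to p (ρ₂). Each violation that disappears frees K, at least what an exchange adds to
    -- the sums for the other events.
    record Good (al : List E) : Set where
      constructor good
      field
        firsts  : map proj₁ al ↭ us
        seconds : map proj₂ al ↭ ps
        inv₁ : ∀ {e} → e ∈ al → 0 < S′ e → ∑ al (ρ′ e) + viol al * K < 5 * K
        inv₂ : ∀ {e u} → e ∈ al → u ∈ al → 0 < evt e u → row (proj₁ e) + (∑[ z ∈ al ] κ u z * ρ′ e z) + viol al * K
            < 5 * K

    κ≤1 : ∀ u z → κ u z ≤ 1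
    κ≤1 u z = ≤-trans (≤1-* _ (ne≤1 (proj₁ u) (proj₁ z))) (ne≤1 (proj₂ u) (proj₂ z))

    ρ′≤ρ : ∀ e z → ρ′ e z ≤ ρ e z
    ρ′≤ρ e z = ≤1-* (ρ e z) (ne≤1 (proj₂ e) (proj₂ z))

    ρ₁≤ : ∀ e z → ρ₁ e z ≤ deg h ps (proj₂ z)
    ρ₁≤ (v , p) (w , r) = ≤-trans (+-mono-≤ (≤1-* (indeg h ps r) (g≤1 v w)) (≤1-* (outdeg h ps r) (g≤1 w v)))
      (≤-reflexive (+-comm (indeg h ps r) _))

    ρ₂≤ : ∀ e z → ρ₂ e z ≤ deg g us (proj₁ z)
    ρ₂≤ (v , p) (w , r) = ≤-trans (+-mono-≤ (≤1-* (indeg g us w) (h≤1 p r)) (≤1-* (outdeg g us w) (h≤1 r p)))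
      (≤-reflexive (+-comm (indeg g us w) _))

    gh-refl : ∀ e → gh e e ≡ 0
    gh-refl (v , p) = cong (_* h p p) (g0 v)

    viol-∷ : ∀ e al → viol (e ∷ al) ≡ S′ e + ∑ al (cross e) + viol al
    viol-∷ e al = (≤-antisym
        (lin ((S′ e) ∷ (∑ al S′) ∷ (∑ al (cross e)) ∷ (gh e e) ∷ (∑[ y ∈ al ] ∑ al (gh y)) ∷
            (∑[ y ∈ e ∷ al ] ∑ (e ∷ al) (gh y)) ∷ [])
          (λ s t c o x z → (z :≤ o :+ c :+ x) ∷ (o :≤ con 0) ∷ [] ⇒ s :+ t :+ z :≤ s :+ c :+ (t :+ x))
          0 (1 ∷ 1 ∷ [])
          (≤-reflexive (∑∑-∷ e al gh) , ≤-reflexive (gh-refl e) , tt))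
        (lin ((S′ e) ∷ (∑ al S′) ∷ (∑ al (cross e)) ∷ (gh e e) ∷ (∑[ y ∈ al ] ∑ al (gh y)) ∷
            (∑[ y ∈ e ∷ al ] ∑ (e ∷ al) (gh y)) ∷ [])
          (λ s t c o x z → (o :+ c :+ x :≤ z) ∷ [] ⇒ s :+ c :+ (t :+ x) :≤ s :+ t :+ z)
          0 (1 ∷ [])
          (≤-reflexive (sym (∑∑-∷ e al gh)) , tt)))

    viol-↭ : ∀ {al al′} → al ↭ al′ → viol al ≡ viol al′
    viol-↭ p = cong₂ _+_ (∑-↭ S′ p) (∑∑-↭ gh p)

    ∑∑evt≤viol : ∀ al → ∑ al S′ + (∑[ e ∈ al ] ∑ al (evt e)) ≤ viol al
    ∑∑evt≤viol al = +-monoʳ-≤ (∑ al S′) (∑∑-λ′ al proj₁ gh)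

    -- Weighted pigeonhole: `bad` counts what the exchange of (v , p) with an entry would break,
    -- `pr′` how often it would disturb another event. The total over `rest` is less than the length
    -- of `rest`, so some entry has cost 0.
    module Swap {al} (ok : Good al) {v p} {rest} (split : al ↭ (v , p) ∷ rest)
      (drop : viol rest < viol al)
      (room : row v + ∑ rest (ρ (v , p)) + viol al * K < η + Δ + 5 * K) where

      open Good ok

      e = (v , p)

      sub₁ : ∀ f → (∑[ z ∈ rest ] f (proj₁ z)) ≤ ∑ us f
      sub₁ f = ≤-trans (m≤n+m _ (f v)) (≤-reflexive (≡.trans (sym (∑-↭ (λ z → f (proj₁ z)) split))
        (≡.trans (sym (∑-map proj₁ al f)) (∑-↭ f firsts))))

      sub₂ : ∀ f → (∑[ z ∈ rest ] f (proj₂ z)) ≤ ∑ ps f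
      sub₂ f = ≤-trans (m≤n+m _ (f p)) (≤-reflexive (≡.trans (sym (∑-↭ (λ z → f (proj₂ z)) split))
        (≡.trans (sym (∑-map proj₂ al f)) (∑-↭ f seconds))))

      e∈al : e ∈ al
      e∈al = ∈-resp-↭ (↭-sym split) (here ≡.refl)

      rest⊆al : ∀ {z} → z ∈ rest → z ∈ al
      rest⊆al i = ∈-resp-↭ (↭-sym split) (there i)

      first∈ : ∀ {z} → z ∈ al → proj₁ z ∈ us
      first∈ i = ∈-resp-↭ firsts (∈-map⁺ proj₁ i)

      second∈ : ∀ {z} → z ∈ al → proj₂ z ∈ ps
      second∈ i = ∈-resp-↭ seconds (∈-map⁺ proj₂ i)

      bad pr′ : E → ℕ
      bad (w , r) = S v r + S w p + cross (v , r) (w , p) + (∑[ z ∈ rest ] cross (v , r) z + cross (w , p) z)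
      -- For another event at (v′ , p′): v arrives at r, and as v may have large degree, r must not
      -- be joined to p′; w arrives at p, which is tolerable if w has degree at most ζ.
      pr : E → E → ℕ
      pr (_ , p′) (w , r) = h r p′ + h p′ r + ⟦ suc ζ ≤? deg g us w ⟧ᵈ
      pr′ z = (∑[ e′ ∈ rest ] S′ e′ * pr e′ z) + (∑[ e′ ∈ rest ] ∑[ u′ ∈ rest ] evt e′ u′ * pr e′ z)

      ∑-bad : ∑ rest bad ≤ row v + C + Δ + ∑ rest (ρ e)
      ∑-bad = begin
        ∑ rest bad
          ≡⟨ ≡.trans (∑-+ rest _ _) (cong (_+ ∑ rest b₄) (≡.trans (∑-+ rest _ _)
              (cong (_+ ∑ rest b₃) (∑-+ rest _ _)))) ⟩
        (∑[ z ∈ rest ] S v (proj₂ z)) + (∑[ z ∈ rest ] S (proj₁ z) p) + ∑ rest b₃ + ∑ rest b₄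
          ≤⟨ +-mono-≤ (+-mono-≤ (+-mono-≤ (sub₂ (S v)) (≤-trans (sub₁ (λ w → S w p)) (cols (second∈ e∈al)))) b₃≤) b₄≤ ⟩
        row v + C + Δ + ∑ rest (ρ e) ∎
        where
        open ≤-Reasoning
        b₃ b₄ : E → ℕ
        b₃ (w , r) = cross (v , r) (w , p)
        b₄ (w , r) = ∑[ z ∈ rest ] cross (v , r) z + cross (w , p) z
        b₃≤ : ∑ rest b₃ ≤ Δ
        b₃≤ = begin
          ∑ rest b₃ ≤⟨ ∑-mono rest (λ (w , r) → +-mono-≤ (≤1-* (h r p) (g≤1 v w)) (≤1-* (h p r) (g≤1 w v))) ⟩
          (∑[ z ∈ rest ] h (proj₂ z) p + h p (proj₂ z)) ≤⟨ sub₂ (λ r → h r p + h p r) ⟩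
          (∑[ r ∈ ps ] h r p + h p r) ≡⟨ ≡.trans (∑-+ ps (λ r → h r p) (h p)) (+-comm (indeg h ps p) _) ⟩
          deg h ps p ≤⟨ deg-h (second∈ e∈al) ⟩
          Δ ∎
        b₄≤ : ∑ rest b₄ ≤ ∑ rest (ρ e)
        b₄≤ = begin
          ∑ rest b₄ ≡⟨ ∑-swap rest rest _ ⟩
          (∑[ z ∈ rest ] ∑[ y ∈ rest ] cross (v , proj₂ y) z + cross (proj₁ y , p) z) ≤⟨ ∑-mono rest (λ z →
              ≤-trans (≤-reflexive (∑-+ rest _ _)) (+-mono-≤ (in₁ z) (in₂ z))) ⟩
          ∑ rest (ρ e) ∎
          where
          in₁ : ∀ z → (∑[ y ∈ rest ] cross (v , proj₂ y) z) ≤ ρ₁ e z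
          in₁ (x , c) = ≤-trans (≤-reflexive (≡.trans (∑-+ rest _ _)
              (cong₂ _+_ (∑-*ˡ rest (g v x) (λ y → h (proj₂ y) c)) (∑-*ˡ rest (g x v) (λ y → h c (proj₂ y))))))
            (+-mono-≤ (*-monoʳ-≤ (g v x) (sub₂ (λ r → h r c))) (*-monoʳ-≤ (g x v) (sub₂ (h c))))
          in₂ : ∀ z → (∑[ y ∈ rest ] cross (proj₁ y , p) z) ≤ ρ₂ e z
          in₂ (x , c) = ≤-trans (≤-reflexive (≡.trans (∑-+ rest _ _) (cong₂ _+_
              (≡.trans (∑-*ʳ rest (h p c) (λ y → g (proj₁ y) x)) (*-comm _ (h p c)))
              (≡.trans (∑-*ʳ rest (h c p) (λ y → g x (proj₁ y))) (*-comm _ (h c p))))))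
            (+-mono-≤ (*-monoʳ-≤ (h p c) (sub₁ (λ w → g w x))) (*-monoʳ-≤ (h c p) (sub₁ (g x))))

      ∑-pr : ∀ {e′} → e′ ∈ rest → ∑ rest (pr e′) ≤ K
      ∑-pr {v′ , p′} i = begin
        ∑ rest (pr (v′ , p′)) ≡⟨ ∑-+ rest _ _ ⟩
        (∑[ z ∈ rest ] h (proj₂ z) p′ + h p′ (proj₂ z)) + (∑[ z ∈ rest ] ⟦ suc ζ ≤? deg g us (proj₁ z) ⟧ᵈ)
          ≤⟨ +-mono-≤ (sub₂ (λ r → h r p′ + h p′ r)) (≤-trans (sub₁ (λ w → ⟦ suc ζ ≤? deg g us w ⟧ᵈ)) few-big) ⟩
        (∑[ r ∈ ps ] h r p′ + h p′ r) + cnt ≡⟨ cong (_+ cnt)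
            (≡.trans (∑-+ ps (λ r → h r p′) (h p′)) (+-comm (indeg h ps p′) _)) ⟩
        deg h ps p′ + cnt ≤⟨ +-monoˡ-≤ cnt (deg-h (second∈ (rest⊆al i))) ⟩
        Δ + cnt ≤⟨ K≥₂ ⟩
        K ∎
        where open ≤-Reasoning

      ∑-pr′ : ∑ rest pr′ ≤ viol rest * K
      ∑-pr′ = begin
        ∑ rest pr′ ≡⟨ ∑-+ rest _ _ ⟩
        (∑[ z ∈ rest ] ∑[ e′ ∈ rest ] S′ e′ * pr e′ z) + (∑[ z ∈ rest ] ∑[ e′ ∈ rest ] ∑[ u′ ∈ rest ] evt e′ u′ * pr
            e′ z)
          ≡⟨ cong₂ _+_ (∑-swap rest rest _) (∑-swap rest rest _) ⟩
        (∑[ e′ ∈ rest ] ∑[ z ∈ rest ] S′ e′ * pr e′ z) + (∑[ e′ ∈ rest ] ∑[ z ∈ rest ] ∑[ u′ ∈ rest ] evt e′ u′ * pr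
            e′ z)
          ≤⟨ +-mono-≤
               (∑-mono-∈ rest (λ {e′} i → ≤-trans (≤-reflexive (∑-*ˡ rest (S′ e′) (pr e′)))
                   (*-monoʳ-≤ (S′ e′) (∑-pr i))))
               (∑-mono-∈ rest (λ {e′} i → ≤-trans (≤-reflexive
                   (≡.trans (∑-cong rest (λ z → ∑-*ʳ rest (pr e′ z) (evt e′))) (∑-*ˡ rest (∑ rest (evt e′)) (pr e′))))
                 (*-monoʳ-≤ (∑ rest (evt e′)) (∑-pr i)))) ⟩
        (∑[ e′ ∈ rest ] S′ e′ * K) + (∑[ e′ ∈ rest ] ∑ rest (evt e′) * K)
          ≡⟨ ≡.trans (cong₂ _+_ (∑-*ʳ rest K S′) (∑-*ʳ rest K _)) (sym (*-distribʳ-+ K (∑ rest S′) _)) ⟩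
        (∑ rest S′ + (∑[ e′ ∈ rest ] ∑ rest (evt e′))) * K ≤⟨ *-monoˡ-≤ K (∑∑evt≤viol rest) ⟩
        viol rest * K ∎
        where open ≤-Reasoning

      length-rest : suc (length rest) ≡ length us
      length-rest = ≡.trans (sym (↭-length split)) (≡.trans (sym (length-map proj₁ al)) (↭-length firsts))

      -- At least one violation disappears with (v , p), so `pr′` sums to at most (`viol al` - 1) *
      -- K. With `room` the total is below C + 2Δ + η + 4K.
      enough : (∑[ z ∈ rest ] bad z + pr′ z) < length rest
      enough = (lin ((∑[ z ∈ rest ] bad z + pr′ z) ∷ (∑ rest bad) ∷ (∑ rest pr′) ∷ (row v) ∷ C ∷ Δ ∷ η ∷ K ∷
          (∑ rest (ρ e)) ∷ (viol al) ∷ (viol rest) ∷ (viol rest * K) ∷ (viol al * K) ∷ (length us) ∷ (length rest) ∷ [])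
            (λ t b q R C Δ η K Q X Y YK XK N l → (t :≤ b :+ q) ∷ (b :≤ R :+ C :+ Δ :+ Q) ∷ (q :≤ YK) ∷
                (R :+ Q :+ XK :< η :+ Δ :+ con 5 :* K) ∷ (K :+ YK :≤ XK) ∷
                (C :+ con 2 :* Δ :+ η :+ con 4 :* K :+ con 1 :≤ N) ∷ (N :≤ (con 1 :+ l)) ∷ [] ⇒ t :< l)
            0 (1 ∷ 1 ∷ 1 ∷ 1 ∷ 1 ∷ 1 ∷ 1 ∷ [])
            (≤-reflexive (∑-+ rest bad pr′) , ∑-bad , ∑-pr′ , room , *-monoˡ-≤ K drop , N≥ ,
                ≤-reflexive (sym length-rest) , tt))

      module After {w r rest′} (split′ : rest ↭ (w , r) ∷ rest′) (cost≡0 : bad (w , r) + pr′ (w , r) ≡ 0) where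

        new : List E
        new = (v , r) ∷ (w , p) ∷ rest′
        z₀ : E
        z₀ = (w , r)
        z₀∈ : z₀ ∈ rest
        z₀∈ = ∈-resp-↭ (↭-sym split′) (here ≡.refl)
        whole : al ↭ (v , p) ∷ (w , r) ∷ rest′
        whole = ↭-trans split (prep _ split′)
        firsts′ : map proj₁ new ↭ us
        firsts′ = ↭-trans (map⁺ proj₁ (↭-sym whole)) firsts
        seconds′ : map proj₂ new ↭ ps
        seconds′ = ↭-trans (swap r p refl) (↭-trans (map⁺ proj₂ (↭-sym whole)) seconds)
        bad≡0 : bad z₀ ≡ 0
        bad≡0 = m+n≡0⇒m≡0 (bad z₀) cost≡0
        pr′≡0 : pr′ z₀ ≡ 0
        pr′≡0 = m+n≡0⇒n≡0 (bad z₀) cost≡0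
        Svr≡0 : S v r ≡ 0
        Svr≡0 = m+n≡0⇒m≡0 (S v r) (m+n≡0⇒m≡0 (S v r + S w p) (m+n≡0⇒m≡0 _ bad≡0))
        Swp≡0 : S w p ≡ 0
        Swp≡0 = m+n≡0⇒n≡0 (S v r) (m+n≡0⇒m≡0 (S v r + S w p) (m+n≡0⇒m≡0 _ bad≡0))
        vw≡0 : cross (v , r) (w , p) ≡ 0
        vw≡0 = m+n≡0⇒n≡0 (S v r + S w p) (m+n≡0⇒m≡0 _ bad≡0)
        rest′⊆rest : ∀ {z} → z ∈ rest′ → z ∈ rest
        rest′⊆rest j = ∈-resp-↭ (↭-sym split′) (there j)
        off≡0 : ∀ {z} → z ∈ rest′ → cross (v , r) z + cross (w , p) z ≡ 0
        off≡0 j = ∑≡0⇒∈ (λ z → cross (v , r) z + cross (w , p) z)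
            (m+n≡0⇒n≡0 (S v r + S w p + cross (v , r) (w , p)) bad≡0) (rest′⊆rest j)
        off₁ : ∀ {z} → z ∈ rest′ → cross (v , r) z ≡ 0
        off₁ {z} j = m+n≡0⇒m≡0 (cross (v , r) z) (off≡0 j)
        off₂ : ∀ {z} → z ∈ rest′ → cross (w , p) z ≡ 0
        off₂ {z} j = m+n≡0⇒n≡0 (cross (v , r) z) (off≡0 j)
        viol-new : viol new ≡ viol rest′
        viol-new = (≤-antisym
            (lin ((viol new) ∷ (viol ((w , p) ∷ rest′)) ∷ (viol rest′) ∷ (S v r) ∷ (S w p) ∷
                (cross (v , r) (w , p)) ∷ (∑ rest′ (cross (v , r))) ∷ (∑ rest′ (cross (w , p))) ∷ [])
              (λ x y z s t c d f → (x :≤ s :+ (c :+ d) :+ y) ∷ (y :≤ t :+ f :+ z) ∷ (s :≤ con 0) ∷ (t :≤ con 0) ∷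
                  (c :≤ con 0) ∷ (d :≤ con 0) ∷ (f :≤ con 0) ∷ [] ⇒ x :≤ z)
              0 (1 ∷ 1 ∷ 1 ∷ 1 ∷ 1 ∷ 1 ∷ 1 ∷ [])
              (≤-reflexive (viol-∷ (v , r) ((w , p) ∷ rest′)) , ≤-reflexive (viol-∷ (w , p) rest′) ,
                  ≤-reflexive Svr≡0 , ≤-reflexive Swp≡0 , ≤-reflexive vw≡0 , ≤-reflexive (∑-zero-∈ rest′ off₁) ,
                  ≤-reflexive (∑-zero-∈ rest′ off₂) , tt))
            (lin ((viol new) ∷ (viol ((w , p) ∷ rest′)) ∷ (viol rest′) ∷ (S v r) ∷ (S w p) ∷
                (cross (v , r) (w , p)) ∷ (∑ rest′ (cross (v , r))) ∷ (∑ rest′ (cross (w , p))) ∷ [])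
              (λ x y z s t c d f → (s :+ (c :+ d) :+ y :≤ x) ∷ (t :+ f :+ z :≤ y) ∷ [] ⇒ z :≤ x)
              0 (1 ∷ 1 ∷ [])
              (≤-reflexive (sym (viol-∷ (v , r) ((w , p) ∷ rest′))) , ≤-reflexive (sym (viol-∷ (w , p) rest′)) , tt)))
        viol≤ : viol new ≤ viol rest
        viol≤ = ≤-trans (≤-reflexive viol-new) (≤-trans (m≤n+m (viol rest′) (S′ z₀ + ∑ rest′ (cross z₀)))
            (≤-reflexive (≡.trans (sym (viol-∷ z₀ rest′)) (viol-↭ (↭-sym split′)))))
        cross-sym : ∀ e e′ → cross e e′ ≡ cross e′ e
        cross-sym e e′ = +-comm (gh e e′) (gh e′ e)
        old : ∀ {z} → z ∈ rest′ → z ∈ al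
        old j = rest⊆al (rest′⊆rest j)
        grow : ∀ {e′} → pr e′ z₀ ≡ 0 → ρ e′ (v , r) + ρ e′ (w , p) ≤ K
        grow {v′ , p′} pr≡0 = (lin ((ρ₁ (v′ , p′) (v , r)) ∷ (ρ₂ (v′ , p′) (v , r)) ∷ (ρ₁ (v′ , p′) (w , p)) ∷
            (ρ₂ (v′ , p′) (w , p)) ∷ Δ ∷ ζ ∷ K ∷ [])
              (λ a b c d Δ ζ K → (a :≤ Δ) ∷ (b :≤ con 0) ∷ (c :≤ Δ) ∷ (d :≤ ζ) ∷ (con 2 :* Δ :+ ζ :≤ K) ∷ [] ⇒
                  a :+ b :+ (c :+ d) :≤ K)
              0 (1 ∷ 1 ∷ 1 ∷ 1 ∷ 1 ∷ [])
              (≤-trans (ρ₁≤ (v′ , p′) (v , r)) (deg-h (second∈ (rest⊆al z₀∈))) , ≤-reflexive b≡0 ,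
                  ≤-trans (ρ₁≤ (v′ , p′) (w , p)) (deg-h (second∈ e∈al)) ,
                  ≤-trans (ρ₂≤ (v′ , p′) (w , p)) (≮⇒≥ (⟦⟧ᵈ≡0 (suc ζ ≤? deg g us w)
                  (m+n≡0⇒n≡0 (h r p′ + h p′ r) pr≡0))) , K≥₁ , tt))
          where
          h≡0 = m+n≡0⇒m≡0 (h r p′ + h p′ r) pr≡0
          b≡0 : ρ₂ (v′ , p′) (v , r) ≡ 0
          b≡0 = cong₂ _+_ (cong (_* indeg g us v) (m+n≡0⇒n≡0 (h r p′) h≡0))
              (cong (_* outdeg g us v) (m+n≡0⇒m≡0 (h r p′) h≡0))
        -- The sum of an event grows by at most K while at least one violation, worth K, is gone; so
        -- the bound 5K survives.
        keep : ∀ {x y Q Q′ d} → Q′ ≤ d + Q → d ≤ K → x + Q + viol al * K < y → x + Q′ + viol new * K < y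
        keep {x} {y} {Q} {Q′} {d} le dle lt = (lin (x ∷ y ∷ Q ∷ Q′ ∷ d ∷ K ∷ (viol al * K) ∷ (viol new * K) ∷ [])
              (λ x y Q Q′ d K XK YK → (Q′ :≤ d :+ Q) ∷ (d :≤ K) ∷ (x :+ Q :+ XK :< y) ∷ (K :+ YK :≤ XK) ∷ [] ⇒
                  x :+ Q′ :+ YK :< y)
              0 (1 ∷ 1 ∷ 1 ∷ 1 ∷ [])
              (le , dle , lt , *-monoˡ-≤ K (<-≤-trans (s≤s viol≤) drop) , tt))
        ∑-new : ∀ f → ∑ rest′ f ≤ ∑ al f
        ∑-new f = ≤-trans (≤-trans (m≤n+m (∑ rest′ f) (f z₀)) (m≤n+m (f z₀ + ∑ rest′ f) (f (v , p))))
            (≤-reflexive (sym (∑-↭ f whole)))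
        split-new : ∀ (f : E → ℕ) → ∑ new f ≤ f (v , r) + f (w , p) + ∑ al f
        split-new f = ≤-trans (≤-reflexive (sym (+-assoc (f (v , r)) (f (w , p)) (∑ rest′ f))))
            (+-monoʳ-≤ (f (v , r) + f (w , p)) (∑-new f))
        inv₁′ : ∀ {e′} → e′ ∈ new → 0 < S′ e′ → ∑ new (ρ′ e′) + viol new * K < 5 * K
        inv₁′ (here ≡.refl) pos = ⊥-elim (<-irrefl (sym Svr≡0) pos)
        inv₁′ (there (here ≡.refl)) pos = ⊥-elim (<-irrefl (sym Swp≡0) pos)
        inv₁′ {e′} (there (there j)) pos = keep {x = 0} {Q =
            ∑ al (ρ′ e′)} (split-new (ρ′ e′)) (≤-trans (+-mono-≤ (ρ′≤ρ e′ (v , r)) (ρ′≤ρ e′ (w , p)))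
            (grow (*-≡0 pos (∑≡0⇒∈ (λ e″ → S′ e″ * pr e″ z₀) (m+n≡0⇒m≡0 _ pr′≡0) (rest′⊆rest j))))) (inv₁ (old j) pos)
        -- The two new entries collide with nothing, so every event after the exchange consists of
        -- two old entries and was an event before.
        inv₂′ : ∀ {e′ u′} → e′ ∈ new → u′ ∈ new → 0 < evt e′ u′ →
            row (proj₁ e′) + (∑[ z ∈ new ] κ u′ z * ρ′ e′ z) + viol new * K < 5 * K
        inv₂′ {e′} {u′} je ju pos = go je ju
          where
          crossing : 0 < cross e′ u′
          crossing = >0-*ʳ (λ′ (proj₁ e′) (proj₁ u′)) (cross e′ u′) pos
          clash : ∀ {a b} → e′ ≡ a → u′ ≡ b → cross a b ≡ 0 → ∀ {X : Set} → X
          clash ≡.refl ≡.refl eq = ⊥-elim (<-irrefl (sym eq) crossing)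
          self : ∀ a → cross a a ≡ 0
          self a = cong₂ _+_ (gh-refl a) (gh-refl a)
          go : e′ ∈ new → u′ ∈ new → row (proj₁ e′) + (∑[ z ∈ new ] κ u′ z * ρ′ e′ z) + viol new * K < 5 * K
          go (here p) (here q) = clash p q (self _)
          go (here p) (there (here q)) = clash p q vw≡0
          go (here p) (there (there k)) = clash p ≡.refl (off₁ k)
          go (there (here p)) (here q) = clash p q (≡.trans (cross-sym (w , _) (v , _)) vw≡0)
          go (there (here p)) (there (here q)) = clash p q (self _)
          go (there (here p)) (there (there k)) = clash p ≡.refl (off₂ k)
          go (there (there j)) (here q) = clash ≡.refl q (≡.trans (cross-sym e′ (v , r)) (off₁ j))
          go (there (there j)) (there (here q)) = clash ≡.refl q (≡.trans (cross-sym e′ (w , p)) (off₂ j))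
          go (there (there j)) (there (there k)) = keep {x = row (proj₁ e′)} {Q =
              ∑[ z ∈ al ] κ u′ z * ρ′ e′ z} (split-new (λ z → κ u′ z * ρ′ e′ z))
            (≤-trans (+-mono-≤ (shrink (v , r)) (shrink (w , p))) (grow pr≡0)) (inv₂ (old j) (old k) pos)
            where
            shrink : ∀ z → κ u′ z * ρ′ e′ z ≤ ρ e′ z
            shrink z = ≤-trans (≤1-* (ρ′ e′ z) (κ≤1 u′ z)) (ρ′≤ρ e′ z)
            pr≡0 : pr e′ z₀ ≡ 0
            pr≡0 = *-≡0 pos (∑≡0⇒∈ (λ u″ → evt e′ u″ * pr e′ z₀)
              (∑≡0⇒∈ (λ e″ → ∑[ u″ ∈ rest ] evt e″ u″ * pr e″ z₀)
                  (m+n≡0⇒n≡0 (∑[ e″ ∈ rest ] S′ e″ * pr e″ z₀) pr′≡0) (rest′⊆rest j)) (rest′⊆rest k))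

      Better : Set
      Better = ∃ λ al′ → Good al′ × viol al′ < viol al

      better : ∀ {z} → ∃ (λ rest′ → rest ↭ z ∷ rest′) → bad z + pr′ z ≡ 0 → Better
      better (rest′ , split′) cost≡0 = new , good firsts′ seconds′ inv₁′ inv₂′ , <-≤-trans (s≤s viol≤) drop
        where open After split′ cost≡0

      result : Better
      result = found (∑<length⇒∃ rest (λ z → bad z + pr′ z) enough)
        where
        found : ∃ (λ z → z ∈ rest × bad z + pr′ z ≡ 0) → Better
        found (z , i , cost≡0) = better (∈⇒↭ i) cost≡0

    Unique₁ : ∀ {al} {e : E} {rest} → map proj₁ al ↭ us → al ↭ e ∷ rest → ∀ {z} → z ∈ rest → proj₁ e ≢ proj₁ z
    Unique₁ f p i = Unique-∉ (Unique-resp-↭ (↭-trans (↭-sym f) (map⁺ proj₁ p)) us!) (∈-map⁺ proj₁ i)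

    Unique₂ : ∀ {al} {e : E} {rest} → map proj₂ al ↭ ps → al ↭ e ∷ rest → ∀ {z} → z ∈ rest → proj₂ e ≢ proj₂ z
    Unique₂ f p i = Unique-∉ (Unique-resp-↭ (↭-trans (↭-sym f) (map⁺ proj₂ p)) ps!) (∈-map⁺ proj₂ i)

    module Event {al} (ok : Good al) {e : E} {rest} (split : al ↭ e ∷ rest) where
      open Good ok

      viol-split : viol al ≡ S′ e + ∑ rest (cross e) + viol rest
      viol-split = ≡.trans (viol-↭ split) (viol-∷ e rest)

      ρ≡ρ′ : ∀ {z} → z ∈ rest → ρ e z ≡ ρ′ e z
      ρ≡ρ′ {z} i = sym (≡.trans (cong (_* ρ e z) (ne-≢ (Unique₂ seconds split i))) (*-identityˡ (ρ e z)))

      e∈ : e ∈ al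
      e∈ = ∈-resp-↭ (↭-sym split) (here ≡.refl)

      forbidden : 0 < S′ e → ∃ λ al′ → Good al′ × viol al′ < viol al
      forbidden pos = Swap.result ok split
        (lin ((viol al) ∷ (viol rest) ∷ (S′ e) ∷ (∑ rest (cross e)) ∷ [])
              (λ X Y s c → (s :+ c :+ Y :≤ X) ∷ (con 0 :< s) ∷ [] ⇒ Y :< X)
              0 (1 ∷ 1 ∷ [])
              (≤-reflexive (sym viol-split) , pos , tt))
        (lin ((row (proj₁ e)) ∷ (∑ rest (ρ e)) ∷ (∑ al (ρ′ e)) ∷ (viol al * K) ∷ η ∷ Δ ∷ K ∷ [])
              (λ R Q Q′ XK η Δ K → (R :≤ η) ∷ (Q :≤ Q′) ∷ (Q′ :+ XK :< con 5 :* K) ∷ [] ⇒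
                  R :+ Q :+ XK :< η :+ Δ :+ con 5 :* K)
              0 (1 ∷ 1 ∷ 1 ∷ [])
              (rows (∈-resp-↭ firsts (∈-map⁺ proj₁ e∈)) , Q≤ , inv₁ e∈ pos , tt))
        where
        Q≤ : ∑ rest (ρ e) ≤ ∑ al (ρ′ e)
        Q≤ = ≤-trans (≤-reflexive (∑-cong-∈ rest ρ≡ρ′)) (≤-trans (m≤n+m (∑ rest (ρ′ e)) (ρ′ e e))
            (≤-reflexive (sym (∑-↭ (ρ′ e) split))))

      -- `inv₂` leaves out the partner u. Its share of `ρ e` is added back, at most Δ for `ρ₁` and η
      -- for `ρ₂`.
      colliding : ∀ {u rest₂} → u ∈ al → rest ↭ u ∷ rest₂ → 0 < evt e u → ∃ λ al′ → Good al′ × viol al′ < viol al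
      colliding {u} {rest₂} i split₂ pos = Swap.result ok split
        (lin ((viol al) ∷ (viol rest) ∷ (S′ e) ∷ (∑ rest (cross e)) ∷ (cross e u) ∷ [])
              (λ X Y s c d → (s :+ c :+ Y :≤ X) ∷ (d :≤ c) ∷ (con 0 :< d) ∷ [] ⇒ Y :< X)
              0 (1 ∷ 1 ∷ 1 ∷ [])
              (≤-reflexive (sym viol-split) , ∑-∈ (cross e) (∈-resp-↭ (↭-sym split₂) (here ≡.refl)) ,
                  >0-*ʳ (λ′ (proj₁ e) (proj₁ u)) (cross e u) pos , tt))
        (lin ((row (proj₁ e)) ∷ (∑ rest (ρ e)) ∷ (ρ₁ e u) ∷ (ρ₂ e u) ∷ (∑ rest₂ (ρ e)) ∷
            (∑[ z ∈ al ] κ u z * ρ′ e z) ∷ (viol al * K) ∷ η ∷ Δ ∷ K ∷ [])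
              (λ R Q x y Q″ Q′ XK η Δ K → (Q :≤ x :+ y :+ Q″) ∷ (Q″ :≤ Q′) ∷ (x :≤ Δ) ∷ (y :≤ η) ∷
                  (R :+ Q′ :+ XK :< con 5 :* K) ∷ [] ⇒ R :+ Q :+ XK :< η :+ Δ :+ con 5 :* K)
              0 (1 ∷ 1 ∷ 1 ∷ 1 ∷ 1 ∷ [])
              (≤-reflexive (∑-↭ (ρ e) split₂) , Q≤ , ≤-trans (ρ₁≤ e u) (deg-h (∈-resp-↭ seconds (∈-map⁺ proj₂ i))) ,
                  ≤-trans (ρ₂≤ e u) (deg-g (∈-resp-↭ firsts (∈-map⁺ proj₁ i))) , inv₂ e∈ i pos , tt))
        where
        whole : al ↭ u ∷ e ∷ rest₂
        whole = ↭-trans split (↭-trans (prep e split₂) (swap e u refl))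
        same : ∀ {z} → z ∈ rest₂ → ρ e z ≡ κ u z * ρ′ e z
        same {z} j = ≡.trans (ρ≡ρ′ (∈-resp-↭ (↭-sym split₂) (there j))) (sym (≡.trans (cong (_* ρ′ e z)
          (cong₂ _*_ (ne-≢ (Unique₁ firsts whole (there j))) (ne-≢ (Unique₂ seconds whole (there j)))))
              (*-identityˡ (ρ′ e z))))
        Q≤ : ∑ rest₂ (ρ e) ≤ (∑[ z ∈ al ] κ u z * ρ′ e z)
        Q≤ = ≤-trans (≤-reflexive (∑-cong-∈ rest₂ same)) (≤-trans
            (≤-trans (m≤n+m (∑[ z ∈ rest₂ ] κ u z * ρ′ e z) (κ u e * ρ′ e e))
          (m≤n+m (κ u e * ρ′ e e + (∑[ z ∈ rest₂ ] κ u z * ρ′ e z)) (κ u u * ρ′ e u)))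
              (≤-reflexive (sym (∑-↭ (λ z → κ u z * ρ′ e z) whole))))

    improve : ∀ {al} → Good al → 0 < viol al → ∃ λ al′ → Good al′ × viol al′ < viol al
    improve {al} ok pos = first (∑ al S′) ≡.refl
      where
      Goal : Set
      Goal = ∃ λ al′ → Good al′ × viol al′ < viol al
      event : ∀ {e u} → e ∈ al → u ∈ al → e ≢ u → 0 < evt e u → Goal
      event {e} {u} i j e≢u pos′ = go (∈⇒↭ i)
        where
        in-rest : ∀ {rest} → u ∈ e ∷ rest → u ∈ rest
        in-rest (here p)  = ⊥-elim (e≢u (sym p))
        in-rest (there k) = k
        go : ∃ (λ rest → al ↭ e ∷ rest) → Goal
        go (rest , split) = Event.colliding ok split j (proj₂ (∈⇒↭ (in-rest (∈-resp-↭ split j)))) pos′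
      collision : ∀ {e u} → e ∈ al → u ∈ al → 0 < gh e u → Goal
      -- The end of smaller degree is the one to move: only there `evt` is positive, and a sum of
      -- the smaller degrees is what `∑-min-degree` controls.
      collision {e} {u} i j pos′ = lighter (λ′ (proj₁ e) (proj₁ u)) ≡.refl
        where
        distinct : proj₁ e ≢ proj₁ u
        distinct eq = <-irrefl (sym (≡.trans (cong (g (proj₁ e)) (sym eq)) (g0 (proj₁ e))))
            (>0-*ˡ (g (proj₁ e) (proj₁ u)) (h (proj₂ e) (proj₂ u)) pos′)
        lighter : ∀ l → λ′ (proj₁ e) (proj₁ u) ≡ l → Goal
        lighter zero    eq = event j i (λ q → distinct (sym (cong proj₁ q)))
          (*-mono-< (λ′-total (proj₁ e) (proj₁ u) distinct eq) (<-≤-trans pos′ (m≤n+m (gh e u) (gh u e))))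
        lighter (suc l) eq = event i j (λ q → distinct (cong proj₁ q))
          (*-mono-< (≤-trans (s≤s z≤n) (≤-reflexive (sym eq))) (<-≤-trans pos′ (m≤m+n (gh e u) (gh u e))))
      first : ∀ s → ∑ al S′ ≡ s → Goal
      first (suc s) eq = go (∑>0⇒∃ al S′ (≤-trans (s≤s z≤n) (≤-reflexive (sym eq))))
        where
        go : ∃ (λ e → e ∈ al × 0 < S′ e) → Goal
        go (e , i , p) = Event.forbidden ok (proj₂ (∈⇒↭ i)) p
      first zero eq = go (∑>0⇒∃ al (λ e → ∑ al (gh e)) (>0-+ (∑ al S′) _ pos eq))
        where
        go : ∃ (λ e → e ∈ al × 0 < ∑ al (gh e)) → Goal
        go (e , i , p) = go′ (∑>0⇒∃ al (gh e) p)
          where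
          go′ : ∃ (λ u → u ∈ al × 0 < gh e u) → Goal
          go′ (u , j , q) = collision i j q

    cleanUp : ∀ fuel {al} → Good al → viol al ≤ fuel → Packs us ps S
    cleanUp fuel {al} ok le = go fuel (viol al) ≡.refl le
      where
      go : ∀ fuel x → viol al ≡ x → viol al ≤ fuel → Packs us ps S
      go _ zero eq _ = packs al (Good.firsts ok) (Good.seconds ok)
        (λ i → ∑≡0⇒∈ S′ (m+n≡0⇒m≡0 (∑ al S′) eq) i)
        (λ {e} i j → ∑≡0⇒∈ (gh e) (∑≡0⇒∈ (λ e → ∑ al (gh e)) (m+n≡0⇒n≡0 (∑ al S′) eq) i) j)
      go zero (suc x) eq le = ⊥-elim (n≮0 (<-≤-trans (≤-trans (s≤s z≤n) (≤-reflexive (sym eq))) le))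
      go (suc fuel) (suc x) eq le = next (improve ok (≤-trans (s≤s z≤n) (≤-reflexive (sym eq))))
        where
        next : ∃ (λ al′ → Good al′ × viol al′ < viol al) → Packs us ps S
        next (al′ , ok′ , lt) = cleanUp fuel ok′ (s≤s⁻¹ (<-≤-trans lt le))

-- The average over all bijections

module Start {n : ℕ} (g h : Fin n → Fin n → ℕ)
    (g≤1 : ∀ u v → g u v ≤ 1) (h≤1 : ∀ p q → h p q ≤ 1) (g0 : ∀ u → g u u ≡ 0) (h0 : ∀ p → h p p ≡ 0)
    (us ps : List (Fin n)) (S : Fin n → Fin n → ℕ) (us! : Unique us) (ps! : Unique ps)
    (Δ η ζ C K cnt : ℕ)
    (deg-h : ∀ {p} → p ∈ ps → deg h ps p ≤ Δ) (deg-g : ∀ {u} → u ∈ us → deg g us u ≤ η)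
    (rows : ∀ {v} → v ∈ us → (∑[ p ∈ ps ] S v p) ≤ η) (cols : ∀ {p} → p ∈ ps → (∑[ v ∈ us ] S v p) ≤ C)
    (few-big : (∑[ w ∈ us ] ⟦ suc ζ ≤? deg g us w ⟧ᵈ) ≤ cnt)
    (K≥₁ : 2 * Δ + ζ ≤ K) (K≥₂ : Δ + cnt ≤ K) (N≥ : C + 2 * Δ + η + 4 * K + 1 ≤ length us)
    (τ s M : ℕ) (S-small : ∀ {v p} → 0 < S v p → deg g us v ≤ τ) (a≤s² : arcs g us ≤ s * s)
    (length-us : length us ≡ 3 + M) (length-ps : length ps ≡ 3 + M)
    where

  open Packing g h
  open Swaps g≤1 h≤1 g0 h0 us ps S us! ps! Δ η ζ C K cnt deg-h deg-g rows cols few-big K≥₁ K≥₂ N≥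
  open Lighter (deg g us)

  a b φ : ℕ
  a = arcs g us
  b = arcs h ps
  φ = ∑[ v ∈ us ] row v

  private
    d : Fin n → ℕ
    d = deg g us

    f₁ f₂ f₃ : ℕ
    f₁ = ff₁ (length us) (length ps)
    f₂ = ff₂ (length us) (length ps)
    f₃ = ff₃ (length us) (length ps)

  -- Over all pairs (w , r) the two factors separate: each arc at v meets all arcs of h, each arc at
  -- p all arcs of g.
  ∑∑ρ : ∀ v p → (∑[ w ∈ us ] ∑[ r ∈ ps ] ρ (v , p) (w , r)) ≡ d v * b + deg h ps p * a
  ∑∑ρ v p = begin
    (∑[ w ∈ us ] ∑[ r ∈ ps ] ρ (v , p) (w , r))
      ≡⟨ ∑-cong us inner ⟩
    (∑[ w ∈ us ] g v w * b + g w v * b + (outdeg h ps p * indeg g us w + indeg h ps p * outdeg g us w))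
      ≡⟨ ≡.trans (∑-+ us _ _) (cong₂ _+_
           (≡.trans (∑-+ us _ _) (cong₂ _+_ (∑-*ʳ us b (g v)) (∑-*ʳ us b (λ w → g w v))))
           (≡.trans (∑-+ us _ _) (cong₂ _+_ (≡.trans (∑-*ˡ us (outdeg h ps p) (indeg g us))
               (cong (outdeg h ps p *_) (∑-indeg g us)))
             (∑-*ˡ us (indeg h ps p) (outdeg g us))))) ⟩
    outdeg g us v * b + indeg g us v * b + (outdeg h ps p * a + indeg h ps p * a)
      ≡⟨ cong₂ _+_ (sym (*-distribʳ-+ b (outdeg g us v) _)) (sym (*-distribʳ-+ a (outdeg h ps p) _)) ⟩
    d v * b + deg h ps p * a ∎
    where
    open ≡.≡-Reasoning
    inner : ∀ w → (∑[ r ∈ ps ] ρ (v , p) (w , r)) ≡ g v w * b + g w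
        v * b + (outdeg h ps p * indeg g us w + indeg h ps p * outdeg g us w)
    inner w = ≡.trans (∑-+ ps _ _) (cong₂ _+_
      (≡.trans (∑-+ ps _ _) (cong₂ _+_ (≡.trans (∑-*ˡ ps (g v w) (indeg h ps)) (cong (g v w *_) (∑-indeg h ps)))
          (∑-*ˡ ps (g w v) (outdeg h ps))))
      (≡.trans (∑-+ ps _ _) (cong₂ _+_ (∑-*ʳ ps (indeg g us w) (h p)) (∑-*ʳ ps (outdeg g us w) (λ r → h r p)))))

  ∑∑h : ∀ x y → (∑[ p ∈ ps ] ∑[ q ∈ ps ] x * h p q + y * h q p) ≡ (x + y) * b
  ∑∑h x y = begin
    (∑[ p ∈ ps ] ∑[ q ∈ ps ] x * h p q + y * h q p)
      ≡⟨ ∑-cong ps (λ p → ≡.trans (∑-+ ps _ _) (cong₂ _+_ (∑-*ˡ ps x (h p)) (∑-*ˡ ps y (λ q → h q p)))) ⟩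
    (∑[ p ∈ ps ] x * outdeg h ps p + y * indeg h ps p)
      ≡⟨ ≡.trans (∑-+ ps _ _) (cong₂ _+_ (∑-*ˡ ps x _) (≡.trans (∑-*ˡ ps y _) (cong (y *_) (∑-indeg h ps)))) ⟩
    x * b + y * b ≡⟨ sym (*-distribʳ-+ b x y) ⟩
    (x + y) * b ∎
    where open ≡.≡-Reasoning

  private
    m : Fin n → Fin n → ℕ
    m v u = λ′ v u * (g v u + g u v)

    ∑∑evt : ∀ v u → (∑[ p ∈ ps ] ∑[ q ∈ ps ] evt (v , p) (u , q)) ≡ m v u * b
    ∑∑evt v u = ≡.trans (∑-cong ps (λ p → ∑-*ˡ ps (λ′ v u) (λ q → cross (v , p) (u , q))))
      (≡.trans (∑-*ˡ ps (λ′ v u) _) (≡.trans (cong (λ′ v u *_) (∑∑h (g v u) (g u v))) (sym (*-assoc (λ′ v u) _ b))))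

    ∑∑m≤a : (∑[ v ∈ us ] ∑[ u ∈ us ] m v u) ≤ a
    ∑∑m≤a = ∑∑-λ′ us (λ v → v) g

    ∑m≤d : ∀ v → (∑[ u ∈ us ] m v u) ≤ d v
    ∑m≤d v = ≤-trans (∑-mono us (λ u → ≤1-* (g v u + g u v) (≤-trans (m≤m+n (λ′ v u) (λ′ u v)) (λ′-exclusive v u))))
      (≤-reflexive (∑-+ us (g v) (λ u → g u v)))

    -- Either the row of v is empty, or v has a forbidden position and `S-small` bounds its degree
    -- by τ.
    row*d : ∀ v → row v * d v ≤ row v * τ
    row*d v = go (row v) ≡.refl
      where
      go : ∀ r → row v ≡ r → r * d v ≤ r * τ
      go zero    _  = z≤n
      go (suc r) eq = *-monoʳ-≤ (suc r) (found (∑>0⇒∃ ps (S v) (≤-trans (s≤s z≤n) (≤-reflexive (sym eq)))))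
        where
        found : ∃ (λ p → p ∈ ps × 0 < S v p) → d v ≤ τ
        found (p , _ , pos) = S-small pos

    ∑row*d : (∑[ v ∈ us ] row v * d v) ≤ τ * φ
    ∑row*d = ≤-trans (∑-mono us row*d) (≤-reflexive (≡.trans (∑-*ʳ us τ row) (*-comm φ τ)))

  T-gh : T₂ us ps gh ≡ a * b
  T-gh = ≡.trans (∑-cong us (λ u → ≡.trans (∑-cong us (λ v →
      ≡.trans (∑-cong ps (λ p → ∑-*ˡ ps (g u v) (h p))) (∑-*ˡ ps (g u v) _)))
    (∑-*ʳ us b (g u)))) (∑-*ʳ us b _)

  T-list : T₂ us ps (λ e z → S′ e * ρ′ e z) ≤ τ * φ * b + φ * (Δ * a)
  T-list = begin
    T₂ us ps (λ e z → S′ e * ρ′ e z)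
      ≡⟨ ∑-cong us (λ v → ≡.trans (∑-cong us (λ w → ∑-cong ps (λ p → ∑-*ˡ ps (S v p) (λ r → ρ′ (v , p) (w , r)))))
          (≡.trans (∑-swap us ps _)
           (∑-cong ps (λ p → ∑-*ˡ us (S v p) _)))) ⟩
    (∑[ v ∈ us ] ∑[ p ∈ ps ] S v p * (∑[ w ∈ us ] ∑[ r ∈ ps ] ρ′ (v , p) (w , r)))
      ≤⟨ ∑-mono us (λ v → ∑-mono-∈ ps (λ {p} i → *-monoʳ-≤ (S v p)
          (≤-trans (∑-mono us (λ w → ∑-mono ps (λ r → ρ′≤ρ (v , p) (w , r))))
           (≤-trans (≤-reflexive (∑∑ρ v p)) (+-monoʳ-≤ (d v * b) (*-monoˡ-≤ a (deg-h i))))))) ⟩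
    (∑[ v ∈ us ] ∑[ p ∈ ps ] S v p * (d v * b + Δ * a))
      ≡⟨ ∑-cong us (λ v → ≡.trans (∑-*ʳ ps (d v * b + Δ * a) (S v))
          (≡.trans (*-distribˡ-+ (row v) (d v * b) (Δ * a))
          (cong (_+ row v * (Δ * a)) (sym (*-assoc (row v) (d v) b))))) ⟩
    (∑[ v ∈ us ] row v * d v * b + row v * (Δ * a))
      ≡⟨ ≡.trans (∑-+ us _ _) (cong₂ _+_ (∑-*ʳ us b _) (∑-*ʳ us (Δ * a) row)) ⟩
    (∑[ v ∈ us ] row v * d v) * b + φ * (Δ * a)
      ≤⟨ +-monoˡ-≤ (φ * (Δ * a)) (*-monoˡ-≤ b ∑row*d) ⟩
    τ * φ * b + φ * (Δ * a) ∎
    where open ≤-Reasoning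

  T-row : T₂ us ps (λ e u → evt e u * row (proj₁ e)) ≤ τ * φ * b
  T-row = begin
    T₂ us ps (λ e u → evt e u * row (proj₁ e))
      ≡⟨ ∑-cong us (λ v → ∑-cong us (λ u → ≡.trans (∑-cong ps (λ p → ∑-*ʳ ps (row v) (λ q → evt (v , p) (u , q))))
          (≡.trans (∑-*ʳ ps (row v) _) (cong (_* row v) (∑∑evt v u))))) ⟩
    (∑[ v ∈ us ] ∑[ u ∈ us ] m v u * b * row v)
      ≡⟨ ∑-cong us (λ v → ≡.trans (∑-*ʳ us (row v) _) (cong (_* row v) (∑-*ʳ us b (m v)))) ⟩
    (∑[ v ∈ us ] ∑ us (m v) * b * row v)
      ≤⟨ ∑-mono us (λ v → *-monoˡ-≤ (row v) (*-monoˡ-≤ b (∑m≤d v))) ⟩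
    (∑[ v ∈ us ] d v * b * row v)
      ≡⟨ ∑-cong us (λ v → (≤-antisym
          (lin ((d v) ∷ b ∷ (row v) ∷ [])
            (λ x b r → [] ⇒ x :* b :* r :≤ r :* x :* b)
            0 []
            tt)
          (lin ((d v) ∷ b ∷ (row v) ∷ [])
            (λ x b r → [] ⇒ r :* x :* b :≤ x :* b :* r)
            0 []
            tt))) ⟩
    (∑[ v ∈ us ] row v * d v * b) ≡⟨ ∑-*ʳ us b _ ⟩
    (∑[ v ∈ us ] row v * d v) * b ≤⟨ *-monoˡ-≤ b ∑row*d ⟩
    τ * φ * b ∎
    where open ≤-Reasoning

  T-evt : T₃ us ps (λ e u z → evt e u * (κ u z * ρ′ e z)) ≤ b * (b * (s * (2 * a))) + Δ * a * (a * b)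
  T-evt = begin
    T₃ us ps (λ e u z → evt e u * (κ u z * ρ′ e z))
      ≤⟨ ∑-mono us (λ v → ∑-mono us (λ u → ∑-mono us (λ w → ∑-mono ps (λ p → ∑-mono ps (λ q → ∑-mono ps (λ r →
           *-monoʳ-≤ (evt (v , p) (u , q)) (≤-trans (≤1-* _ (κ≤1 (u , q) (w , r))) (ρ′≤ρ (v , p) (w , r))))))))) ⟩
    (∑[ v ∈ us ] ∑[ u ∈ us ] ∑[ w ∈ us ] ∑[ p ∈ ps ] ∑[ q ∈ ps ] ∑[ r ∈ ps ] evt (v , p) (u , q) * ρ (v , p) (w , r))
      ≡⟨ ∑-cong us (λ v → ∑-cong us (λ u → ≡.trans (∑-swap us ps _)
          (∑-cong ps (λ p → ≡.trans (∑-swap us ps _) (∑-cong ps (λ q →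
           ≡.trans (∑-cong us (λ w → ∑-*ˡ ps (evt (v , p) (u , q)) (λ r → ρ (v , p) (w , r))))
               (∑-*ˡ us (evt (v , p) (u , q)) _))))))) ⟩
    (∑[ v ∈ us ] ∑[ u ∈ us ] ∑[ p ∈ ps ] ∑[ q ∈ ps ] evt (v , p) (u , q) * (∑[ w ∈ us ] ∑[ r ∈ ps ] ρ (v , p) (w , r)))
      ≤⟨ ∑-mono us (λ v → ∑-mono us (λ u → ∑-mono-∈ ps (λ {p} i → ∑-mono ps (λ q → *-monoʳ-≤ (evt (v , p) (u , q))
           (≤-trans (≤-reflexive (∑∑ρ v p)) (+-monoʳ-≤ (d v * b) (*-monoˡ-≤ a (deg-h i)))))))) ⟩
    (∑[ v ∈ us ] ∑[ u ∈ us ] ∑[ p ∈ ps ] ∑[ q ∈ ps ] evt (v , p) (u , q) * (d v * b + Δ * a))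
      ≡⟨ ∑-cong us (λ v → ∑-cong us (λ u → ≡.trans (∑-cong ps (λ p → ∑-*ʳ ps (d v * b + Δ * a) _))
          (≡.trans (∑-*ʳ ps (d v * b + Δ * a) _)
           (≡.trans (cong (_* (d v * b + Δ * a)) (∑∑evt v u)) (≤-antisym
               (lin ((m v u) ∷ b ∷ (d v) ∷ Δ ∷ a ∷ (Δ * a) ∷ [])
                 (λ m b x Δ a Δa → [] ⇒ m :* b :* (x :* b :+ Δa) :≤ b :* (b :* (m :* x)) :+ Δa :* (m :* b))
                 0 []
                 tt)
               (lin ((m v u) ∷ b ∷ (d v) ∷ Δ ∷ a ∷ (Δ * a) ∷ [])
                 (λ m b x Δ a Δa → [] ⇒ b :* (b :* (m :* x)) :+ Δa :* (m :* b) :≤ m :* b :* (x :* b :+ Δa))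
                 0 []
                 tt)))))) ⟩
    (∑[ v ∈ us ] ∑[ u ∈ us ] b * (b * (m v u * d v)) + Δ * a * (m v u * b))
      ≡⟨ ≡.trans (∑-cong us (λ v → ∑-+ us _ _)) (∑-+ us _ _) ⟩
    (∑[ v ∈ us ] ∑[ u ∈ us ] b * (b * (m v u * d v))) + (∑[ v ∈ us ] ∑[ u ∈ us ] Δ * a * (m v u * b))
      ≡⟨ cong₂ _+_
           (≡.trans (∑-cong us (λ v → ≡.trans (∑-*ˡ us b _) (cong (b *_) (∑-*ˡ us b _))))
               (≡.trans (∑-*ˡ us b _) (cong (b *_) (∑-*ˡ us b _))))
           (≡.trans (∑-cong us (λ v → ≡.trans (∑-*ˡ us (Δ * a) _) (cong (Δ * a *_) (∑-*ʳ us b (m v)))))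
               (≡.trans (∑-*ˡ us (Δ * a) _) (cong (Δ * a *_) (∑-*ʳ us b _)))) ⟩
    b * (b * (∑[ v ∈ us ] ∑[ u ∈ us ] m v u * d v)) + Δ * a * ((∑[ v ∈ us ] ∑ us (m v)) * b)
      ≤⟨ +-mono-≤ (*-monoʳ-≤ b (*-monoʳ-≤ b (∑-min-degree g us g≤1 s a≤s²))) (*-monoʳ-≤ (Δ * a) (*-monoˡ-≤ b ∑∑m≤a)) ⟩
    b * (b * (s * (2 * a))) + Δ * a * (a * b) ∎
    where open ≤-Reasoning

  -- One number that dominates every quantity in `Good`: the sum for a single entry or event is at
  -- most the sum over all of them, so `Y al < 5 * K` yields both invariants at once.
  Y : List E → ℕ
  Y al = K * viol al + (∑[ e ∈ al ] ∑[ z ∈ al ] S′ e * ρ′ e z) + (∑[ e ∈ al ] ∑[ u ∈ al ] evt e u * row (proj₁ e))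
    + (∑[ e ∈ al ] ∑[ u ∈ al ] ∑[ z ∈ al ] evt e u * (κ u z * ρ′ e z))

  𝔼-Y : 𝔼 us ps Y ≤ K * (f₁ * φ + f₂ * (a * b)) + f₂ * (τ * φ * b + φ * (Δ * a)) + f₂ * (τ * φ * b) + f₃ *
      (b * (b * (s * (2 * a))) + Δ * a * (a * b))
  𝔼-Y = begin
    𝔼 us ps Y
      ≡⟨ ≡.trans (𝔼-+ us ps _ _) (cong (_+ 𝔼 us ps Y₄) (≡.trans (𝔼-+ us ps _ _)
          (cong (_+ 𝔼 us ps Y₃) (≡.trans (𝔼-+ us ps _ _)
           (cong (_+ 𝔼 us ps Y₂) (≡.trans (𝔼-* us ps K viol) (cong (K *_) (𝔼-+ us ps _ _)))))))) ⟩
    K * (𝔼 us ps (λ al → ∑ al S′) + 𝔼 us ps (λ al → ∑[ e ∈ al ] ∑ al (gh e))) + 𝔼 us ps Y₂ + 𝔼 us ps Y₃ + 𝔼 us ps Y₄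
      ≤⟨ +-mono-≤ (+-mono-≤ (+-mono-≤ (*-monoʳ-≤ K (+-mono-≤ (𝔼₁ us ps S′)
             (≤-trans (𝔼₂ us ps gh (λ u v p → ≡.trans (cong (g u v *_) (h0 p)) (*-zeroʳ (g u v))))
                 (≤-reflexive (cong (f₂ *_) T-gh)))))
           (≤-trans (𝔼₂ us ps _ (λ u v p → ≡.trans (cong (S u p *_) (0ρ′ u v p)) (*-zeroʳ (S u p))))
               (*-monoʳ-≤ f₂ T-list)))
           (≤-trans (𝔼₂ us ps _ (λ u v p → cong (_* row u) (0evt u v p))) (*-monoʳ-≤ f₂ T-row)))
           (≤-trans (𝔼₃ us ps _ (λ u v w p q → cong (_* (κ (v , p) (w , q) * ρ′ (u , p) (w , q))) (0evt u v p))
             (λ u v w p q → ≡.trans (cong (λ x → evt (u , p) (v , q) * (κ (v , q) (w , p) * x)) (0ρ′ u w p))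
                 (0* (evt (u , p) (v , q)) (κ (v , q) (w , p))))
             (λ u v w p q → ≡.trans (cong (λ x → evt (u , q) (v , p) * (ne v w * x * ρ′ (u , q) (w , p)))
                 (ne-refl p)) (0*′ (evt (u , q) (v , p)) (ne v w) (ρ′ (u , q) (w , p)))))
             (*-monoʳ-≤ f₃ T-evt)) ⟩
    K * (f₁ * φ + f₂ * (a * b)) + f₂ * (τ * φ * b + φ * (Δ * a)) + f₂ * (τ * φ * b) + f₃ *
        (b * (b * (s * (2 * a))) + Δ * a * (a * b)) ∎
    where
    open ≤-Reasoning
    Y₂ Y₃ Y₄ : List E → ℕ
    Y₂ al = ∑[ e ∈ al ] ∑[ z ∈ al ] S′ e * ρ′ e z
    Y₃ al = ∑[ e ∈ al ] ∑[ u ∈ al ] evt e u * row (proj₁ e)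
    Y₄ al = ∑[ e ∈ al ] ∑[ u ∈ al ] ∑[ z ∈ al ] evt e u * (κ u z * ρ′ e z)
    0* : ∀ x y → x * (y * 0) ≡ 0
    0* x y = ≡.trans (cong (x *_) (*-zeroʳ y)) (*-zeroʳ x)
    0*′ : ∀ x y z → x * (y * 0 * z) ≡ 0
    0*′ x y z = ≡.trans (cong (λ t → x * (t * z)) (*-zeroʳ y)) (*-zeroʳ x)
    0ρ′ : ∀ u v p → ρ′ (u , p) (v , p) ≡ 0
    0ρ′ u v p = cong (_* ρ (u , p) (v , p)) (ne-refl p)
    0evt : ∀ u v p → evt (u , p) (v , p) ≡ 0
    0evt u v p = ≡.trans (cong (λ x → λ′ u v * (g u v * x + g v u * x)) (h0 p))
      (≡.trans (cong₂ (λ x y → λ′ u v * (x + y)) (*-zeroʳ (g u v)) (*-zeroʳ (g v u))) (*-zeroʳ (λ′ u v)))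

  -- The bound on the average, cleared of denominators: for N = 3 + M the values of `ff₁`, `ff₂`,
  -- `ff₃` and `ff` are (2 + M)(1 + M), 1 + M, 1 and (3 + M)(2 + M)(1 + M) times `ff M M`.
  module _ (inequality :
    (2 + M) * (1 + M) * (K * φ) + (1 + M) * (K * (a * b) + (τ * φ * b + φ * (Δ * a)) + τ * φ * b) +
        (b * (b * (s * (2 * a))) + Δ * a * (a * b))
      < (3 + M) * ((2 + M) * ((1 + M) * (5 * K)))) where

    𝔼-Y< : 𝔼 us ps Y < 𝔼 us ps (λ _ → 5 * K)
    𝔼-Y< = ≤-<-trans 𝔼-Y (<-≤-trans (bound (length us) (length ps) length-us length-ps)
        (≤-reflexive (sym (𝔼-const us ps (5 * K)))))
      where
      bound : ∀ k l → k ≡ 3 + M → l ≡ 3 + M →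
        K * (ff₁ k l * φ + ff₂ k l * (a * b)) + ff₂ k l * (τ * φ * b + φ * (Δ * a)) + ff₂ k l * (τ * φ * b) + ff₃ k
            l * (b * (b * (s * (2 * a))) + Δ * a * (a * b))
          < ff k l * (5 * K)
      bound k l ≡.refl ≡.refl = ≤-<-trans
        (lin (M ∷ F ∷ K ∷ φ ∷ (a * b) ∷ (τ * φ * b + φ * (Δ * a)) ∷ (τ * φ * b) ∷
            (b * (b * (s * (2 * a))) + Δ * a * (a * b)) ∷ [])
              (λ M F K φ A B D X → [] ⇒ K :* ((con 2 :+ M) :* ((con 1 :+ M) :* F) :* φ :+ (con 1 :+ M) :* F :* A) :+
                  (con 1 :+ M) :* F :* B :+ (con 1 :+ M) :* F :* D :+ F :* X :≤ F :*
                  ((con 2 :+ M) :* (con 1 :+ M) :* (K :* φ) :+ (con 1 :+ M) :* (K :* A :+ B :+ D) :+ X))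
              0 []
              tt)
        (<-≤-trans (*-monoʳ-< F ⦃ F≢0 ⦄ inequality)
        (lin (M ∷ F ∷ K ∷ [])
              (λ M F K → [] ⇒ F :* ((con 3 :+ M) :* ((con 2 :+ M) :* ((con 1 :+ M) :* (con 5 :* K)))) :≤ (con
                  3 :+ M) :* ((con 2 :+ M) :* ((con 1 :+ M) :* F)) :* (con 5 :* K))
              0 []
              tt))
        where
        F = ff M M
        ff>0 : ∀ j → 0 < ff j j
        ff>0 zero    = s≤s z≤n
        ff>0 (suc j) = <-≤-trans (ff>0 j) (m≤m+n (ff j j) (j * ff j j))
        F≢0 : NonZero F
        F≢0 = >-nonZero (ff>0 M)

    start : ∃ λ al → Good al
    start = found (𝔼⇒∃ us ps Y (λ _ → 5 * K) 𝔼-Y<)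
      where
      found : ∃ (λ al → Injects us ps al × Y al < 5 * K) → ∃ λ al → Good al
      found (al , injects rest eq₁ eq₂ , lt) = al , good (↭-reflexive eq₁) seconds′ inv₁ inv₂
        where
        length-rest : ∀ r → length r ≡ 0 → r ≡ []
        length-rest [] _ = ≡.refl
        rest≡[] : rest ≡ []
        rest≡[] = length-rest rest (+-cancelˡ-≡ (length al) _ _ (begin
          length al + length rest ≡⟨ cong (_+ length rest) (sym (length-map proj₂ al)) ⟩
          length (map proj₂ al) + length rest ≡⟨ sym (length-++ (map proj₂ al)) ⟩
          length (map proj₂ al ++ rest) ≡⟨ sym (↭-length eq₂) ⟩
          length ps ≡⟨ ≡.trans length-ps (sym length-us) ⟩
          length us ≡⟨ cong length (sym eq₁) ⟩
          length (map proj₁ al) ≡⟨ length-map proj₁ al ⟩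
          length al ≡⟨ sym (+-identityʳ _) ⟩
          length al + 0 ∎))
          where open ≡.≡-Reasoning
        seconds′ : map proj₂ al ↭ ps
        seconds′ = ↭-sym (subst (λ r → ps ↭ r) (≡.trans (cong (map proj₂ al ++_) rest≡[]) (++-identityʳ _)) eq₂)
        Y₂ Y₃ Y₄ : ℕ
        Y₂ = ∑[ e ∈ al ] ∑[ z ∈ al ] S′ e * ρ′ e z
        Y₃ = ∑[ e ∈ al ] ∑[ u ∈ al ] evt e u * row (proj₁ e)
        Y₄ = ∑[ e ∈ al ] ∑[ u ∈ al ] ∑[ z ∈ al ] evt e u * (κ u z * ρ′ e z)
        inv₁ : ∀ {e} → e ∈ al → 0 < S′ e → ∑ al (ρ′ e) + viol al * K < 5 * K
        inv₁ {e} i pos = (lin ((∑ al (ρ′ e)) ∷ (viol al) ∷ K ∷ Y₂ ∷ Y₃ ∷ Y₄ ∷ [])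
              (λ Q X K Y₂ Y₃ Y₄ → (Q :≤ Y₂) ∷ (K :* X :+ Y₂ :+ Y₃ :+ Y₄ :< con 5 :* K) ∷ [] ⇒ Q :+ X :* K :< con 5 :* K)
              0 (1 ∷ 1 ∷ [])
              (≤-trans (≤-trans (>0-* (∑ al (ρ′ e)) pos) (≤-reflexive (sym (∑-*ˡ al (S′ e) (ρ′ e)))))
                  (∑-∈ (λ e → ∑[ z ∈ al ] S′ e * ρ′ e z) i) , lt , tt))
        inv₂ : ∀ {e u} → e ∈ al → u ∈ al → 0 < evt e u → row (proj₁ e) + (∑[ z ∈ al ] κ u z * ρ′ e z) + viol al * K
            < 5 * K
        inv₂ {e} {u} i j pos = (lin ((row (proj₁ e)) ∷ (∑[ z ∈ al ] κ u z * ρ′ e z) ∷ (viol al) ∷ K ∷ Y₂ ∷ Y₃ ∷ Y₄ ∷ [])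
              (λ R Q X K Y₂ Y₃ Y₄ → (R :≤ Y₃) ∷ (Q :≤ Y₄) ∷ (K :* X :+ Y₂ :+ Y₃ :+ Y₄ :< con 5 :* K) ∷ [] ⇒
                  R :+ Q :+ X :* K :< con 5 :* K)
              0 (1 ∷ 1 ∷ 1 ∷ [])
              (≤-trans (>0-* (row (proj₁ e)) pos) (≤-trans (∑-∈ (λ u → evt e u * row (proj₁ e)) j)
                  (∑-∈ (λ e → ∑[ u ∈ al ] evt e u * row (proj₁ e)) i)) ,
                  ≤-trans (≤-trans (>0-* (∑[ z ∈ al ] κ u z * ρ′ e z) pos)
                  (≤-reflexive (sym (∑-*ˡ al (evt e u) (λ z → κ u z * ρ′ e z)))))
                  (≤-trans (∑-∈ (λ u → ∑[ z ∈ al ] evt e u * (κ u z * ρ′ e z)) j)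
                  (∑-∈ (λ e → ∑[ u ∈ al ] ∑[ z ∈ al ] evt e u * (κ u z * ρ′ e z)) i)) , lt , tt))

    packing : Packs us ps S
    packing = cleanUp (viol (proj₁ start)) (proj₂ start) ≤-refl

-- Tree components

length-concat : ∀ {A : Set} (xss : List (List A)) → length (concat xss) ≡ ∑ xss length
length-concat []         = ≡.refl
length-concat (xs ∷ xss) = ≡.trans (length-++ xs) (cong (length xs +_) (length-concat xss))

record Split {A : Set} (P : List A → Set) (bs : List (List A)) : Set where
  constructor splitting
  field
    as ns   : List (List A)
    whole   : concat bs ↭ concat as ++ concat ns
    pieces  : bs ↭ as ++ ns
    all-as  : ∀ {B} → B ∈ as → P B
    all-ns  : ∀ {B} → B ∈ ns → ¬ P B

split : ∀ {A : Set} {P : List A → Set} → (∀ B → Dec (P B)) → ∀ bs → Split P bs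
split P? [] = splitting [] [] refl refl (λ ()) (λ ())
split P? (B ∷ bs) with P? B | split P? bs
... | yes p | splitting as ns w q a n = splitting (B ∷ as) ns
  (↭-trans (++⁺ˡ B w) (↭-reflexive (sym (++-assoc B (concat as) (concat ns))))) (prep B q)
  (λ { (here ≡.refl) → p ; (there i) → a i }) n
... | no ¬p | splitting as ns w q a n = splitting as (B ∷ ns)
  (↭-trans (++⁺ˡ B w) (shifts B (concat as))) (↭-trans (prep B q) (↭-sym (shift B as ns)))
  a (λ { (here ≡.refl) → ¬p ; (there i) → n i })

module _ {V : Set} (g : V → V → ℕ) (g0 : ∀ u → g u u ≡ 0) where

  adjacency : V → V → ℕ
  adjacency u v = g u v + g v u

  record Components (xs : List V) : Set where
    constructor components
    field
      blocks    : List (List V)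
      cover     : concat blocks ↭ xs
      closed    : ∀ {B} → B ∈ blocks → ∀ {t v} → t ∈ B → v ∈ xs → 0 < adjacency t v → v ∈ B
      connected : ∀ {B} → B ∈ blocks → length B ≤ suc (arcs g B)

  arcs-concat : ∀ (bs : List (List V)) → ∑ bs (arcs g) ≤ arcs g (concat bs)
  arcs-concat bs = ≤-trans
    (∑-mono-∈ bs (λ {B} i → ∑-mono B (λ t → ≤-trans (∑-∈ (λ B → ∑ B (g t)) i) (≤-reflexive (sym (∑-concat bs (g t)))))))
    (≤-reflexive (sym (∑-concat bs (outdeg g (concat bs)))))

  -- All blocks that v touches merge with it. Each of them supplies at least one arc at v, which
  -- makes up for the unit that its own bound |B| ≤ 1 + arcs gives away.
  Components-∷ : ∀ v {xs} → Components xs → Components (v ∷ xs)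
  Components-∷ v {xs} (components bs cover closed connected) = components (B₀ ∷ ns) cover′ closed′ connected′
    where
    touch : List V → ℕ
    touch B = ∑ B (adjacency v)
    open Split (split (λ B → 1 ≤? touch B) bs)
    B₀ = v ∷ concat as
    cover′ : concat (B₀ ∷ ns) ↭ v ∷ xs
    cover′ = prep v (↭-trans (↭-sym whole) cover)
    as⊆bs : ∀ {B} → B ∈ as → B ∈ bs
    as⊆bs i = ∈-resp-↭ (↭-sym pieces) (∈-++⁺ˡ i)
    ns⊆bs : ∀ {B} → B ∈ ns → B ∈ bs
    ns⊆bs i = ∈-resp-↭ (↭-sym pieces) (∈-++⁺ʳ as i)
    neighbour : ∀ {w} → w ∈ xs → 0 < adjacency v w → w ∈ concat as
    neighbour {w} i pos with ∈-++⁻ (concat as) (∈-resp-↭ whole (∈-resp-↭ (↭-sym cover) i))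
    ... | inj₁ j = j
    ... | inj₂ j with ∈-concat⁻′ ns j
    ...   | B , w∈B , B∈ns = ⊥-elim (all-ns B∈ns (≤-trans pos (∑-∈ (adjacency v) w∈B)))
    closed′ : ∀ {B} → B ∈ B₀ ∷ ns → ∀ {t w} → t ∈ B → w ∈ v ∷ xs → 0 < adjacency t w → w ∈ B
    closed′ (here ≡.refl) _ (here ≡.refl) _ = here ≡.refl
    closed′ (here ≡.refl) (here ≡.refl) (there i) pos = there (neighbour i pos)
    closed′ (here ≡.refl) (there t∈) (there i) pos with ∈-concat⁻′ as t∈
    ... | B , t∈B , B∈as = there (∈-concat⁺′ (closed (as⊆bs B∈as) t∈B i pos) B∈as)
    closed′ (there B∈ns) {t} t∈B (here ≡.refl) pos =
      ⊥-elim (all-ns B∈ns (≤-trans (≤-trans pos (≤-reflexive (+-comm (g t v) (g v t)))) (∑-∈ (adjacency v) t∈B)))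
    closed′ (there B∈ns) t∈B (there i) pos = closed (ns⊆bs B∈ns) t∈B i pos
    connected′ : ∀ {B} → B ∈ B₀ ∷ ns → length B ≤ suc (arcs g B)
    connected′ (there B∈ns) = connected (ns⊆bs B∈ns)
    connected′ (here ≡.refl) = (lin ((length (concat as)) ∷ (∑ as length) ∷ (length as) ∷ (∑ as (arcs g)) ∷
        (arcs g (concat as)) ∷ (deg g (concat as) v) ∷ (arcs g B₀) ∷ (∑[ B ∈ as ] 1 + arcs g B) ∷ (∑[ B ∈ as ] 1) ∷
        (∑ as touch) ∷ (∑ (concat as) (adjacency v)) ∷ [])
          (λ l L k A A′ D a kA k1 T T′ → (l :≤ L) ∷ (L :≤ kA) ∷ (kA :≤ k1 :+ A) ∷ (k1 :≤ T) ∷ (T :≤ T′) ∷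
              (T′ :≤ D) ∷ (A :≤ A′) ∷ (D :+ A′ :≤ a) ∷ [] ⇒ (con 1 :+ l) :≤ (con 1 :+ a))
          0 (1 ∷ 1 ∷ 1 ∷ 1 ∷ 1 ∷ 1 ∷ 1 ∷ 1 ∷ [])
          (≤-reflexive (length-concat as) , ∑-mono-∈ as (λ i → connected (as⊆bs i)) ,
              ≤-reflexive (∑-+ as (λ _ → 1) (arcs g)) , ∑-mono-∈ as all-as ,
              ≤-reflexive (sym (∑-concat as (adjacency v))) , ≤-reflexive (∑-+ (concat as) (g v) (λ t → g t v)) ,
              arcs-concat as , ≤-reflexive (sym (arcs-∷ g v (concat as) (g0 v))) , tt))

  all-components : ∀ xs → Components xs
  all-components [] = components [] refl (λ ()) (λ ())
  all-components (x ∷ xs) = Components-∷ x (all-components xs)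

  -- Connectedness is not recorded: closure under adjacency and the number of arcs are all that is used.
  record Tree (T : List V) : Set where
    constructor tree
    field
      closed : ∀ {t v} → t ∈ T → 0 < adjacency t v → v ∈ T
      size   : length T ≡ suc (arcs g T)

  record Forest (xs : List V) : Set where
    constructor forest
    field
      trees : List (List V)
      other : List V
      cover : xs ↭ concat trees ++ other
      count : length xs ≤ arcs g xs + length trees
      are-trees : ∀ {T} → T ∈ trees → Tree T

  -- A block with fewer arcs than vertices is a tree by the bound in `connected`; every other block
  -- has at least as many arcs as vertices. So only the trees, by one each, let the vertices
  -- outnumber the arcs.
  all-trees : ∀ xs → (∀ v → v ∈ xs) → Forest xs
  all-trees xs all∈ = forest as (concat ns) (↭-trans (↭-sym cover) whole) count λ i →
    tree (λ t∈ pos → closed (as⊆ i) t∈ (all∈ _) pos) (≤-antisym (connected (as⊆ i)) (all-as i))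
    where
    open Components (all-components xs)
    open Split (split (λ B → arcs g B <? length B) blocks)
    as⊆ : ∀ {B} → B ∈ as → B ∈ blocks
    as⊆ i = ∈-resp-↭ (↭-sym pieces) (∈-++⁺ˡ i)
    count : length xs ≤ arcs g xs + length as
    count = (lin ((length xs) ∷ (length (concat blocks)) ∷ (∑ blocks length) ∷ (∑ as length) ∷ (∑ ns length) ∷
        (∑ as (arcs g)) ∷ (∑ ns (arcs g)) ∷ (arcs g xs) ∷ (arcs g (concat blocks)) ∷ (∑ blocks (arcs g)) ∷
        (∑ (as ++ ns) length) ∷ (∑ (as ++ ns) (arcs g)) ∷ (length as) ∷ (∑[ B ∈ as ] 1 + arcs g B) ∷
        (∑[ B ∈ as ] 1) ∷ [])
          (λ l lc L La Ln Aa An a ac A L′ A′ k kA k1 → (l :≤ lc) ∷ (lc :≤ L) ∷ (L :≤ L′) ∷ (L′ :≤ La :+ Ln) ∷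
              (ac :≤ a) ∷ (A :≤ ac) ∷ (A′ :≤ A) ∷ (Aa :+ An :≤ A′) ∷ (La :≤ kA) ∷ (kA :≤ k1 :+ Aa) ∷
              (k1 :≤ k :* con 1) ∷ (Ln :≤ An) ∷ [] ⇒ l :≤ a :+ k)
          0 (1 ∷ 1 ∷ 1 ∷ 1 ∷ 1 ∷ 1 ∷ 1 ∷ 1 ∷ 1 ∷ 1 ∷ 1 ∷ 1 ∷ [])
          (≤-reflexive (sym (↭-length cover)) , ≤-reflexive (length-concat blocks) ,
              ≤-reflexive (∑-↭ length pieces) , ≤-reflexive (∑-++ as ns length) , ≤-reflexive (arcs-↭ g cover) ,
              arcs-concat blocks , ≤-reflexive (sym (∑-↭ (arcs g) pieces)) ,
              ≤-reflexive (sym (∑-++ as ns (arcs g))) , ∑-mono-∈ as (λ i → connected (as⊆ i)) ,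
              ≤-reflexive (∑-+ as (λ _ → 1) (arcs g)) , ≤-reflexive (∑-const as 1) ,
              ∑-mono-∈ ns (λ i → ≮⇒≥ (all-ns i)) , tt))

  Tree-deg : ∀ {T} → Tree T → ∀ {t} → t ∈ T → suc (deg g T t) ≤ length T
  Tree-deg {T} (tree closed size) {t} i = go (∈⇒↭ i)
    where
    go : ∃ (λ ys → T ↭ t ∷ ys) → suc (deg g T t) ≤ length T
    go (ys , p) = (lin ((length T) ∷ (arcs g T) ∷ (arcs g (t ∷ ys)) ∷ (arcs g ys) ∷ (deg g T t) ∷
        (deg g (t ∷ ys) t) ∷ (outdeg g ys t) ∷ (indeg g ys t) ∷ (g t t) ∷ [])
          (λ l a a′ a″ d d′ x y o → ((con 1 :+ a) :≤ l) ∷ (a′ :≤ a) ∷ (x :+ y :+ a″ :≤ a′) ∷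
              (d :≤ o :+ x :+ (o :+ y)) ∷ (o :≤ con 0) ∷ [] ⇒ (con 1 :+ d) :≤ l)
          0 (1 ∷ 1 ∷ 1 ∷ 1 ∷ 2 ∷ [])
          (≤-reflexive (sym size) , ≤-reflexive (sym (arcs-↭ g p)) , ≤-reflexive (sym (arcs-∷ g t ys (g0 t))) ,
              ≤-reflexive (deg-↭ g t p) , ≤-reflexive (g0 t) , tt))

  -- The degrees sum to 2(|T| - 1), less than 2 per vertex. Degree 0 occurs for a tree with one
  -- vertex.
  Tree-leaf : ∀ {T} → Tree T → ∃ λ x → x ∈ T × deg g T x ≤ 1
  Tree-leaf {T} (tree closed size) = found (∑<⇒∃< T (deg g T) (λ _ → 2)
      (lin ((length T) ∷ (arcs g T) ∷ (∑ T (deg g T)) ∷ (∑[ _ ∈ T ] 2) ∷ [])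
            (λ l a D c → ((con 1 :+ a) :≤ l) ∷ (D :≤ con 2 :* a) ∷ (l :* con 2 :≤ c) ∷ [] ⇒ D :< c)
            0 (2 ∷ 1 ∷ 1 ∷ [])
            (≤-reflexive (sym size) , ≤-reflexive (∑-deg g T) , ≤-reflexive (sym (∑-const T 2)) , tt)))
    where
    found : ∃ (λ x → x ∈ T × deg g T x < 2) → ∃ λ x → x ∈ T × deg g T x ≤ 1
    found (x , i , s≤s le) = x , i , le

  Tree-sink : ∀ {T} → Tree T → ∃ λ x → x ∈ T × outdeg g T x ≡ 0
  Tree-sink {T} (tree closed size) = ∑<length⇒∃ T (outdeg g T) (≤-reflexive (sym size))

  Tree-source : ∀ {T} → Tree T → ∃ λ x → x ∈ T × indeg g T x ≡ 0
  Tree-source {T} (tree closed size) = ∑<length⇒∃ T (indeg g T)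
      (≤-reflexive (≡.trans (cong suc (∑-indeg g T)) (sym size)))

smallest : ∀ {A : Set} (bs : List (List A)) → 0 < length bs → ∃ λ B → B ∈ bs × length B * length bs ≤ length (concat bs)
smallest bs pos = found (pick bs pos)
  where
  pick : ∀ bs → 0 < length bs → ∃ λ B → B ∈ bs × (∀ {C} → C ∈ bs → length B ≤ length C)
  pick (B ∷ []) _ = B , here ≡.refl , λ { (here ≡.refl) → ≤-refl }
  pick (B ∷ C ∷ bs) _ with pick (C ∷ bs) (s≤s z≤n)
  ... | D , i , le with length B ≤? length D
  ...   | yes p = B , here ≡.refl , λ { (here ≡.refl) → ≤-refl ; (there j) → ≤-trans p (le j) }
  ...   | no ¬p = D , there i , λ { (here ≡.refl) → <⇒≤ (≰⇒> ¬p) ; (there j) → le j }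
  found : ∃ (λ B → B ∈ bs × (∀ {C} → C ∈ bs → length B ≤ length C)) → ∃ λ B →
      B ∈ bs × length B * length bs ≤ length (concat bs)
  found (B , i , le) = B , i , (begin
    length B * length bs ≡⟨ *-comm (length B) _ ⟩
    length bs * length B ≡⟨ sym (∑-const bs (length B)) ⟩
    (∑[ _ ∈ bs ] length B) ≤⟨ ∑-mono-∈ bs le ⟩
    ∑ bs length ≡⟨ sym (length-concat bs) ⟩
    length (concat bs) ∎)
    where open ≤-Reasoning

-- Random placement, and placing a vertex or a whole tree

module Random {n} (g h : Fin n → Fin n → ℕ) (g0 : ∀ u → g u u ≡ 0) (h0 : ∀ p → h p p ≡ 0) where
  open Packing {n} g h

  ff>0 : ∀ k l → k ≤ l → 0 < ff k l
  ff>0 zero    l       _        = s≤s z≤n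
  ff>0 (suc k) (suc l) (s≤s le) = <-≤-trans (ff>0 k l le) (m≤m+n (ff k l) (l * ff k l))

  Collision-free : List E → Set
  Collision-free al = ∀ {e e′} → e ∈ al → e′ ∈ al → gh e e′ ≡ 0

  -- With l = `length ps` the expected number of collisions is at most the product of the numbers of
  -- arcs divided by l(l - 1). The alternative with product 0 serves independent positions, however
  -- few there are.
  random : ∀ us ps → length us ≤ length ps → arcs g us * arcs h ps ≡ 0 ⊎ arcs g us * arcs h ps < length
      ps * (length ps ∸ 1) →
    ∃ λ al → Injects us ps al × Collision-free al
  random us ps le lt = found (𝔼⇒∃ us ps _ (λ _ → 1) (begin-strict
    𝔼 us ps (λ al → ∑[ e ∈ al ] ∑ al (gh e))
      ≤⟨ 𝔼₂ us ps gh (λ u v p → ≡.trans (cong (g u v *_) (h0 p)) (*-zeroʳ (g u v))) ⟩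
    ff₂ (length us) (length ps) * T₂ us ps gh
      ≡⟨ cong (ff₂ (length us) (length ps) *_) T-gh ⟩
    ff₂ (length us) (length ps) * (arcs g us * arcs h ps)
      <⟨ fewer (length us) (length ps) le lt ⟩
    ff (length us) (length ps)
      ≡⟨ sym (*-identityʳ _) ⟩
    ff (length us) (length ps) * 1
      ≡⟨ sym (𝔼-const us ps 1) ⟩
    𝔼 us ps (λ _ → 1) ∎))
    where
    open ≤-Reasoning
    T-gh : T₂ us ps gh ≡ arcs g us * arcs h ps
    T-gh = ≡.trans (∑-cong us (λ u → ≡.trans (∑-cong us (λ v →
        ≡.trans (∑-cong ps (λ p → ∑-*ˡ ps (g u v) (h p))) (∑-*ˡ ps (g u v) _)))
      (∑-*ʳ us (arcs h ps) (g u)))) (∑-*ʳ us (arcs h ps) _)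
    fewer : ∀ k l {x} → k ≤ l → x ≡ 0 ⊎ x < l * (l ∸ 1) → ff₂ k l * x < ff k l
    fewer k             l le (inj₁ ≡.refl) = <-≤-trans (s≤s (≤-reflexive (*-zeroʳ (ff₂ k l)))) (ff>0 k l le)
    fewer zero          l _ _ = s≤s z≤n
    fewer (suc zero)    l le _ = ff>0 1 l le
    fewer (suc (suc k)) l {x} le (inj₂ lt) = <-≤-trans (*-monoʳ-< F ⦃ >-nonZero
        (ff>0 k (l ∸ 1 ∸ 1) (∸-monoˡ-≤ 1 (∸-monoˡ-≤ 1 le))) ⦄ lt)
      (lin (F ∷ l ∷ (l ∸ 1) ∷ [])
            (λ F l l′ → [] ⇒ F :* (l :* l′) :≤ l :* (l′ :* F))
            0 []
            tt)
      where F = ff k (l ∸ 1 ∸ 1)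
    found : ∃ (λ al → Injects us ps al × (∑[ e ∈ al ] ∑ al (gh e)) < 1) → ∃ λ al → Injects us ps al × Collision-free al
    found (al , inj , s≤s z) = al , inj , λ {e} i j → ∑≡0⇒∈ (gh e) (∑≡0⇒∈ (λ e → ∑ al (gh e)) (n≤0⇒n≡0 z) i) j

record Filtered {A : Set} (P : A → Set) (xs : List A) : Set where
  constructor filtered
  field
    ins outs : List A
    whole : xs ↭ ins ++ outs
    all-ins  : ∀ {x} → x ∈ ins → P x
    all-outs : ∀ {x} → x ∈ outs → ¬ P x

filter : ∀ {A : Set} {P : A → Set} → (∀ x → Dec (P x)) → ∀ xs → Filtered P xs
filter P? [] = filtered [] [] refl (λ ()) (λ ())
filter P? (x ∷ xs) with P? x | filter P? xs
... | yes p | filtered i o w a b = filtered (x ∷ i) o (prep x w) (λ { (here ≡.refl) → p ; (there j) → a j }) b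
... | no ¬p | filtered i o w a b = filtered i (x ∷ o) (↭-trans (prep x w) (↭-sym (shift x i o))) a
    (λ { (here ≡.refl) → ¬p ; (there j) → b j })

Unique-++ : ∀ {A : Set} {x : A} xs {ys} → Unique (xs ++ ys) → x ∈ xs → x ∈ ys → ⊥
Unique-++ (x ∷ xs) u (here ≡.refl) j = Unique-∉ u (∈-++⁺ʳ xs j) ≡.refl
Unique-++ (x ∷ xs) (_ ∷ u) (there i) j = Unique-++ xs u i j

Unique-++ʳ : ∀ {A : Set} (xs : List A) {ys} → Unique (xs ++ ys) → Unique ys
Unique-++ʳ []       u       = u
Unique-++ʳ (x ∷ xs) (_ ∷ u) = Unique-++ʳ xs u

length-⊆ : ∀ {A : Set} {xs ys zs : List A} → xs ↭ ys ++ zs → length xs ≡ length ys + length zs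
length-⊆ {ys = ys} p = ≡.trans (↭-length p) (length-++ ys)

module _ {V : Set} (g : V → V → ℕ) where

  arcs-++ : ∀ xs ys → arcs g xs + arcs g ys ≤ arcs g (xs ++ ys)
  arcs-++ xs ys = ≤-trans (+-mono-≤
      (∑-mono xs (λ u → ≤-trans (m≤m+n (∑ xs (g u)) (∑ ys (g u))) (≤-reflexive (sym (∑-++ xs ys (g u))))))
      (∑-mono ys (λ u → ≤-trans (m≤n+m (∑ ys (g u)) (∑ xs (g u))) (≤-reflexive (sym (∑-++ xs ys (g u)))))))
    (≤-reflexive (sym (∑-++ xs ys (outdeg g (xs ++ ys)))))

  arcs-⊆ : ∀ {xs ys zs} → xs ↭ ys ++ zs → arcs g ys + arcs g zs ≤ arcs g xs
  arcs-⊆ {ys = ys} {zs} p = ≤-trans (arcs-++ ys zs) (≤-reflexive (sym (arcs-↭ g p)))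

  deg-⊆ : ∀ {xs ys zs} u → xs ↭ ys ++ zs → deg g zs u ≤ deg g xs u
  deg-⊆ {ys = ys} {zs} u p = ≤-trans (+-mono-≤ (sub (g u)) (sub (λ v → g v u))) (≤-reflexive (sym (deg-↭ g u p)))
    where
    sub : ∀ f → ∑ zs f ≤ ∑ (ys ++ zs) f
    sub f = ≤-trans (m≤n+m (∑ zs f) (∑ ys f)) (≤-reflexive (sym (∑-++ ys zs f)))

module Operations {n : ℕ} (g h : Fin n → Fin n → ℕ) (g0 : ∀ u → g u u ≡ 0) (h0 : ∀ p → h p p ≡ 0) where

  open Packing g h public
  open Random g h g0 h0 public

  private V = Fin n

  -- S v r > 0 forbids v at r.
  forbid : (V → V → ℕ) → V → V → V → V → ℕ
  forbid S x p v r = S v r + cross (x , p) (v , r)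

  place : ∀ {us ps us′ ps′ S x p} → us ↭ x ∷ us′ → ps ↭ p ∷ ps′ → S x p ≡ 0 →
    Packs us′ ps′ (forbid S x p) → Packs us ps S
  place {S = S} {x} {p} us≡ ps≡ Sxp (packs al f s a c) = packs ((x , p) ∷ al)
    (↭-trans (prep x f) (↭-sym us≡)) (↭-trans (prep p s) (↭-sym ps≡)) allowed clean
    where
    off : ∀ {e} → e ∈ al → cross (x , p) e ≡ 0
    off {e} i = m+n≡0⇒n≡0 (S (proj₁ e) (proj₂ e)) (a i)
    allowed : ∀ {e} → e ∈ (x , p) ∷ al → S (proj₁ e) (proj₂ e) ≡ 0
    allowed (here ≡.refl) = Sxp
    allowed (there i)     = m+n≡0⇒m≡0 _ (a i)
    clean : ∀ {e e′} → e ∈ (x , p) ∷ al → e′ ∈ (x , p) ∷ al → gh e e′ ≡ 0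
    clean (here ≡.refl) (here ≡.refl) = cong (_* h p p) (g0 x)
    clean (here ≡.refl) (there j)     = m+n≡0⇒m≡0 _ (off j)
    clean {e} (there i) (here ≡.refl) = m+n≡0⇒n≡0 (gh (x , p) e) (off i)
    clean (there i)     (there j)     = c i j

  Packs-mono : ∀ {us ps S S′} → (∀ {v r} → v ∈ us → r ∈ ps → S v r ≡ 0 → S′ v r ≡ 0) → Packs us ps S → Packs us ps S′
  Packs-mono le (packs al f s a c) = packs al f s
    (λ i → le (∈-resp-↭ f (∈-map⁺ proj₁ i)) (∈-resp-↭ s (∈-map⁺ proj₂ i)) (a i)) c

  none : V → V → ℕ
  none _ _ = 0

  apart : ∀ {us T ys} → Unique us → us ↭ T ++ ys → Tree g g0 T → ∀ {t v} → t ∈ T → v ∈ ys → adjacency g g0 t v ≡ 0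
  apart {T = T} us! us≡ tr {t} {v} t∈ v∈ = go (adjacency g g0 t v) ≡.refl
    where
    go : ∀ k → adjacency g g0 t v ≡ k → adjacency g g0 t v ≡ 0
    go zero    eq = eq
    go (suc k) eq = ⊥-elim (Unique-++ T (Unique-resp-↭ us≡ us!)
        (Tree.closed tr t∈ (≤-trans (s≤s z≤n) (≤-reflexive (sym eq)))) v∈)

  inside : ∀ {us T ys} → Unique us → us ↭ T ++ ys → Tree g g0 T → ∀ {t} → t ∈ T → deg g us t ≡ deg g T t
  inside {us} {T} {ys} us! us≡ tr {t} t∈ =
    (≤-antisym
        (lin ((deg g us t) ∷ (deg g (T ++ ys) t) ∷ (outdeg g T t) ∷ (indeg g T t) ∷ (outdeg g ys t) ∷
            (indeg g ys t) ∷ (outdeg g (T ++ ys) t) ∷ (indeg g (T ++ ys) t) ∷ [])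
          (λ d d′ o i o′ i′ o″ i″ → (d :≤ o″ :+ i″) ∷ (o″ :≤ o :+ o′) ∷ (i″ :≤ i :+ i′) ∷ (o′ :≤ con 0) ∷
              (i′ :≤ con 0) ∷ [] ⇒ d :≤ o :+ i)
          0 (1 ∷ 1 ∷ 1 ∷ 1 ∷ 1 ∷ [])
          (≤-reflexive (deg-↭ g t us≡) , ≤-reflexive (∑-++ T ys (g t)) , ≤-reflexive (∑-++ T ys (λ v → g v t)) ,
              ≤-reflexive (∑-zero-∈ ys (λ {v} v∈ → m+n≡0⇒m≡0 (g t v) (apart us! us≡ tr t∈ v∈))) ,
              ≤-reflexive (∑-zero-∈ ys (λ {v} v∈ → m+n≡0⇒n≡0 (g t v) (apart us! us≡ tr t∈ v∈))) , tt))
        (lin ((deg g us t) ∷ (deg g (T ++ ys) t) ∷ (outdeg g T t) ∷ (indeg g T t) ∷ (outdeg g ys t) ∷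
            (indeg g ys t) ∷ (outdeg g (T ++ ys) t) ∷ (indeg g (T ++ ys) t) ∷ [])
          (λ d d′ o i o′ i′ o″ i″ → (o″ :+ i″ :≤ d) ∷ (o :+ o′ :≤ o″) ∷ (i :+ i′ :≤ i″) ∷ [] ⇒ o :+ i :≤ d)
          0 (1 ∷ 1 ∷ 1 ∷ [])
          (≤-reflexive (sym (deg-↭ g t us≡)) , ≤-reflexive (sym (∑-++ T ys (g t))) ,
              ≤-reflexive (sym (∑-++ T ys (λ v → g v t))) , tt)))

  -- T is closed under adjacency, so once all of it is placed the remaining vertices are restricted
  -- in no way; hence `none` on both sides.
  place-tree : ∀ {us ps us′ ps′ T al} → Unique us → us ↭ T ++ us′ → Tree g g0 T →
    map proj₁ al ↭ T → ps ↭ map proj₂ al ++ ps′ → Collision-free al → Packs us′ ps′ none → Packs us ps none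
  place-tree {us} {ps} {us′} {ps′} {T} {al} us! us≡ tr first second free (packs al′ f s _ c) = packs (al ++ al′)
    (↭-trans (↭-reflexive (map-++ proj₁ al al′)) (↭-trans (++⁺ first f) (↭-sym us≡)))
    (↭-trans (↭-reflexive (map-++ proj₂ al al′)) (↭-trans (++⁺ˡ (map proj₂ al) s) (↭-sym second)))
    (λ _ → ≡.refl) clean
    where
    between : ∀ {e e′} → e ∈ al → e′ ∈ al′ → adjacency g g0 (proj₁ e) (proj₁ e′) ≡ 0
    between i j = apart us! us≡ tr (∈-resp-↭ first (∈-map⁺ proj₁ i)) (∈-resp-↭ f (∈-map⁺ proj₁ j))
    clean : ∀ {e e′} → e ∈ al ++ al′ → e′ ∈ al ++ al′ → gh e e′ ≡ 0
    clean {e} {e′} i j with ∈-++⁻ al i | ∈-++⁻ al j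
    ... | inj₁ i | inj₁ j = free i j
    ... | inj₂ i | inj₂ j = c i j
    ... | inj₁ i | inj₂ j = cong (_* h (proj₂ e) (proj₂ e′)) (m+n≡0⇒m≡0 (g (proj₁ e) (proj₁ e′)) (between i j))
    ... | inj₂ i | inj₁ j = cong (_* h (proj₂ e) (proj₂ e′)) (m+n≡0⇒n≡0 (g (proj₁ e′) (proj₁ e)) (between j i))

  record TreePlaced (us : List V) (ps : List V) (us′ : List V) (T : List V) (y : V) : Set where
    constructor treePlaced
    field
      qs ps′  : List V
      number  : suc (length qs) ≡ length T
      ps≡     : ps ↭ y ∷ qs ++ ps′
      pack    : Packs us′ ps′ none → Packs us ps none

  -- x at y is safe against every placement of T′ in `Q`, so only collisions inside T′ are left to
  -- chance. Positions of `Q` that are not taken return to `ps′`.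
  root-at : ∀ {us ps us′ T T′ x y ps₁ Q R} → Unique us → us ↭ T ++ us′ → Tree g g0 T → T ↭ x ∷ T′ → ps ↭ y ∷ ps₁ →
      ps₁ ↭ Q ++ R →
    (∀ {t p} → t ∈ T′ → p ∈ Q → cross (x , y) (t , p) ≡ 0) → length T′ ≤ length Q →
    arcs g T′ * arcs h Q ≡ 0 ⊎ arcs g T′ * arcs h Q < length Q * (length Q ∸ 1) → TreePlaced us ps us′ T y
  root-at {us} {ps} {us′} {T} {T′} {x} {y} {ps₁} {Q} {R} us! us≡ tr T≡ ps≡ ps₁≡ ok le few = go (random T′ Q le few)
    where
    go : ∃ (λ al → Injects T′ Q al × Collision-free al) → TreePlaced us ps us′ T y
    go (al , injects rest eq seconds , free) = treePlaced (map proj₂ al) (rest ++ R)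
      (≡.trans (cong suc (≡.trans (length-map proj₂ al) (≡.trans (sym (length-map proj₁ al)) (cong length eq))))
          (sym (↭-length T≡)))
      whole
      (place-tree {al = (x , y) ∷ al} us! us≡ tr (↭-trans (prep x (↭-reflexive eq)) (↭-sym T≡)) whole clean)
      where
      whole : ps ↭ y ∷ map proj₂ al ++ rest ++ R
      whole = ↭-trans ps≡ (prep y (↭-trans ps₁≡ (↭-trans (++⁺ʳ R seconds)
          (↭-reflexive (++-assoc (map proj₂ al) rest R)))))
      off : ∀ {e} → e ∈ al → cross (x , y) e ≡ 0
      off i = ok (subst (_ ∈_) eq (∈-map⁺ proj₁ i)) (∈-resp-↭ (↭-sym seconds) (∈-++⁺ˡ (∈-map⁺ proj₂ i)))
      clean : Collision-free ((x , y) ∷ al)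
      clean (here ≡.refl) (here ≡.refl) = cong (_* h y y) (g0 x)
      clean (here ≡.refl) (there j)     = m+n≡0⇒m≡0 _ (off j)
      clean {e} (there i) (here ≡.refl) = m+n≡0⇒n≡0 (gh (x , y) e) (off i)
      clean (there i)     (there j)     = free i j

  pack-rest : ∀ us ps → length us ≡ length ps → arcs g us * arcs h ps < length ps * (length ps ∸ 1) → Packs us ps none
  pack-rest us ps eq lt = go (random us ps (≤-reflexive eq) (inj₂ lt))
    where
    go : ∃ (λ al → Injects us ps al × Collision-free al) → Packs us ps none
    go (al , injects rest eq₁ seconds , free) = packs al (↭-reflexive eq₁)
      (↭-sym (subst (λ r → ps ↭ r) (≡.trans (cong (map proj₂ al ++_) (empty rest rest≡0)) (++-identityʳ _))
          seconds)) (λ _ → ≡.refl) free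
      where
      empty : ∀ (r : List V) → length r ≡ 0 → r ≡ []
      empty [] _ = ≡.refl
      rest≡0 : length rest ≡ 0
      rest≡0 = n≤0⇒n≡0 (lin ((length rest) ∷ (length (map proj₂ al)) ∷ (length al) ∷ (length (map proj₁ al)) ∷
          (length us) ∷ (length ps) ∷ [])
            (λ r a a′ a″ u p → (a :+ r :≤ p) ∷ (a′ :≤ a) ∷ (a″ :≤ a′) ∷ (u :≤ a″) ∷ (p :≤ u) ∷ [] ⇒ r :≤ con 0)
            0 (1 ∷ 1 ∷ 1 ∷ 1 ∷ 1 ∷ [])
            (≤-reflexive (sym (length-⊆ {ys = map proj₂ al} seconds)) , ≤-reflexive (sym (length-map proj₂ al)) ,
                ≤-reflexive (length-map proj₁ al) , ≤-reflexive (sym (cong length eq₁)) , ≤-reflexive (sym eq) , tt))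

-- Leaves on vertices of large degree

concat-↭ : ∀ {A : Set} {xss yss : List (List A)} → xss ↭ yss → concat xss ↭ concat yss
concat-↭ refl = refl
concat-↭ (prep xs p) = ++⁺ˡ xs (concat-↭ p)
concat-↭ (swap xs ys p) = ↭-trans (shifts xs ys) (++⁺ˡ ys (++⁺ˡ xs (concat-↭ p)))
concat-↭ (trans p q) = ↭-trans (concat-↭ p) (concat-↭ q)

∑-tail : ∀ {A : Set} {xs ys : List A} {x} (f : A → ℕ) → xs ↭ x ∷ ys → ∑ ys f ≤ ∑ xs f
∑-tail {x = x} f p = ≤-trans (m≤n+m _ (f x)) (≤-reflexive (sym (∑-↭ f p)))

module Stages {n : ℕ} (g h : Fin n → Fin n → ℕ) (g≤1 : ∀ u v → g u v ≤ 1) (h≤1 : ∀ p q → h p q ≤ 1)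
  (g0 : ∀ u → g u u ≡ 0) (h0 : ∀ p → h p p ≡ 0) where

  open Operations g h g0 h0 public

  private V = Fin n

  deg-tail : ∀ (k : V → V → ℕ) {xs ys x} u → xs ↭ x ∷ ys → deg k ys u ≤ deg k xs u
  deg-tail k u p = +-mono-≤ (∑-tail (k u) p) (∑-tail (λ v → k v u) p)

  arcs-split : ∀ (k : V → V → ℕ) → (∀ u → k u u ≡ 0) → ∀ {xs ys x} → xs ↭ x ∷ ys → arcs k xs ≡ deg k ys x + arcs k ys
  arcs-split k k0 {ys = ys} {x} p = ≡.trans (arcs-↭ k p) (arcs-∷ k x ys (k0 x))

  -- The vertices us and the positions ps remain after i trees have been used; the part of a used tree that
  -- is left belongs to other. The forbidden pairs and the arcs of h are counted together (β), since a leaf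
  -- put at p creates at most as many of the former as it removes of the latter.
  record State (D β c₀ i : ℕ) : Set where
    field
      us ps     : List V
      S         : V → V → ℕ
      trees     : List (List V)
      other     : List V
      us!       : Unique us
      ps!       : Unique ps
      us≡       : us ↭ concat trees ++ other
      len       : length us ≡ length ps
      us≤n      : length us ≤ n
      are-trees : ∀ {T} → T ∈ trees → Tree g g0 T
      count     : 93 ≤ i + length trees
      sparse    : arcs g us + 93 ≤ length us + i
      half⁺     : ∀ {p} → p ∈ ps → 3 * outdeg h ps p ≤ n
      half⁻     : ∀ {p} → p ∈ ps → 3 * indeg h ps p ≤ n
      rows      : ∀ {v} → v ∈ us → 3 * (∑[ p ∈ ps ] S v p) ≤ n
      cols      : ∀ {p} → p ∈ ps → (∑[ v ∈ us ] S v p) ≤ i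
      small     : ∀ {v p} → 0 < S v p → 36 * deg g us v ≤ n
      fresh     : ∀ {v} → v ∈ concat trees → ∀ p → S v p ≡ 0
      budget    : arcs h ps + (∑[ v ∈ us ] ∑[ p ∈ ps ] S v p) ≤ β
      total     : length us + i ≡ c₀
      few       : arcs g us + 93 ≤ n
      low       : ∀ {p} → p ∈ ps → deg h ps p ≤ D

  private variable D β c₀ i : ℕ

  PacksState : State D β c₀ i → Set
  PacksState st = Packs (State.us st) (State.ps st) (State.S st)

  record Covered (st : State D β c₀ i) (p : V) : Set where
    constructor covered
    field
      st′  : State D β c₀ (suc i)
      x    : V
      us-∷ : State.us st ↭ x ∷ State.us st′
      ps-∷ : State.ps st ↭ p ∷ State.ps st′
      leaf : deg g (State.us st) x ≤ 1
      pack : PacksState st′ → PacksState st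

  private
    convex : ∀ a b {x y m} → a + b ≤ 1 → 3 * x ≤ m → 3 * y ≤ m → 3 * (a * x + b * y) ≤ m
    convex zero    zero          _  p q = z≤n
    convex zero    (suc zero) {y = y} {m} _ p q = (lin (y ∷ m ∷ [])
          (λ y m → (con 3 :* y :≤ m) ∷ [] ⇒ con 3 :* (con 0 :* y :+ con 1 :* y) :≤ m)
          0 (1 ∷ [])
          (q , tt))
    convex (suc zero) zero {x} {y} {m} _ p q = (lin (x ∷ y ∷ m ∷ [])
          (λ x y m → (con 3 :* x :≤ m) ∷ [] ⇒ con 3 :* (con 1 :* x :+ con 0 :* y) :≤ m)
          0 (1 ∷ [])
          (p , tt))
    convex zero (suc (suc b)) (s≤s ())
    convex (suc zero) (suc b) (s≤s ())
    convex (suc (suc a)) b (s≤s ())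

    weighted : ∀ a b x y → a + b ≤ 1 → a * x + b * y ≤ x + y
    weighted a b x y le = +-mono-≤ (≤1-* x (≤-trans (m≤m+n a b) le)) (≤1-* y (≤-trans (m≤n+m b a) le))

  -- At most 57 trees are used, so at least 93 - 57 = 36 remain and the smallest has at most n/36
  -- vertices. A leaf x of it goes to p; only a neighbour of x becomes restricted.
  module Cover (st : State D β c₀ i) (i≤57 : i ≤ 57) {p : V} (p∈ : p ∈ State.ps st) where
    open State st

    private
      unused : 0 < length trees
      unused = (lin (i ∷ (length trees) ∷ [])
            (λ i l → (con 93 :≤ i :+ l) ∷ (i :≤ con 57) ∷ [] ⇒ con 0 :< l)
            35 (1 ∷ 1 ∷ [])
            (count , i≤57 , tt))

      many : 36 ≤ length trees
      many = (lin (i ∷ (length trees) ∷ [])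
            (λ i l → (con 93 :≤ i :+ l) ∷ (i :≤ con 57) ∷ [] ⇒ con 36 :≤ l)
            0 (1 ∷ 1 ∷ [])
            (count , i≤57 , tt))

      build : ∀ {T} → T ∈ trees → length T * length trees ≤ length (concat trees) → Covered st p
      build {T} T∈ size = go (Tree-leaf g g0 tr) (∈⇒↭ T∈) (∈⇒↭ p∈)
        where
        tr = are-trees T∈
        go : ∃ (λ x → x ∈ T × deg g T x ≤ 1) → ∃ (λ trees′ → trees ↭ T ∷ trees′) → ∃ (λ ps′ → ps ↭ p ∷ ps′) →
            Covered st p
        go (x , x∈ , leafT) (trees′ , trees≡) (ps′ , ps≡) = go′ (∈⇒↭ x∈)
          where
          us-T : us ↭ T ++ (concat trees′ ++ other)
          us-T = ↭-trans us≡ (↭-trans (++⁺ʳ other (concat-↭ trees≡)) (↭-reflexive (++-assoc T (concat trees′) other)))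
          leaf′ : deg g us x ≤ 1
          leaf′ = ≤-trans (≤-reflexive (inside us! us-T tr x∈)) leafT
          short : 36 * length T ≤ n
          short = (lin ((length T) ∷ i ∷ (length trees) ∷ (length T * length trees) ∷ (length (concat trees)) ∷
              (length other) ∷ (length us) ∷ n ∷ [])
                (λ t i l tl c o u n → (t :* con 36 :≤ tl) ∷ (tl :≤ c) ∷ (c :+ o :≤ u) ∷ (u :≤ n) ∷ [] ⇒
                    con 36 :* t :≤ n)
                0 (1 ∷ 1 ∷ 1 ∷ 1 ∷ [])
                (*-monoʳ-≤ (length T) many , size , ≤-reflexive (sym (length-⊆ {ys = concat trees} us≡)) , us≤n , tt))
          go′ : ∃ (λ T′ → T ↭ x ∷ T′) → Covered st p
          go′ (T′ , T≡) = covered new x us-∷ ps≡ leaf′ (place us-∷ ps≡ (fresh (∈-concat⁺′ x∈ T∈) p))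
            where
            us′ = concat trees′ ++ (T′ ++ other)
            S′ = forbid S x p
            us-∷ : us ↭ x ∷ us′
            us-∷ = ↭-trans us-T (↭-trans (++⁺ʳ (concat trees′ ++ other) T≡) (prep x (shifts T′ (concat trees′))))
            ∈T : ∀ {v} → v ∈ T′ → v ∈ T
            ∈T i = ∈-resp-↭ (↭-sym T≡) (there i)
            us′⊆ : ∀ {v} → v ∈ us′ → v ∈ us
            us′⊆ i = ∈-resp-↭ (↭-sym us-∷) (there i)
            ps′⊆ : ∀ {q} → q ∈ ps′ → q ∈ ps
            ps′⊆ i = ∈-resp-↭ (↭-sym ps≡) (there i)
            trees′⊆ : ∀ {T} → T ∈ trees′ → T ∈ trees
            trees′⊆ i = ∈-resp-↭ (↭-sym trees≡) (there i)
            where? : ∀ {v} → v ∈ us′ → v ∈ T ⊎ v ∈ concat trees′ ++ other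
            where? {v} i with ∈-++⁻ (concat trees′) i
            ... | inj₁ j = inj₂ (∈-++⁺ˡ j)
            ... | inj₂ j with ∈-++⁻ T′ j
            ...   | inj₁ k = inj₁ (∈T k)
            ...   | inj₂ k = inj₂ (∈-++⁺ʳ (concat trees′) k)
            out-x in-x out-p in-p : ℕ
            out-x = outdeg g us′ x
            in-x  = indeg g us′ x
            out-p = outdeg h ps′ p
            in-p  = indeg h ps′ p
            leaf″ : out-x + in-x ≤ 1
            leaf″ = ≤-trans (deg-tail g x us-∷) leaf′
            cross-row : ∀ v → (∑[ r ∈ ps′ ] cross (x , p) (v , r)) ≡ g x v * out-p + g v x * in-p
            cross-row v = ≡.trans (∑-+ ps′ _ _) (cong₂ _+_ (∑-*ˡ ps′ (g x v) (h p)) (∑-*ˡ ps′ (g v x) (λ r → h r p)))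
            -- A vertex of T had no forbidden positions before, by `fresh`, and x has at most one
            -- arc, so the new row is at most the out- or the indegree of p, never their sum. This
            -- is why `half⁺` and `half⁻` are kept apart. No other row grows.
            rows′ : ∀ {v} → v ∈ us′ → 3 * (∑[ r ∈ ps′ ] S′ v r) ≤ n
            rows′ {v} i = ≤-trans (≤-reflexive (cong (3 *_)
                (≡.trans (∑-+ ps′ (S v) _) (cong ((∑[ r ∈ ps′ ] S v r) +_) (cross-row v))))) (go″ (where? i))
              where
              go″ : v ∈ T ⊎ v ∈ concat trees′ ++ other → 3 * ((∑[ r ∈ ps′ ] S v r) + (g x v * out-p + g v x * in-p)) ≤ n
              go″ (inj₁ v∈T) = (lin ((∑[ r ∈ ps′ ] S v r) ∷ (g x v * out-p + g v x * in-p) ∷ n ∷ [])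
                    (λ s c n → (s :≤ con 0) ∷ (con 3 :* c :≤ n) ∷ [] ⇒ con 3 :* (s :+ c) :≤ n)
                    0 (3 ∷ 1 ∷ [])
                    (≤-reflexive (∑-zero-∈ ps′ (λ {r} _ → fresh (∈-concat⁺′ v∈T T∈) r)) ,
                        convex (g x v) (g v x) (≤-trans (+-mono-≤ (∑-∈ (g x) (us′⊆ i)) (∑-∈ (λ w → g w x) (us′⊆ i)))
                        leaf′) (≤-trans (*-monoʳ-≤ 3 (∑-tail (h p) ps≡)) (half⁺ p∈))
                        (≤-trans (*-monoʳ-≤ 3 (∑-tail (λ r → h r p) ps≡)) (half⁻ p∈)) , tt))
              go″ (inj₂ j) = (lin ((∑[ r ∈ ps′ ] S v r) ∷ (∑[ r ∈ ps ] S v r) ∷ (g x v * out-p) ∷ (g v x * in-p) ∷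
                  n ∷ [])
                    (λ s s′ c d n → (s :≤ s′) ∷ (con 3 :* s′ :≤ n) ∷ (c :≤ con 0) ∷ (d :≤ con 0) ∷ [] ⇒
                        con 3 :* (s :+ (c :+ d)) :≤ n)
                    0 (3 ∷ 1 ∷ 3 ∷ 3 ∷ [])
                    (∑-tail (S v) ps≡ , rows (us′⊆ i) , ≤-reflexive
                        (cong (_* out-p) (m+n≡0⇒m≡0 (g x v) (apart us! us-T tr x∈ j))) ,
                        ≤-reflexive (cong (_* in-p) (m+n≡0⇒n≡0 (g x v) (apart us! us-T tr x∈ j))) , tt))
            cols′ : ∀ {r} → r ∈ ps′ → (∑[ v ∈ us′ ] S′ v r) ≤ suc i
            cols′ {r} r∈ = (lin ((∑[ v ∈ us′ ] S′ v r) ∷ (∑[ v ∈ us′ ] S v r) ∷ (∑[ v ∈ us ] S v r) ∷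
                (∑[ v ∈ us′ ] cross (x , p) (v , r)) ∷ (∑[ v ∈ us′ ] g x v * h p r) ∷ (∑[ v ∈ us′ ] g v x * h r p) ∷
                (out-x) ∷ (in-x) ∷ i ∷ [])
                  (λ t s s′ c c₁ c₂ o j i → (t :≤ s :+ c) ∷ (s :≤ s′) ∷ (s′ :≤ i) ∷ (c :≤ c₁ :+ c₂) ∷ (c₁ :≤ o) ∷
                      (c₂ :≤ j) ∷ (o :+ j :≤ con 1) ∷ [] ⇒ t :≤ (con 1 :+ i))
                  0 (1 ∷ 1 ∷ 1 ∷ 1 ∷ 1 ∷ 1 ∷ 1 ∷ [])
                  (≤-reflexive (∑-+ us′ (λ v → S v r) (λ v → cross (x , p) (v , r))) , ∑-tail (λ v → S v r) us-∷ ,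
                      cols (ps′⊆ r∈) , ≤-reflexive (∑-+ us′ (λ v → g x v * h p r) (λ v → g v x * h r p)) ,
                      ∑-mono us′ (λ v → ≤-trans (*-monoʳ-≤ (g x v) (h≤1 p r)) (≤-reflexive (*-identityʳ (g x v)))) ,
                      ∑-mono us′ (λ v → ≤-trans (*-monoʳ-≤ (g v x) (h≤1 r p)) (≤-reflexive (*-identityʳ (g v x)))) ,
                      leaf″ , tt))
            budget′ : arcs h ps′ + (∑[ v ∈ us′ ] ∑[ r ∈ ps′ ] S′ v r) ≤ β
            budget′ = (lin ((arcs h ps′) ∷ (arcs h ps) ∷ (∑[ v ∈ us′ ] ∑[ r ∈ ps′ ] S′ v r) ∷
                (∑[ v ∈ us ] ∑[ r ∈ ps ] S v r) ∷ (∑[ v ∈ us′ ] ∑[ r ∈ ps ] S v r) ∷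
                (∑[ v ∈ us′ ] ∑[ r ∈ ps′ ] S v r) ∷ (out-x * out-p + in-x * in-p) ∷ (out-p) ∷ (in-p) ∷ β ∷ [])
                  (λ a′ a t φ φ″ φ′ c o j β → (o :+ j :+ a′ :≤ a) ∷ (t :≤ φ′ :+ c) ∷ (φ′ :≤ φ″) ∷ (φ″ :≤ φ) ∷
                      (c :≤ o :+ j) ∷ (a :+ φ :≤ β) ∷ [] ⇒ a′ :+ t :≤ β)
                  0 (1 ∷ 1 ∷ 1 ∷ 1 ∷ 1 ∷ 1 ∷ [])
                  (≤-reflexive (sym (arcs-split h h0 ps≡)) , ≤-reflexive t≡ , ∑-mono us′ (λ v → ∑-tail (S v) ps≡) ,
                      ∑-tail (λ v → ∑[ r ∈ ps ] S v r) us-∷ , weighted out-x in-x out-p in-p leaf″ , budget , tt))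
              where
              t≡ : (∑[ v ∈ us′ ] ∑[ r ∈ ps′ ] S′ v r) ≡ (∑[ v ∈ us′ ] ∑[ r ∈ ps′ ] S v
                  r) + (out-x * out-p + in-x * in-p)
              t≡ = ≡.trans (∑-cong us′ (λ v → ∑-+ ps′ (S v) _))
                  (≡.trans (∑-+ us′ _ _) (cong ((∑[ v ∈ us′ ] ∑[ r ∈ ps′ ] S v r) +_)
                (≡.trans (∑-cong us′ cross-row) (≡.trans (∑-+ us′ _ _)
                    (cong₂ _+_ (∑-*ʳ us′ out-p (g x)) (∑-*ʳ us′ in-p (λ v → g v x)))))))
            -- A newly forbidden position makes v adjacent to x, hence v lies in T and has degree
            -- less than |T| ≤ n/36.
            small′ : ∀ {v r} → 0 < S′ v r → 36 * deg g us′ v ≤ n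
            small′ {v} {r} pos = go″ (S v r) ≡.refl
              where
              go″ : ∀ s → S v r ≡ s → 36 * deg g us′ v ≤ n
              go″ (suc s) eq = ≤-trans (*-monoʳ-≤ 36 (deg-tail g v us-∷))
                  (small (≤-trans (s≤s z≤n) (≤-reflexive (sym eq))))
              go″ zero eq = (lin ((deg g us′ v) ∷ (deg g us v) ∷ (deg g T v) ∷ (length T) ∷ n ∷ [])
                    (λ d′ d e t n → (d′ :≤ d) ∷ (d :≤ e) ∷ ((con 1 :+ e) :≤ t) ∷ (con 36 :* t :≤ n) ∷ [] ⇒
                        con 36 :* d′ :≤ n)
                    0 (36 ∷ 36 ∷ 36 ∷ 1 ∷ [])
                    (deg-tail g v us-∷ , ≤-reflexive (inside us! us-T tr v∈T) , Tree-deg g g0 tr v∈T , short , tt))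
                where
                touching : ∀ a → g x v ≡ a → 0 < adjacency g g0 x v
                touching (suc a) eq′ = ≤-trans (s≤s z≤n) (≤-trans (≤-reflexive (sym eq′)) (m≤m+n (g x v) (g v x)))
                touching zero eq′ = ≤-trans (>0-*ˡ (g v x) (h r p)
                    (>0-+ (g x v * h p r) (g v x * h r p) (>0-+ (S v r) _ pos eq) (cong (_* h p r) eq′)))
                    (m≤n+m (g v x) (g x v))
                v∈T : v ∈ T
                v∈T = Tree.closed tr x∈ (touching (g x v) ≡.refl)
            fresh′ : ∀ {v} → v ∈ concat trees′ → ∀ r → S′ v r ≡ 0
            fresh′ {v} v∈ r = cong₂ _+_ (fresh (∈-resp-↭ (↭-sym (concat-↭ trees≡)) (∈-++⁺ʳ T v∈)) r)
              (cong₂ _+_ (cong (_* h p r) (m+n≡0⇒m≡0 (g x v) off)) (cong (_* h r p) (m+n≡0⇒n≡0 (g x v) off)))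
              where off = apart us! us-T tr x∈ (∈-++⁺ˡ v∈)
            shorter : length us ≡ suc (length us′)
            shorter = ↭-length us-∷
            new : State D β c₀ (suc i)
            new = record
              { us = us′ ; ps = ps′ ; S = S′ ; trees = trees′ ; other = T′ ++ other
              ; us! = Unique-++ʳ (x ∷ []) (Unique-resp-↭ us-∷ us!) ; ps! =
                  Unique-++ʳ (p ∷ []) (Unique-resp-↭ ps≡ ps!) ; us≡ = refl
              ; len = suc-injective (≡.trans (sym shorter) (≡.trans len (↭-length ps≡)))
              ; us≤n = ≤-trans (n≤1+n _) (≤-trans (≤-reflexive (sym shorter)) us≤n)
              ; are-trees = λ i → are-trees (trees′⊆ i)
              ; count = (lin (i ∷ (length trees) ∷ (length trees′) ∷ [])
                    (λ i l l′ → (con 93 :≤ i :+ l) ∷ (l :≤ (con 1 :+ l′)) ∷ [] ⇒ con 93 :≤ (con 1 :+ i) :+ l′)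
                    0 (1 ∷ 1 ∷ [])
                    (count , ≤-reflexive (↭-length trees≡) , tt))
              ; sparse = (lin ((arcs g us) ∷ (arcs g us′) ∷ (deg g us′ x) ∷ (length us) ∷ (length us′) ∷ i ∷ [])
                    (λ a a′ d u u′ i → (d :+ a′ :≤ a) ∷ (a :+ con 93 :≤ u :+ i) ∷ (u :≤ (con 1 :+ u′)) ∷ [] ⇒
                        a′ :+ con 93 :≤ u′ :+ (con 1 :+ i))
                    0 (1 ∷ 1 ∷ 1 ∷ [])
                    (≤-reflexive (sym (arcs-split g g0 us-∷)) , sparse , ≤-reflexive shorter , tt))
              ; half⁺ = λ {q} q∈ → ≤-trans (*-monoʳ-≤ 3 (∑-tail (h q) ps≡)) (half⁺ (ps′⊆ q∈))
              ; half⁻ = λ {q} q∈ → ≤-trans (*-monoʳ-≤ 3 (∑-tail (λ r → h r q) ps≡)) (half⁻ (ps′⊆ q∈))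
              ; rows = rows′ ; cols = cols′ ; small = small′ ; fresh = fresh′ ; budget = budget′
              ; total = (≤-antisym
                  (lin ((length us) ∷ (length us′) ∷ i ∷ c₀ ∷ [])
                    (λ u u′ i c₀ → (u :+ i :≤ c₀) ∷ ((con 1 :+ u′) :≤ u) ∷ [] ⇒ u′ :+ (con 1 :+ i) :≤ c₀)
                    0 (1 ∷ 1 ∷ [])
                    (≤-reflexive total , ≤-reflexive (sym shorter) , tt))
                  (lin ((length us) ∷ (length us′) ∷ i ∷ c₀ ∷ [])
                    (λ u u′ i c₀ → (c₀ :≤ u :+ i) ∷ (u :≤ (con 1 :+ u′)) ∷ [] ⇒ c₀ :≤ u′ :+ (con 1 :+ i))
                    0 (1 ∷ 1 ∷ [])
                    (≤-reflexive (sym total) , ≤-reflexive shorter , tt)))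
              ; few = ≤-trans (+-monoˡ-≤ 93 (≤-trans (m≤n+m (arcs g us′) (deg g us′ x))
                  (≤-reflexive (sym (arcs-split g g0 us-∷))))) few
              ; low = λ {q} q∈ → ≤-trans (deg-tail h q ps≡) (low (ps′⊆ q∈))
              }

    cover : Covered st p
    cover = go (smallest trees unused)
      where
      go : ∃ (λ T → T ∈ trees × length T * length trees ≤ length (concat trees)) → Covered st p
      go (T , T∈ , size) = build T∈ size

  tighten : ∀ {D′} (st : State D β c₀ i) → (∀ {p} → p ∈ State.ps st → deg h (State.ps st) p ≤ D′) → State D′ β c₀ i
  tighten st low′ = record
    { us = us ; ps = ps ; S = S ; trees = trees ; other = other ; us! = us! ; ps! = ps! ; us≡ = us≡ ; len = len ;
        us≤n = us≤n
    ; are-trees = are-trees ; count = count ; sparse = sparse ; half⁺ = half⁺ ; half⁻ = half⁻ ; rows = rows ; cols =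
        cols
    ; small = small ; fresh = fresh ; budget = budget ; total = total ; few = few ; low = low′ }
    where open State st

  search : ∀ {A : Set} {P : A → Set} → (∀ x → Dec (P x)) → ∀ xs → (∃ λ x → x ∈ xs × P x) ⊎ (∀ {x} → x ∈ xs → ¬ P x)
  search P? [] = inj₂ (λ ())
  search P? (x ∷ xs) with P? x | search P? xs
  ... | yes p | _ = inj₁ (x , here ≡.refl , p)
  ... | no ¬p | inj₁ (y , i , p) = inj₁ (y , there i , p)
  ... | no ¬p | inj₂ all = inj₂ λ { (here ≡.refl) → ¬p ; (there i) → all i }

  record Reached (D′ : ℕ) (i₁ : ℕ) (st : State D β c₀ i) : Set where
    constructor reached
    field
      {i′} : ℕ
      st′  : State D′ β c₀ i′
      i≤   : i′ ≤ i₁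
      pack : PacksState st′ → PacksState st

  -- Potential argument: a vertex of degree at least n/25 takes that many arcs of h with it and h
  -- has fewer than 2n, so the search ends with at most 49 trees used. `j` is what remains up to 50.
  cover-large : ∀ j (st : State D β c₀ i) → i + j ≡ 50 → 25 * arcs h (State.ps st) + i * n < 50 * n →
      Reached (n / 25) 49 st
  cover-large {i = i} zero st eq lt = ⊥-elim (<⇒≱ lt (≤-trans
      (≤-reflexive (cong (_* n) (≡.trans (sym eq) (+-identityʳ i)))) (m≤n+m (i * n) (25 * arcs h (State.ps st)))))
  cover-large {i = i} (suc j) st eq lt = go (search (λ p → n ≤? 25 * deg h ps p) ps)
    where
    open State st
    i≤49 : i ≤ 49
    i≤49 = (lin (i ∷ j ∷ [])
          (λ i j → (i :+ (con 1 :+ j) :≤ con 50) ∷ [] ⇒ i :≤ con 49)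
          0 (1 ∷ [])
          (≤-reflexive eq , tt))
    go : (∃ λ p → p ∈ ps × n ≤ 25 * deg h ps p) ⊎ (∀ {p} → p ∈ ps → ¬ n ≤ 25 * deg h ps p) → Reached (n / 25) 49 st
    go (inj₂ none) = reached (tighten st (λ p∈ → *-cancelˡ-/ (<⇒≤ (≰⇒> (none p∈))))) i≤49 (λ x → x)
      where
      *-cancelˡ-/ : ∀ {x} → 25 * x ≤ n → x ≤ n / 25
      *-cancelˡ-/ {x} le = ≤-trans (≤-reflexive (sym (m*n/n≡m x 25)))
          (/-monoˡ-≤ 25 (≤-trans (≤-reflexive (*-comm x 25)) le))
    go (inj₁ (p , p∈ , le)) = next (Cover.cover st (≤-trans i≤49 (m≤m+n 49 8)) p∈)
      where
      next : Covered st p → Reached (n / 25) 49 st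
      next (covered st₁ _ _ ps-∷ _ pack₁) = then (cover-large j st₁ (≡.trans (sym (+-suc i j)) eq)
        (lin ((arcs h ps) ∷ (arcs h (State.ps st₁)) ∷ (deg h (State.ps st₁) p) ∷ (deg h ps p) ∷ n ∷ i ∷ [])
              (λ a a′ d′ d n i → (d′ :+ a′ :≤ a) ∷ (d :≤ d′) ∷ (n :≤ con 25 :* d) ∷
                  (con 25 :* a :+ i :* n :< con 50 :* n) ∷ [] ⇒ con 25 :* a′ :+ (con 1 :+ i) :* n :< con 50 :* n)
              0 (25 ∷ 25 ∷ 1 ∷ 1 ∷ [])
              (≤-reflexive (sym (arcs-split h h0 ps-∷)) , d≤ , le , lt , tt)))
        where
        d≤ : deg h ps p ≤ deg h (State.ps st₁) p
        d≤ = ≤-reflexive (≡.trans (deg-↭ h p ps-∷) (cong₂ _+_ (cong (_+ outdeg h (State.ps st₁) p) (h0 p))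
            (cong (_+ indeg h (State.ps st₁) p) (h0 p))))
        then : Reached (n / 25) 49 st₁ → Reached (n / 25) 49 st
        then (reached st₂ le₂ pack₂) = reached st₂ le₂ (λ x → pack₁ (pack₂ x))

  record Isolated (st : State D β c₀ i) (u c : V) (d : ℕ) : Set where
    constructor isolated
    field
      {i′} : ℕ
      st′  : State D β c₀ i′
      i≤   : i′ ≤ i + d
      u∈   : u ∈ State.us st′
      c∈   : c ∈ State.ps st′
      iso  : deg h (State.ps st′) c ≡ 0
      big  : deg g (State.us st) u ≤ deg g (State.us st′) u + d
      arcs≤ : arcs g (State.us st′) ≤ arcs g (State.us st)
      pack : PacksState st′ → PacksState st

  -- Covering a neighbour of c lowers the degree of c, whereas u loses at most the single arc of the
  -- leaf. The reserve `2 + d` keeps u from being chosen as a leaf itself, and `i + d ≤ 58` leaves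
  -- at most 57 trees used before each leaf.
  isolate : ∀ d (st : State D β c₀ i) {u c} → i + d ≤ 58 → u ∈ State.us st → c ∈ State.ps st →
    deg h (State.ps st) c ≤ d → 2 + d ≤ deg g (State.us st) u → Isolated st u c d
  isolate {i = i} zero st _ u∈ c∈ le _ = isolated st (m≤m+n i 0) u∈ c∈ (n≤0⇒n≡0 le) (m≤m+n _ 0) ≤-refl (λ x → x)
  isolate {i = i} (suc d) st {u} {c} i≤ u∈ c∈ le big = go (deg h ps c) ≡.refl
    where
    open State st
    go : ∀ k → deg h ps c ≡ k → Isolated st u c (suc d)
    go zero eq = isolated st (m≤m+n i (suc d)) u∈ c∈ eq (m≤m+n _ (suc d)) ≤-refl (λ x → x)
    go (suc k) eq = neighbour (∑>0⇒∃ ps (λ r → h c r + h r c)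
        (≤-trans (s≤s z≤n) (≤-reflexive (≡.trans (sym eq) (sym (∑-+ ps (h c) (λ r → h r c)))))))
      where
      neighbour : ∃ (λ r → r ∈ ps × 0 < h c r + h r c) → Isolated st u c (suc d)
      neighbour (r , r∈ , pos) = next (Cover.cover st (lin (i ∷ d ∷ [])
            (λ i d → (i :+ (con 1 :+ d) :≤ con 58) ∷ [] ⇒ i :≤ con 57)
            0 (1 ∷ [])
            (i≤ , tt)) r∈)
        where
        c≢r : c ≢ r
        c≢r ≡.refl = <-irrefl (sym (cong₂ _+_ (h0 c) (h0 c))) pos
        next : Covered st r → Isolated st u c (suc d)
        next (covered st₁ x us-∷ ps-∷ leaf pack₁) = then (isolate d st₁ {u} {c}
            (≤-trans (≤-reflexive (sym (+-suc i d))) i≤) (tail us-∷ u≢x u∈) (tail ps-∷ c≢r c∈)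
            (lin ((deg h ps c) ∷ (h c r) ∷ (h r c) ∷ (outdeg h (State.ps st₁) c) ∷ (indeg h (State.ps st₁) c) ∷ d ∷ [])
                  (λ D x y o j d → (x :+ o :+ (y :+ j) :≤ D) ∷ (D :≤ (con 1 :+ d)) ∷ (con 0 :< x :+ y) ∷ [] ⇒
                      o :+ j :≤ d)
                  0 (1 ∷ 1 ∷ 1 ∷ [])
                  (≤-reflexive (sym (deg-↭ h c ps-∷)) , le , pos , tt))
            (lin ((deg g us u) ∷ (g u x + g x u) ∷ (deg g us₁ u) ∷ d ∷ [])
                  (λ D x d′ d → (D :≤ x :+ d′) ∷ (x :≤ con 1) ∷ (con 2 :+ (con 1 :+ d) :≤ D) ∷ [] ⇒ con 2 :+ d :≤ d′)
                  0 (1 ∷ 1 ∷ 1 ∷ [])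
                  (≤-reflexive du , touch , big , tt)))
          where
          us₁ = State.us st₁
          tail : ∀ {xs ys : List V} {a b} → xs ↭ a ∷ ys → b ≢ a → b ∈ xs → b ∈ ys
          tail p b≢a i with ∈-resp-↭ p i
          ... | here eq  = ⊥-elim (b≢a eq)
          ... | there j = j
          u≢x : u ≢ x
          u≢x ≡.refl = <⇒≱ (≤-trans (s≤s (s≤s z≤n)) big) leaf
          touch : g u x + g x u ≤ 1
          touch = ≤-trans (≤-reflexive (+-comm (g u x) (g x u)))
              (≤-trans (+-mono-≤ (∑-∈ (g x) u∈) (∑-∈ (λ v → g v x) u∈)) leaf)
          du : deg g us u ≡ (g u x + g x u) + deg g us₁ u
          du = (≤-antisym
              (lin ((deg g us u) ∷ (g u x) ∷ (g x u) ∷ (outdeg g us₁ u) ∷ (indeg g us₁ u) ∷ [])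
                (λ D a b o j → (D :≤ a :+ o :+ (b :+ j)) ∷ [] ⇒ D :≤ a :+ b :+ (o :+ j))
                0 (1 ∷ [])
                (≤-reflexive (deg-↭ g u us-∷) , tt))
              (lin ((deg g us u) ∷ (g u x) ∷ (g x u) ∷ (outdeg g us₁ u) ∷ (indeg g us₁ u) ∷ [])
                (λ D a b o j → (a :+ o :+ (b :+ j) :≤ D) ∷ [] ⇒ a :+ b :+ (o :+ j) :≤ D)
                0 (1 ∷ [])
                (≤-reflexive (sym (deg-↭ g u us-∷)) , tt)))
          then : Isolated st₁ u c d → Isolated st u c (suc d)
          then (isolated st₂ i≤₂ u∈₂ c∈₂ iso big₂ arcs≤ pack₂) =
              isolated st₂ (≤-trans i≤₂ (≤-reflexive (sym (+-suc i d)))) u∈₂ c∈₂ iso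
            (lin ((deg g us u) ∷ (g u x + g x u) ∷ (deg g us₁ u) ∷ (deg g (State.us st₂) u) ∷ d ∷ [])
                  (λ D x d′ d″ d → (D :≤ x :+ d′) ∷ (x :≤ con 1) ∷ (d′ :≤ d″ :+ d) ∷ [] ⇒ D :≤ d″ :+ (con 1 :+ d))
                  0 (1 ∷ 1 ∷ 1 ∷ [])
                  (≤-reflexive du , touch , big₂ , tt))
            (≤-trans arcs≤ (≤-trans (m≤n+m (arcs g us₁) (deg g us₁ x)) (≤-reflexive (sym (arcs-split g g0 us-∷)))))
            (λ z → pack₁ (pack₂ z))

-- Vertices of large degree in the first digraph

≤-/ : ∀ k .{{_ : NonZero k}} {x n} → k * x ≤ n → x ≤ n / k
≤-/ k {x} {n} le = ≤-trans (≤-reflexive (sym (m*n/n≡m x k))) (/-monoˡ-≤ k (≤-trans (≤-reflexive (*-comm x k)) le))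

/-≤ : ∀ k .{{_ : NonZero k}} n → k * (n / k) ≤ n
/-≤ k n = ≤-trans (≤-reflexive (*-comm k (n / k))) (m/n*n≤m n k)

</-suc : ∀ k .{{_ : NonZero k}} n → n < k * suc (n / k)
</-suc k n = ≤-trans (s≤s (≤-reflexive (m≡m%n+[m/n]*n n k))) (≤-trans (+-monoˡ-≤ (n / k * k) (m%n<n n k))
  (≤-reflexive (≡.trans (cong (k +_) (*-comm (n / k) k)) (sym (*-suc k (n / k))))))

-- Here N = 3 + M is the number of vertices that are left, and K, Δ, τ and s are 3n/25, n/25, n/36 and N/51 + 1 up to rounding.
core-inequality : ∀ M n K Δ τ s a b φ → 1000 ≤ M → 3 + M ≤ n →
  3 * n ≤ 25 * K + 24 → 25 * K ≤ 3 * n → 25 * Δ ≤ n → τ ≤ 2 * s → 51 * s ≤ M + 54 → a ≤ 1 + M → b + φ ≤ 2 * M + 124 →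
  (2 + M) * (1 + M) * (K * φ) + (1 + M) * (K * (a * b) + (τ * φ * b + φ * (Δ * a)) + τ * φ * b) +
      (b * (b * (s * (2 * a))) + Δ * a * (a * b))
    < (3 + M) * ((2 + M) * ((1 + M) * (5 * K)))
core-inequality M n K Δ τ s a b φ M≥ n≥ K≥ K≤ Δ≤ τ≤ s≤ a≤ β≤ = begin-strict
  (2 + M) * P * (K * φ) + P * (K * (a * b) + (τ * φ * b + φ * (Δ * a)) + τ * φ * b) +
      (b * (b * (s * (2 * a))) + Δ * a * (a * b))
    ≤⟨ +-mono-≤ (+-monoʳ-≤ ((2 + M) * P * (K * φ)) (*-monoʳ-≤ P (+-mono-≤ (+-mono-≤ (*-monoʳ-≤ K (*-monoˡ-≤ b a≤))
         (+-mono-≤ (*-monoˡ-≤ b (*-monoˡ-≤ φ τ≤)) (*-monoʳ-≤ φ (*-monoʳ-≤ Δ a≤)))) (*-monoˡ-≤ b (*-monoˡ-≤ φ τ≤)))))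
       (+-mono-≤ (*-monoʳ-≤ b (*-monoʳ-≤ b (*-monoʳ-≤ s (*-monoʳ-≤ 2 a≤))))
           (*-mono-≤ (*-monoʳ-≤ Δ a≤) (*-monoˡ-≤ b a≤))) ⟩
  (2 + M) * P * (K * φ) + P * (K * (P * b) + (2 * s * φ * b + φ * (Δ * P)) + 2 * s * φ * b) +
      (b * (b * (s * (2 * P))) + Δ * P * (P * b))
    -- Up to replacing 1 + M by 2 + M, everything fits into a linear and a square term in b + φ.
    -- This is why arcs of h and forbidden pairs can share one budget.
    ≤⟨ (lin (M ∷ K ∷ φ ∷ s ∷ b ∷ Δ ∷ [])
          (λ M K φ s b Δ → [] ⇒ (con 2 :+ M) :* (con 1 :+ M) :* (K :* φ) :+ (con
              1 :+ M) :* (K :* ((con 1 :+ M) :* b) :+ (con 2 :* s :* φ :* b :+ φ :* (Δ :* (con 1 :+ M))) :+ con 2 :*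
              s :* φ :* b) :+ (b :* (b :* (s :* (con 2 :* (con 1 :+ M)))) :+ Δ :* (con
              1 :+ M) :* ((con 1 :+ M) :* b)) :≤ (con 1 :+ M) :*
              ((con 2 :+ M) :* (K :+ Δ) :* (b :+ φ) :+ con 2 :* s :* ((b :+ φ) :* (b :+ φ))))
          0 []
          tt) ⟩
  P * ((2 + M) * (K + Δ) * (b + φ) + 2 * s * ((b + φ) * (b + φ)))
    -- 1275 = 25 * 51 clears the denominators of K, Δ and s.
    <⟨ *-monoʳ-< P (*-cancelˡ-< 1275 ((2 + M) * (K + Δ) * (b + φ) + 2 * s * ((b + φ) * (b + φ)))
        ((3 + M) * ((2 + M) * (5 * K))) scaled) ⟩
  P * ((3 + M) * ((2 + M) * (5 * K)))
    ≡⟨ (≤-antisym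
        (lin (M ∷ K ∷ [])
          (λ M K → [] ⇒ (con 1 :+ M) :* ((con 3 :+ M) :* ((con 2 :+ M) :* (con 5 :* K))) :≤ (con
              3 :+ M) :* ((con 2 :+ M) :* ((con 1 :+ M) :* (con 5 :* K))))
          0 []
          tt)
        (lin (M ∷ K ∷ [])
          (λ M K → [] ⇒ (con 3 :+ M) :* ((con 2 :+ M) :* ((con 1 :+ M) :* (con 5 :* K))) :≤ (con
              1 :+ M) :* ((con 3 :+ M) :* ((con 2 :+ M) :* (con 5 :* K))))
          0 []
          tt)) ⟩
  (3 + M) * ((2 + M) * (P * (5 * K))) ∎
  where
  open ≤-Reasoning
  P = 1 + M
  B = 2 * M + 124
  scaled : 1275 * ((2 + M) * (K + Δ) * (b + φ) + 2 * s * ((b + φ) * (b + φ))) < 1275 * ((3 + M) * ((2 + M) * (5 * K)))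
  scaled = (lin (M ∷ n ∷ K ∷ Δ ∷ s ∷ (b + φ) ∷ ((2 + M) * (25 * (K + Δ)) * (b + φ)) ∷
      (51 * s * ((b + φ) * (b + φ))) ∷ ((2 + M) * (4 * n) * B) ∷ ((M + 54) * (B * B)) ∷
      ((3 + M) * (2 + M) * (3 * n)) ∷ ((3 + M) * (2 + M) * (25 * K + 24)) ∷
      (1275 * ((2 + M) * (K + Δ) * (b + φ) + 2 * s * ((b + φ) * (b + φ)))) ∷
      (1275 * ((3 + M) * ((2 + M) * (5 * K)))) ∷ ((3 + M) * (2 + M)) ∷ [])
        (λ M n K Δ s β X Y x y z w X′ w′ c → (X′ :≤ con 51 :* X :+ con 50 :* Y) ∷ (X :≤ x) ∷ (Y :≤ y) ∷
            (con 51 :* x :+ con 50 :* y :+ con 6120 :* c :< con 255 :* z) ∷ (z :≤ w) ∷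
            (con 255 :* w :≤ w′ :+ con 6120 :* c) ∷ [] ⇒ X′ :< w′)
        0 (1 ∷ 51 ∷ 50 ∷ 1 ∷ 255 ∷ 1 ∷ [])
        (≤-reflexive lhs , *-mono-≤ (*-monoʳ-≤ (2 + M) KΔ) β≤ , *-mono-≤ s≤ (*-mono-≤ β≤ β≤) , polynomial ,
            *-monoʳ-≤ ((3 + M) * (2 + M)) K≥ , ≤-reflexive rhs , tt))
    where
    KΔ : 25 * (K + Δ) ≤ 4 * n
    KΔ = (lin (K ∷ Δ ∷ n ∷ [])
          (λ K Δ n → (con 25 :* K :≤ con 3 :* n) ∷ (con 25 :* Δ :≤ n) ∷ [] ⇒ con 25 :* (K :+ Δ) :≤ con 4 :* n)
          0 (1 ∷ 1 ∷ [])
          (K≤ , Δ≤ , tt))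
    lhs : 1275 * ((2 + M) * (K + Δ) * (b + φ) + 2 * s * ((b + φ) * (b + φ))) ≡
        51 * ((2 + M) * (25 * (K + Δ)) * (b + φ)) + 50 * (51 * s * ((b + φ) * (b + φ)))
    lhs = (≤-antisym
        (lin ((2 + M) ∷ (K + Δ) ∷ (b + φ) ∷ s ∷ [])
          (λ x y z s → [] ⇒ con 1275 :* (x :* y :* z :+ con 2 :* s :* (z :* z)) :≤ con 51 :*
              (x :* (con 25 :* y) :* z) :+ con 50 :* (con 51 :* s :* (z :* z)))
          0 []
          tt)
        (lin ((2 + M) ∷ (K + Δ) ∷ (b + φ) ∷ s ∷ [])
          (λ x y z s → [] ⇒ con 51 :* (x :* (con 25 :* y) :* z) :+ con 50 :* (con
              51 :* s :* (z :* z)) :≤ con 1275 :* (x :* y :* z :+ con 2 :* s :* (z :* z)))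
          0 []
          tt))
    rhs : 255 * ((3 + M) * (2 + M) * (25 * K + 24)) ≡ 1275 * ((3 + M) * ((2 + M) * (5 * K))) + 6120 *
        ((3 + M) * (2 + M))
    rhs = (≤-antisym
        (lin ((3 + M) ∷ (2 + M) ∷ K ∷ [])
          (λ x y K → [] ⇒ con 255 :* (x :* y :* (con 25 :* K :+ con 24)) :≤ con 1275 :* (x :* (y :* (con 5 :* K)))
              :+ con 6120 :* (x :* y))
          0 []
          tt)
        (lin ((3 + M) ∷ (2 + M) ∷ K ∷ [])
          (λ x y K → [] ⇒ con 1275 :* (x :* (y :* (con 5 :* K))) :+ con 6120 :* (x :* y) :≤ con 255 :*
              (x :* y :* (con 25 :* K :+ con 24)))
          0 []
          tt))
    -- The leading terms are 408M²n + 200M³ against 765M²n, and M < n. The term with 6120 = 255 * 24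
    -- pays for the rounding of K.
    polynomial : 51 * ((2 + M) * (4 * n) * B) + 50 * ((M + 54) * (B * B)) + 6120 * ((3 + M) * (2 + M))
        < 255 * ((3 + M) * (2 + M) * (3 * n))
    polynomial = (lin (M ∷ n ∷ [])
          (λ M n → (M :* M :* (con 3 :+ M) :≤ M :* M :* n) ∷ (M :* M :* con 1000 :≤ M :* M :* M) ∷
              (M :* n :* con 1000 :≤ M :* n :* M) ∷ (M :* con 1000 :≤ M :* M) ∷ (n :* con 1000 :≤ n :* M) ∷
              (con 1000 :≤ M) ∷ [] ⇒ con 51 :* ((con 2 :+ M) :* (con 4 :* n) :* (con 2 :* M :+ con 124)) :+ con 50
              :* ((M :+ con 54) :* ((con 2 :* M :+ con 124) :* (con 2 :* M :+ con 124))) :+ con 6120 :*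
              ((con 3 :+ M) :* (con 2 :+ M)) :< con 255 :* ((con 3 :+ M) :* (con 2 :+ M) :* (con 3 :* n)))
          1002999999 (243900151921 ∷ 43300151921 ∷ 22400001006 ∷ 2186692376763 ∷ 46140006000 ∷ 41676576763000 ∷ [])
          (*-monoʳ-≤ (M * M) n≥ , *-monoʳ-≤ (M * M) M≥ , *-monoʳ-≤ (M * n) M≥ , *-monoʳ-≤ M M≥ , *-monoʳ-≤ n M≥ ,
              M≥ , tt))

module Final {n : ℕ} (g h : Fin n → Fin n → ℕ) (g≤1 : ∀ u v → g u v ≤ 1) (h≤1 : ∀ p q → h p q ≤ 1)
  (g0 : ∀ u → g u u ≡ 0) (h0 : ∀ p → h p p ≡ 0) (n≥ : 2883 ≤ n) where

  open Stages g h g≤1 h≤1 g0 h0 public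

  private
    V = Fin n
    variable D β c₀ i : ℕ

  record Located (st : State D β c₀ i) (u : V) : Set where
    constructor located
    field
      trees′ : List (List V)
      other′ : List V
      us-∷   : State.us st ↭ u ∷ concat trees′ ++ other′
      sub    : ∀ {T} → T ∈ trees′ → T ∈ State.trees st
      almost : length (State.trees st) ≤ suc (length trees′)

  locate : ∀ (st : State D β c₀ i) {u} → u ∈ State.us st → Located st u
  locate st {u} u∈ = go (∈-++⁻ (concat trees) (∈-resp-↭ us≡ u∈))
    where
    open State st
    go : u ∈ concat trees ⊎ u ∈ other → Located st u
    go (inj₂ j) = outside (∈⇒↭ j)
      where
      outside : ∃ (λ ys → other ↭ u ∷ ys) → Located st u
      outside (ys , p) = located trees ys (↭-trans us≡ (↭-trans (++⁺ˡ (concat trees) p)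
          (shift u (concat trees) ys))) (λ T∈ → T∈) (n≤1+n _)
    go (inj₁ j) = within (∈-concat⁻′ trees j)
      where
      within : ∃ (λ T → u ∈ T × T ∈ trees) → Located st u
      within (T , u∈T , T∈) = split′ (∈⇒↭ T∈) (∈⇒↭ u∈T)
        where
        split′ : ∃ (λ ts → trees ↭ T ∷ ts) → ∃ (λ T′ → T ↭ u ∷ T′) → Located st u
        split′ (ts , p) (T′ , q) = located ts (T′ ++ other)
          (↭-trans us≡ (↭-trans (++⁺ʳ other (↭-trans (concat-↭ p) (++⁺ʳ (concat ts) q)))
              (prep u (↭-trans (↭-reflexive (++-assoc T′ (concat ts) other)) (shifts T′ (concat ts))))))
          (λ i → ∈-resp-↭ (↭-sym p) (there i)) (≤-reflexive (↭-length p))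

  record HubPlaced (st : State D β c₀ i) : Set where
    constructor hubPlaced
    field
      {i′} : ℕ
      st′  : State D β c₀ i′
      i≤   : i′ ≤ i + 5
      drop : 3 * arcs g (State.us st′) + n ≤ 3 * arcs g (State.us st) + 12
      pack : PacksState st′ → PacksState st

  -- The degrees of h average less than 5, so some c has degree at most 4. At most four leaves
  -- isolate c, and u on an isolated vertex forbids nothing new; with the tree that u may lie in, at
  -- most five trees are lost.
  place-hub : ∀ (st : State D β c₀ i) {u} → i ≤ 54 → u ∈ State.us st → n ≤ 3 * deg g (State.us st) u →
    2 * arcs h (State.ps st) < 5 * length (State.us st) → HubPlaced st
  place-hub {D} {β} {c₀} {i} st {u} i≤ u∈ hub sparse-h = go (∑<⇒∃< ps₀ (deg h ps₀) (λ _ → 5)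
      (lin ((∑ ps₀ (deg h ps₀)) ∷ (arcs h ps₀) ∷ (∑[ _ ∈ ps₀ ] 5) ∷ (length ps₀) ∷ (length us₀) ∷ [])
            (λ d b c l u → (d :≤ con 2 :* b) ∷ (con 2 :* b :< con 5 :* u) ∷ (u :≤ l) ∷ (l :* con 5 :≤ c) ∷ [] ⇒ d :< c)
            0 (1 ∷ 1 ∷ 5 ∷ 1 ∷ [])
            (≤-reflexive (∑-deg h ps₀) , sparse-h , ≤-reflexive (State.len st) , ≤-reflexive (sym (∑-const ps₀ 5)) ,
                tt)))
    where
    ps₀ = State.ps st
    us₀ = State.us st
    go : ∃ (λ c → c ∈ ps₀ × deg h ps₀ c < 5) → HubPlaced st
    go (c , c∈₀ , s≤s c≤4) = next (isolate 4 st {u} {c} (lin (i ∷ [])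
          (λ i → (i :≤ con 54) ∷ [] ⇒ i :+ con 4 :≤ con 58)
          0 (1 ∷ [])
          (i≤ , tt)) u∈ c∈₀ c≤4
        (lin (n ∷ (deg g us₀ u) ∷ [])
              (λ n d → (con 2883 :≤ n) ∷ (n :≤ con 3 :* d) ∷ [] ⇒ con 2 :+ con 4 :≤ d)
              960 (2 ∷ 2 ∷ [])
              (n≥ , hub , tt)))
      where
      next : Isolated st u c 4 → HubPlaced st
      next (isolated {i₁} st₁ i₁≤ u∈₁ c∈₁ iso big₁ arcs≤ pack₁) = done (locate st₁ u∈₁) (∈⇒↭ c∈₁)
        where
        open State st₁
        big : n ≤ 3 * deg g us u + 12
        big = (lin (n ∷ (deg g us₀ u) ∷ (deg g us u) ∷ [])
              (λ n d d′ → (n :≤ con 3 :* d) ∷ (d :≤ d′ :+ con 4) ∷ [] ⇒ n :≤ con 3 :* d′ :+ con 12)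
              0 (1 ∷ 3 ∷ [])
              (hub , big₁ , tt))
        -- By `small` a vertex with a forbidden position has degree at most n/36, but u still has at
        -- least n/3 - 4.
        Suc≡0 : ∀ s → S u c ≡ s → S u c ≡ 0
        Suc≡0 zero eq = eq
        Suc≡0 (suc s) eq = ⊥-elim (<-irrefl ≡.refl (lin (n ∷ (deg g us u) ∷ [])
              (λ n d → (n :≤ con 3 :* d :+ con 12) ∷ (con 2883 :≤ n) ∷ (con 36 :* d :≤ n) ∷ [] ⇒ n :< n)
              31568 (12 ∷ 11 ∷ 1 ∷ [])
              (big , n≥ , small (≤-trans (s≤s z≤n) (≤-reflexive (sym eq))) , tt)))
        done : Located st₁ u → ∃ (λ ps′ → ps ↭ c ∷ ps′) → HubPlaced st
        done (located trees′ other′ us-∷ sub almost) (ps′ , ps-∷) = hubPlaced new (lin (i ∷ i₁ ∷ [])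
              (λ i i₁ → (i₁ :≤ i :+ con 4) ∷ [] ⇒ (con 1 :+ i₁) :≤ i :+ con 5)
              0 (1 ∷ [])
              (i₁≤ , tt))
            (lin ((arcs g us₀) ∷ (arcs g us) ∷ (arcs g us′) ∷ (deg g us′ u) ∷ (deg g us u) ∷ n ∷ [])
                  (λ a a₁ a′ d d₁ n → (a₁ :≤ a) ∷ (d :+ a′ :≤ a₁) ∷ (d₁ :≤ d) ∷ (n :≤ con 3 :* d₁ :+ con 12) ∷ [] ⇒
                      con 3 :* a′ :+ n :≤ con 3 :* a :+ con 12)
                  0 (3 ∷ 3 ∷ 3 ∷ 1 ∷ [])
                  (arcs≤ , ≤-reflexive (sym (arcs-split g g0 us-∷)) , ≤-reflexive d≡ , big , tt))
            (λ x → pack₁ (place us-∷ ps-∷ (Suc≡0 (S u c) ≡.refl) (Packs-mono free x)))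
          where
          us′ = concat trees′ ++ other′
          d≡ : deg g us u ≡ deg g us′ u
          d≡ = ≡.trans (deg-↭ g u us-∷) (cong₂ _+_ (cong (_+ outdeg g us′ u) (g0 u)) (cong (_+ indeg g us′ u) (g0 u)))
          us′⊆ : ∀ {v} → v ∈ us′ → v ∈ us
          us′⊆ i = ∈-resp-↭ (↭-sym us-∷) (there i)
          ps′⊆ : ∀ {q} → q ∈ ps′ → q ∈ ps
          ps′⊆ i = ∈-resp-↭ (↭-sym ps-∷) (there i)
          free : ∀ {v r} → v ∈ us′ → r ∈ ps′ → S v r ≡ 0 → forbid S u c v r ≡ 0
          free {v} {r} _ r∈ eq = cong₂ _+_ eq (cong₂ _+_
            (≡.trans (cong (g u v *_) (∑≡0⇒∈ (h c) (m+n≡0⇒m≡0 (outdeg h ps c) iso) (ps′⊆ r∈))) (*-zeroʳ (g u v)))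
            (≡.trans (cong (g v u *_) (∑≡0⇒∈ (λ r → h r c) (m+n≡0⇒n≡0 (outdeg h ps c) iso) (ps′⊆ r∈)))
                (*-zeroʳ (g v u))))
          shorter : length us ≡ suc (length us′)
          shorter = ↭-length us-∷
          arcs-g′ : arcs g us′ ≤ arcs g us
          arcs-g′ = ≤-trans (m≤n+m (arcs g us′) (deg g us′ u)) (≤-reflexive (sym (arcs-split g g0 us-∷)))
          new : State D β c₀ (suc i₁)
          new = record
            { us = us′ ; ps = ps′ ; S = S ; trees = trees′ ; other = other′
            ; us! = Unique-++ʳ (u ∷ []) (Unique-resp-↭ us-∷ us!) ; ps! =
                Unique-++ʳ (c ∷ []) (Unique-resp-↭ ps-∷ ps!) ; us≡ = refl
            ; len = suc-injective (≡.trans (sym shorter) (≡.trans len (↭-length ps-∷)))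
            ; us≤n = ≤-trans (n≤1+n _) (≤-trans (≤-reflexive (sym shorter)) us≤n)
            ; are-trees = λ i → are-trees (sub i)
            ; count = (lin (i₁ ∷ (length trees) ∷ (length trees′) ∷ [])
                  (λ i₁ l l′ → (con 93 :≤ i₁ :+ l) ∷ (l :≤ (con 1 :+ l′)) ∷ [] ⇒ con 93 :≤ (con 1 :+ i₁) :+ l′)
                  0 (1 ∷ 1 ∷ [])
                  (count , almost , tt))
            ; sparse = (lin ((arcs g us) ∷ (arcs g us′) ∷ (length us) ∷ (length us′) ∷ i₁ ∷ [])
                  (λ a a′ u u′ i₁ → (a′ :≤ a) ∷ (a :+ con 93 :≤ u :+ i₁) ∷ (u :≤ (con 1 :+ u′)) ∷ [] ⇒
                      a′ :+ con 93 :≤ u′ :+ (con 1 :+ i₁))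
                  0 (1 ∷ 1 ∷ 1 ∷ [])
                  (arcs-g′ , sparse , ≤-reflexive shorter , tt))
            ; half⁺ = λ {q} q∈ → ≤-trans (*-monoʳ-≤ 3 (∑-tail (h q) ps-∷)) (half⁺ (ps′⊆ q∈))
            ; half⁻ = λ {q} q∈ → ≤-trans (*-monoʳ-≤ 3 (∑-tail (λ r → h r q) ps-∷)) (half⁻ (ps′⊆ q∈))
            ; rows = λ {v} v∈ → ≤-trans (*-monoʳ-≤ 3 (∑-tail (S v) ps-∷)) (rows (us′⊆ v∈))
            ; cols = λ {q} q∈ → ≤-trans (≤-trans (∑-tail (λ v → S v q) us-∷) (cols (ps′⊆ q∈))) (n≤1+n i₁)
            ; small = λ {v} pos → ≤-trans (*-monoʳ-≤ 36 (deg-tail g v us-∷)) (small pos)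
            ; fresh = λ {v} v∈ → fresh (fresh′ v∈)
            ; budget = ≤-trans (+-mono-≤ (≤-trans (m≤n+m (arcs h ps′) (deg h ps′ c))
                (≤-reflexive (sym (arcs-split h h0 ps-∷))))
                (≤-trans (∑-mono us′ (λ v → ∑-tail (S v) ps-∷)) (∑-tail (λ v → ∑[ p ∈ ps ] S v p) us-∷))) budget
            ; total = (≤-antisym
                (lin ((length us) ∷ (length us′) ∷ i₁ ∷ c₀ ∷ [])
                  (λ u u′ i₁ c₀ → (u :+ i₁ :≤ c₀) ∷ ((con 1 :+ u′) :≤ u) ∷ [] ⇒ u′ :+ (con 1 :+ i₁) :≤ c₀)
                  0 (1 ∷ 1 ∷ [])
                  (≤-reflexive total , ≤-reflexive (sym shorter) , tt))
                (lin ((length us) ∷ (length us′) ∷ i₁ ∷ c₀ ∷ [])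
                  (λ u u′ i₁ c₀ → (c₀ :≤ u :+ i₁) ∷ (u :≤ (con 1 :+ u′)) ∷ [] ⇒ c₀ :≤ u′ :+ (con 1 :+ i₁))
                  0 (1 ∷ 1 ∷ [])
                  (≤-reflexive (sym total) , ≤-reflexive shorter , tt)))
            ; few = ≤-trans (+-monoˡ-≤ 93 arcs-g′) few
            ; low = λ {q} q∈ → ≤-trans (deg-tail h q ps-∷) (low (ps′⊆ q∈))
            }
            where
            fresh′ : ∀ {v} → v ∈ concat trees′ → v ∈ concat trees
            fresh′ v∈ = go′ (∈-concat⁻′ trees′ v∈)
              where
              go′ : ∃ (λ T → _ ∈ T × T ∈ trees′) → _
              go′ (T , v∈T , T∈) = ∈-concat⁺′ v∈T (sub T∈)

  -- `c₀`, the vertices left plus the trees used, does not change while vertices are placed singly.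
  -- Before that at most five whole trees of at most n/88 vertices are placed, hence c₀ ≥ 83n/88.
  module _ (c₀≥ : 88 * n ≤ 88 * c₀ + 5 * n) (β≤ : β ≤ 2 * c₀) where

    sparse-h : ∀ {D i} (st : State D β c₀ i) → i ≤ 59 → 2 * arcs h (State.ps st) < 5 * length (State.us st)
    sparse-h {i = i} st i≤ = (lin ((arcs h (State.ps st)) ∷
        (∑[ v ∈ State.us st ] ∑[ p ∈ State.ps st ] State.S st v p) ∷ β ∷ c₀ ∷ (length (State.us st)) ∷ i ∷ n ∷ [])
          (λ b φ β c₀ u i n → (b :+ φ :≤ β) ∷ (β :≤ con 2 :* c₀) ∷ (con 88 :* n :≤ con 88 :* c₀ :+ con 5 :* n) ∷
              (c₀ :≤ u :+ i) ∷ (i :≤ con 59) ∷ (con 2883 :≤ n) ∷ [] ⇒ con 2 :* b :< con 5 :* u)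
          234096 (468194 ∷ 468194 ∷ 237 ∷ 957244 ∷ 957244 ∷ 19671 ∷ [])
          (State.budget st , β≤ , c₀≥ , ≤-reflexive (sym (State.total st)) , i≤ , n≥ , tt))

    -- Each hub removes at least n/3 - 4 of the arcs of g, of which there are at most n - 93; so
    -- after two of them none is left.
    place-hubs : ∀ j {D i} (st : State D β c₀ i) → i + 5 * j ≤ 59 → 3 * arcs g (State.us st) + 12 * j < suc j * n →
      Σ (Reached D 59 st) λ r → ∀ {u} → u ∈ State.us (Reached.st′ r) → 3 * deg g (State.us (Reached.st′ r)) u < n
    place-hubs j {D} {i} st i≤ lt = go j i≤ lt (search (λ u → n ≤? 3 * deg g us u) us)
      where
      open State st
      deg≤arcs : ∀ {u} → u ∈ us → deg g us u ≤ arcs g us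
      deg≤arcs {u} u∈ = go (∈⇒↭ u∈)
        where
        go : ∃ (λ ys → us ↭ u ∷ ys) → deg g us u ≤ arcs g us
        go (ys , p) = ≤-trans (≤-reflexive (≡.trans (deg-↭ g u p)
            (cong₂ _+_ (cong (_+ outdeg g ys u) (g0 u)) (cong (_+ indeg g ys u) (g0 u)))))
          (≤-trans (m≤m+n (deg g ys u) (arcs g ys)) (≤-reflexive (sym (arcs-split g g0 p))))
      go : ∀ j → i + 5 * j ≤ 59 → 3 * arcs g us + 12 * j < suc j * n →
          (∃ λ u → u ∈ us × n ≤ 3 * deg g us u) ⊎ (∀ {u} → u ∈ us → ¬ n ≤ 3 * deg g us u) →
        Σ (Reached D 59 st) λ r → ∀ {u} → u ∈ State.us (Reached.st′ r) → 3 * deg g (State.us (Reached.st′ r)) u < n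
      go j i≤ lt (inj₂ none) = reached st (≤-trans (m≤m+n i (5 * j)) i≤) (λ x → x) , λ u∈ → ≰⇒> (none u∈)
      go zero i≤ lt (inj₁ (u , u∈ , hub)) = ⊥-elim (<-irrefl ≡.refl (lin (n ∷ (arcs g us) ∷ (deg g us u) ∷ [])
            (λ n a d → (con 3 :* a :+ con 12 :* con 0 :< con 1 :* n) ∷ (n :≤ con 3 :* d) ∷ (d :≤ a) ∷ [] ⇒ n :< n)
            0 (1 ∷ 1 ∷ 3 ∷ [])
            (lt , hub , deg≤arcs u∈ , tt)))
      go (suc j) i≤ lt (inj₁ (u , u∈ , hub)) = next (place-hub st (lin (i ∷ j ∷ [])
            (λ i j → (i :+ con 5 :* (con 1 :+ j) :≤ con 59) ∷ [] ⇒ i :≤ con 54)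
            0 (1 ∷ [])
            (i≤ , tt)) u∈ hub (sparse-h st (≤-trans (m≤m+n i (5 * suc j)) i≤)))
        where
        next : HubPlaced st → Σ (Reached D 59 st) λ r → ∀ {u} → u ∈ State.us (Reached.st′ r) →
            3 * deg g (State.us (Reached.st′ r)) u < n
        next (hubPlaced {i₁} st₁ i₁≤ drop pack₁) = then (place-hubs j st₁ (lin (i₁ ∷ i ∷ j ∷ [])
              (λ i₁ i j → (i₁ :≤ i :+ con 5) ∷ (i :+ con 5 :* (con 1 :+ j) :≤ con 59) ∷ [] ⇒ i₁ :+ con 5 :* j :≤ con 59)
              0 (1 ∷ 1 ∷ [])
              (i₁≤ , i≤ , tt))
            (lin ((arcs g (State.us st₁)) ∷ (arcs g us) ∷ n ∷ j ∷ [])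
                  (λ a′ a n j → (con 3 :* a′ :+ n :≤ con 3 :* a :+ con 12) ∷
                      (con 3 :* a :+ con 12 :* (con 1 :+ j) :< (con 1 :+ ((con 1 :+ j))) :* n) ∷ [] ⇒
                      con 3 :* a′ :+ con 12 :* j :< (con 1 :+ j) :* n)
                  0 (1 ∷ 1 ∷ [])
                  (drop , lt , tt)))
          where
          then : (Σ (Reached D 59 st₁) λ r → ∀ {u} → u ∈ State.us (Reached.st′ r) →
              3 * deg g (State.us (Reached.st′ r)) u < n) →
            Σ (Reached D 59 st) λ r → ∀ {u} → u ∈ State.us (Reached.st′ r) → 3 * deg g (State.us (Reached.st′ r)) u < n
          then (reached st₂ le₂ pack₂ , low₂) = reached st₂ le₂ (λ x → pack₁ (pack₂ x)) , low₂

    -- The choice of K = 3n/25: it has to exceed 2Δ + ζ, about n/10, while the leading part of `N≥`,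
    -- 2n/25 + n/3 + 12n/25 = 67n/75, must stay below 83n/88. C = 59 because each tree used adds at
    -- most one to a column of `S`.
    finish : ∀ {i} (st : State (n / 25) β c₀ i) → i ≤ 59 →
        (∀ {u} → u ∈ State.us st → 3 * deg g (State.us st) u < n) → PacksState st
    finish {i} st i≤ no-hub = Start.packing g h g≤1 h≤1 g0 h0 us ps S us! ps! Δ (n / 3) ζ 59 K 100
      low (λ u∈ → ≤-/ 3 (<⇒≤ (no-hub u∈))) (λ v∈ → ≤-/ 3 (rows v∈)) (λ p∈ → ≤-trans (cols p∈) i≤) few-big
      (lin (Δ ∷ ζ ∷ K ∷ n ∷ [])
            (λ Δ ζ K n → (con 25 :* Δ :≤ n) ∷ (con 50 :* ζ :≤ n) ∷ (con 3 :* n :< con 25 :* (con 1 :+ K)) ∷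
                (con 2883 :≤ n) ∷ [] ⇒ con 2 :* Δ :+ ζ :≤ K)
            28749 (2300 ∷ 575 ∷ 961 ∷ 8 ∷ [])
            (/-≤ 25 n , /-≤ 50 n , K> , n≥ , tt))
      (lin (Δ ∷ K ∷ n ∷ [])
            (λ Δ K n → (con 25 :* Δ :≤ n) ∷ (con 3 :* n :< con 25 :* (con 1 :+ K)) ∷ (con 2883 :≤ n) ∷ [] ⇒
                Δ :+ con 100 :≤ K)
            215624 (8625 ∷ 5383 ∷ 7524 ∷ [])
            (/-≤ 25 n , K> , n≥ , tt))
      (lin (Δ ∷ K ∷ n ∷ (n / 3) ∷ N ∷ c₀ ∷ i ∷ [])
            (λ Δ K n e N c₀ i → (con 25 :* Δ :≤ n) ∷ (con 25 :* K :≤ con 3 :* n) ∷ (con 3 :* e :≤ n) ∷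
                (con 2883 :≤ n) ∷ (c₀ :≤ N :+ i) ∷ (i :≤ con 59) ∷ (con 88 :* n :≤ con 88 :* c₀ :+ con 5 :* n) ∷
                [] ⇒ con 59 :+ con 2 :* Δ :+ e :+ con 4 :* K :+ con 1 :≤ N)
            17557274 (1404582 ∷ 2809164 ∷ 5852425 ∷ 721364 ∷ 17394168 ∷ 17394168 ∷ 197661 ∷ [])
            (/-≤ 25 n , /-≤ 25 (3 * n) , /-≤ 3 n , n≥ , ≤-reflexive (sym total) , i≤ , c₀≥ , tt))
      τ s M (λ pos → ≤-/ 36 (small pos)) a≤s² N≡ (≡.trans (sym len) N≡) inequality
      where
      open State st
      N Δ ζ K τ s M : ℕ
      N = length us
      Δ = n / 25
      ζ = n / 50
      K = 3 * n / 25
      τ = n / 36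
      -- A linear substitute for the square root of the number of arcs of g: N ≥ 51 * 51 gives N ≤
      -- (N/51)².
      s = suc (N / 51)
      M = N ∸ 3
      K> : 3 * n < 25 * suc K
      K> = </-suc 25 (3 * n)
      N≥ : 2601 ≤ N
      N≥ = (lin (N ∷ c₀ ∷ i ∷ n ∷ [])
            (λ N c₀ i n → (c₀ :≤ N :+ i) ∷ (i :≤ con 59) ∷ (con 88 :* n :≤ con 88 :* c₀ :+ con 5 :* n) ∷
                (con 2883 :≤ n) ∷ [] ⇒ con 2601 :≤ N)
            234096 (228888 ∷ 228888 ∷ 2601 ∷ 215883 ∷ [])
            (≤-reflexive (sym total) , i≤ , c₀≥ , n≥ , tt))
      N≡ : N ≡ 3 + M
      N≡ = sym (m+[n∸m]≡n (≤-trans (m≤m+n 3 2598) N≥))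
      -- The degrees sum to less than 2n, so at most 100 of them exceed n/50.
      few-big : (∑[ w ∈ us ] ⟦ suc ζ ≤? deg g us w ⟧ᵈ) ≤ 100
      few-big = *-cancelˡ-≤ n ⦃ >-nonZero (≤-trans (s≤s z≤n) n≥) ⦄ (begin
        n * m ≤⟨ *-monoˡ-≤ m (<⇒≤ (</-suc 50 n)) ⟩
        50 * suc ζ * m ≡⟨ *-assoc 50 (suc ζ) m ⟩
        50 * (suc ζ * m) ≤⟨ *-monoʳ-≤ 50 (Markov us (deg g us) (suc ζ)) ⟩
        50 * ∑ us (deg g us) ≡⟨ cong (50 *_) (∑-deg g us) ⟩
        50 * (2 * arcs g us) ≤⟨ (lin ((arcs g us) ∷ n ∷ [])
              (λ a n → (a :+ con 93 :≤ n) ∷ [] ⇒ con 50 :* (con 2 :* a) :≤ n :* con 100)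
              0 (100 ∷ [])
              (few , tt)) ⟩
        n * 100 ∎)
        where
        open ≤-Reasoning
        m = ∑[ w ∈ us ] ⟦ suc ζ ≤? deg g us w ⟧ᵈ
      a≤ : arcs g us ≤ 1 + M
      a≤ = (lin ((arcs g us) ∷ N ∷ i ∷ M ∷ [])
            (λ a N i M → (a :+ con 93 :≤ N :+ i) ∷ (i :≤ con 59) ∷ (N :≤ con 3 :+ M) ∷ [] ⇒ a :≤ con 1 :+ M)
            0 (1 ∷ 1 ∷ 1 ∷ [])
            (sparse , i≤ , ≤-reflexive N≡ , tt))
      a≤s² : arcs g us ≤ s * s
      a≤s² = (lin ((arcs g us) ∷ N ∷ s ∷ i ∷ [])
            (λ a N s i → (a :+ con 93 :≤ N :+ i) ∷ (i :≤ con 59) ∷ (N :* con 2601 :≤ N :* N) ∷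
                (N :* N :≤ con 51 :* s :* (con 51 :* s)) ∷ [] ⇒ a :≤ s :* s)
            2600 (2601 ∷ 2601 ∷ 1 ∷ 1 ∷ [])
            (sparse , i≤ , *-monoʳ-≤ N N≥ , *-mono-≤ (<⇒≤ (</-suc 51 N)) (<⇒≤ (</-suc 51 N)) , tt))
      inequality = core-inequality M n K Δ τ s (arcs g us) (arcs h ps) (∑[ v ∈ us ] ∑[ p ∈ ps ] S v p)
        (lin (N ∷ M ∷ [])
              (λ N M → (con 2601 :≤ N) ∷ (N :≤ con 3 :+ M) ∷ [] ⇒ con 1000 :≤ M)
              1298 (500 ∷ 500 ∷ [])
              (N≥ , ≤-reflexive N≡ , tt))
        (≤-trans (≤-reflexive (sym N≡)) us≤n)
        (lin (K ∷ n ∷ [])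
              (λ K n → (con 3 :* n :< con 25 :* (con 1 :+ K)) ∷ [] ⇒ con 3 :* n :≤ con 25 :* K :+ con 24)
              0 (1 ∷ [])
              (K> , tt))
        (/-≤ 25 (3 * n)) (/-≤ 25 n)
        (lin (τ ∷ s ∷ n ∷ N ∷ c₀ ∷ i ∷ [])
              (λ τ s n N c₀ i → (con 36 :* τ :≤ n) ∷ (N :< con 51 :* s) ∷ (c₀ :≤ N :+ i) ∷ (i :≤ con 59) ∷
                  (con 88 :* n :≤ con 88 :* c₀ :+ con 5 :* n) ∷ (con 2883 :≤ n) ∷ [] ⇒ τ :≤ con 2 :* s)
              8430659 (234185 ∷ 253704 ∷ 253704 ∷ 253704 ∷ 2883 ∷ 5104 ∷ [])
              (/-≤ 36 n , </-suc 51 N , ≤-reflexive (sym total) , i≤ , c₀≥ , n≥ , tt))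
        (lin ((N / 51) ∷ N ∷ M ∷ [])
              (λ q N M → (con 51 :* q :≤ N) ∷ (N :≤ con 3 :+ M) ∷ [] ⇒ con 51 :* (con 1 :+ q) :≤ M :+ con 54)
              0 (1 ∷ 1 ∷ [])
              (/-≤ 51 N , ≤-reflexive N≡ , tt))
        a≤
        (lin ((arcs h ps) ∷ (∑[ v ∈ us ] ∑[ p ∈ ps ] S v p) ∷ β ∷ c₀ ∷ N ∷ i ∷ M ∷ [])
              (λ b φ β c₀ N i M → (b :+ φ :≤ β) ∷ (β :≤ con 2 :* c₀) ∷ (c₀ :≤ N :+ i) ∷ (i :≤ con 59) ∷
                  (N :≤ con 3 :+ M) ∷ [] ⇒ b :+ φ :≤ con 2 :* M :+ con 124)
              0 (1 ∷ 1 ∷ 2 ∷ 2 ∷ 2 ∷ [])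
              (budget , β≤ , ≤-reflexive (sym total) , i≤ , ≤-reflexive N≡ , tt))

    packs-state : ∀ {D i} (st : State D β c₀ i) j → i + j ≡ 50 → 25 * arcs h (State.ps st) + i * n < 50 * n →
        PacksState st
    packs-state st j eq lt = first (cover-large j st eq lt)
      where
      first : Reached (n / 25) 49 st → PacksState st
      first (reached {i₁} st₁ le₁ pack₁) = pack₁ (second (place-hubs 2 st₁ (lin (i₁ ∷ [])
            (λ i₁ → (i₁ :≤ con 49) ∷ [] ⇒ i₁ :+ con 5 :* con 2 :≤ con 59)
            0 (1 ∷ [])
            (le₁ , tt))
          (lin ((arcs g (State.us st₁)) ∷ n ∷ [])
                (λ a n → (a :+ con 93 :≤ n) ∷ [] ⇒ con 3 :* a :+ con 12 :* con 2 :< (con 1 :+ con 2) :* n)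
                0 (3 ∷ [])
                (State.few st₁ , tt))))
        where
        second : (Σ (Reached (n / 25) 59 st₁) λ r → ∀ {u} → u ∈ State.us (Reached.st′ r) →
            3 * deg g (State.us (Reached.st′ r)) u < n) → PacksState st₁
        second (reached st₂ le₂ pack₂ , low₂) = pack₂ (finish st₂ le₂ low₂)

-- Trees placed at once

zeros : ∀ {A : Set} (f : A → ℕ) xs → Filtered (λ x → f x ≡ 0) xs
zeros f = filter (λ x → f x ≟ 0)

zeros-outs : ∀ {A : Set} (f : A → ℕ) xs → length (Filtered.outs (zeros f xs)) ≤ ∑ xs f
zeros-outs f xs = begin
  length outs ≡⟨ sym (*-identityʳ _) ⟩
  length outs * 1 ≡⟨ sym (∑-const outs 1) ⟩
  (∑[ _ ∈ outs ] 1) ≤⟨ ∑-mono-∈ outs (λ i → n≢0⇒n>0 (all-outs i)) ⟩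
  ∑ outs f ≤⟨ m≤n+m (∑ outs f) (∑ ins f) ⟩
  ∑ ins f + ∑ outs f ≡⟨ sym (≡.trans (∑-↭ f whole) (∑-++ ins outs f)) ⟩
  ∑ xs f ∎
  where
  open ≤-Reasoning
  open Filtered (zeros f xs)

module Whole {n : ℕ} (g h : Fin n → Fin n → ℕ) (g≤1 : ∀ u v → g u v ≤ 1) (h≤1 : ∀ p q → h p q ≤ 1)
  (g0 : ∀ u → g u u ≡ 0) (h0 : ∀ p → h p p ≡ 0) (n≥ : 2883 ≤ n) where

  open Final g h g≤1 h≤1 g0 h0 n≥ public

  private V = Fin n

  outdeg≤arcs : ∀ (k : V → V → ℕ) {xs y} → y ∈ xs → outdeg k xs y ≤ arcs k xs
  outdeg≤arcs k {xs} = ∑-∈ (outdeg k xs)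

  indeg≤arcs : ∀ (k : V → V → ℕ) {xs y} → y ∈ xs → indeg k xs y ≤ arcs k xs
  indeg≤arcs k {xs} y∈ = ≤-trans (∑-∈ (indeg k xs) y∈) (≤-reflexive (∑-indeg k xs))

  deg-self : ∀ (k : V → V → ℕ) → (∀ u → k u u ≡ 0) → ∀ {xs ys y} → xs ↭ y ∷ ys → deg k xs y ≡ deg k ys y
  deg-self k k0 {ys = ys} {y} p = ≡.trans (deg-↭ k y p)
      (cong₂ _+_ (cong (_+ outdeg k ys y) (k0 y)) (cong (_+ indeg k ys y) (k0 y)))

  out-zero : ∀ {T T′ x} → T ↭ x ∷ T′ → outdeg g T x ≡ 0 → ∀ {t} → t ∈ T′ → g x t ≡ 0
  out-zero p eq t∈ = ∑≡0⇒∈ (g _) eq (∈-resp-↭ (↭-sym p) (there t∈))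

  in-zero : ∀ {T T′ x} → T ↭ x ∷ T′ → indeg g T x ≡ 0 → ∀ {t} → t ∈ T′ → g t x ≡ 0
  in-zero {x = x} p eq t∈ = ∑≡0⇒∈ (λ t → g t x) eq (∈-resp-↭ (↭-sym p) (there t∈))

  cross-out : ∀ {x y t p} → g x t ≡ 0 → h p y ≡ 0 → cross (x , y) (t , p) ≡ 0
  cross-out {x} {y} {t} {p} eq₁ eq₂ = cong₂ _+_ (cong (_* h y p) eq₁) (≡.trans (cong (g t x *_) eq₂) (*-zeroʳ (g t x)))

  cross-in : ∀ {x y t p} → g t x ≡ 0 → h y p ≡ 0 → cross (x , y) (t , p) ≡ 0
  cross-in {x} {y} {t} {p} eq₁ eq₂ = cong₂ _+_ (≡.trans (cong (g x t *_) eq₂) (*-zeroʳ (g x t))) (cong (_* h p y) eq₁)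

  -- The state after i whole trees. Each took at least n/3 arcs of h (`heavy`) but at most n/88
  -- vertices (`long`), so h keeps fewer arcs than twice the number of vertices left.
  record Initial (i : ℕ) : Set where
    field
      us ps     : List V
      trees     : List (List V)
      other     : List V
      us!       : Unique us
      ps!       : Unique ps
      us≡       : us ↭ concat trees ++ other
      len       : length us ≡ length ps
      us≤n      : length us ≤ n
      are-trees : ∀ {T} → T ∈ trees → Tree g g0 T
      count     : 93 ≤ i + length trees
      sparse    : arcs g us + 93 ≤ length us + i
      few       : arcs g us + 93 ≤ n
      heavy     : 3 * arcs h ps + i * n < 6 * n
      long      : 88 * n ≤ 88 * length us + i * n
      tame      : ∀ {p} → p ∈ ps → 5 * deg h ps p < 8 * n

  private variable i : ℕ

  -- At least n/3 arcs of h are still present, so `heavy` forces i ≤ 4. Hence 89 trees are left and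
  -- the smallest has at most n/89 vertices, within the n/88 that `long` grants.
  module At (st : Initial i) {y} (y∈ : y ∈ Initial.ps st) (large : n ≤ 3 * deg h (Initial.ps st) y)
    (big : n ≤ 3 * arcs h (Initial.ps st)) where

    open Initial st

    i≤4 : i ≤ 4
    i≤4 = s≤s⁻¹ (*-cancelʳ-< n i 5 (lin ((i * n) ∷ n ∷ (arcs h ps) ∷ [])
          (λ x n b → (n :≤ con 3 :* b) ∷ (con 3 :* b :+ x :< con 6 :* n) ∷ [] ⇒ x :< con 5 :* n)
          0 (1 ∷ 1 ∷ [])
          (big , heavy , tt)))

    many : 89 ≤ length trees
    many = (lin (i ∷ (length trees) ∷ [])
          (λ i l → (con 93 :≤ i :+ l) ∷ (i :≤ con 4) ∷ [] ⇒ con 89 :≤ l)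
          0 (1 ∷ 1 ∷ [])
          (count , i≤4 , tt))

    record Next : Set where
      constructor next
      field
        st′  : Initial (suc i)
        pack : Packs (Initial.us st′) (Initial.ps st′) none → Packs us ps none

    module _ {T} (T∈ : T ∈ trees) (size : length T * length trees ≤ length (concat trees)) where

      tr = are-trees T∈

      short : 89 * length T ≤ n
      short = (lin ((length T) ∷ (length T * length trees) ∷ (length (concat trees)) ∷ (length other) ∷
          (length us) ∷ n ∷ [])
            (λ t tl c o u n → (t :* con 89 :≤ tl) ∷ (tl :≤ c) ∷ (c :+ o :≤ u) ∷ (u :≤ n) ∷ [] ⇒ con 89 :* t :≤ n)
            0 (1 ∷ 1 ∷ 1 ∷ 1 ∷ [])
            (*-monoʳ-≤ (length T) many , size , ≤-reflexive (sym (length-⊆ {ys = concat trees} us≡)) , us≤n , tt))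

      module _ {x T′ ps₁ Q R trees′} (T≡ : T ↭ x ∷ T′) (ps≡ : ps ↭ y ∷ ps₁) (ps₁≡ : ps₁ ↭ Q ++ R) (trees≡ :
          trees ↭ T ∷ trees′)
        (ok : ∀ {t p} → t ∈ T′ → p ∈ Q → cross (x , y) (t , p) ≡ 0) (R≤ : 2 * length R ≤ deg h ps y) where

        private
          us′ = concat trees′ ++ other

        us-T : us ↭ T ++ us′
        us-T = ↭-trans us≡ (↭-trans (++⁺ʳ other (concat-↭ trees≡)) (↭-reflexive (++-assoc T (concat trees′) other)))

        degree≤ : deg h ps y ≤ arcs h ps
        degree≤ = ≤-trans (≤-reflexive (deg-self h h0 ps≡))
            (≤-trans (m≤m+n (deg h ps₁ y) (arcs h ps₁)) (≤-reflexive (sym (arcs-split h h0 ps≡))))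

        -- R has at most 4n/5 vertices by `tame` and fewer than (6 - i)n/6 by `heavy`, and there are
        -- at least (88 - i)n/88 positions. The worst case is i = 1, where 87/88 - 4/5 > 18/100.
        roomy : 18 * n ≤ 100 * length Q + 100
        roomy = (lin (n ∷ (length Q) ∷ (length R) ∷ (length ps₁) ∷ (length ps) ∷ (length us) ∷ (i * n) ∷
            (arcs h ps) ∷ (deg h ps y) ∷ [])
              (λ n q r p₁ p u x b d → (p₁ :≤ q :+ r) ∷ (p :≤ (con 1 :+ p₁)) ∷ (u :≤ p) ∷ (con 2 :* r :≤ d) ∷
                  (d :≤ b) ∷ (con 3 :* b :+ x :< con 6 :* n) ∷ (con 88 :* n :≤ con 88 :* u :+ x) ∷
                  (con 5 :* d :< con 8 :* n) ∷ [] ⇒ con 18 :* n :≤ con 100 :* q :+ con 100)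
              40 (3960 ∷ 3960 ∷ 3960 ∷ 1980 ∷ 135 ∷ 45 ∷ 45 ∷ 369 ∷ [])
              (≤-reflexive (length-⊆ {ys = Q} ps₁≡) , ≤-reflexive (↭-length ps≡) , ≤-reflexive len , R≤ , degree≤ ,
                  heavy , long , tame y∈ , tt))

        arcs-T′ : 89 * arcs g T′ ≤ n
        arcs-T′ = (lin ((arcs g T′) ∷ (arcs g T) ∷ (deg g T′ x) ∷ (length T) ∷ n ∷ [])
              (λ a a″ d t n → (d :+ a :≤ a″) ∷ ((con 1 :+ a″) :≤ t) ∷ (con 89 :* t :≤ n) ∷ [] ⇒ con 89 :* a :≤ n)
              0 (89 ∷ 89 ∷ 1 ∷ [])
              (≤-reflexive (sym (arcs-split g g0 T≡)) , ≤-reflexive (sym (Tree.size tr)) , short , tt))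

        arcs-Q : arcs h Q ≤ 2 * n
        arcs-Q = (lin ((arcs h Q) ∷ (arcs h R) ∷ (arcs h ps₁) ∷ (arcs h ps) ∷ (deg h ps₁ y) ∷ (i * n) ∷ n ∷ [])
              (λ q r a b d x n → (q :+ r :≤ a) ∷ (d :+ a :≤ b) ∷ (con 3 :* b :+ x :< con 6 :* n) ∷ [] ⇒ q :≤ con 2 :* n)
              2 (3 ∷ 3 ∷ 1 ∷ [])
              (arcs-⊆ h {ys = Q} ps₁≡ , ≤-reflexive (sym (arcs-split h h0 ps≡)) , heavy , tt))

        Q≤n : length Q ≤ n
        Q≤n = (lin (n ∷ (length Q) ∷ (length R) ∷ (length ps₁) ∷ (length ps) ∷ (length us) ∷ [])
              (λ n q r p₁ p u → (q :+ r :≤ p₁) ∷ ((con 1 :+ p₁) :≤ p) ∷ (p :≤ u) ∷ (u :≤ n) ∷ [] ⇒ q :≤ n)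
              0 (1 ∷ 1 ∷ 1 ∷ 1 ∷ [])
              (≤-reflexive (sym (length-⊆ {ys = Q} ps₁≡)) , ≤-reflexive (sym (↭-length ps≡)) ,
                  ≤-reflexive (sym len) , us≤n , tt))

        -- At most (n/89) * 2n against about (18n/100)²: the ratio is near 0.7.
        product : ∀ q → 18 * n ≤ 100 * q + 100 → q ≤ n → arcs g T′ * arcs h Q < q * (q ∸ 1)
        product zero    le _ = ⊥-elim (<⇒≱ n≥ (lin (n ∷ [])
              (λ n → (con 18 :* n :≤ con 100 :* con 0 :+ con 100) ∷ [] ⇒ n :≤ con 2882)
              17 (1 ∷ [])
              (le , tt)))
        product (suc q) le q≤n = (lin (n ∷ q ∷ (arcs g T′ * arcs h Q) ∷ [])
              (λ n q X → (con 89 :* X :≤ n :* (con 2 :* n)) ∷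
                  (con 18 :* n :* (con 18 :* n) :≤ (con 100 :* (con 1 :+ q) :+ con 100) :* (con
                  100 :* (con 1 :+ q) :+ con 100)) ∷ ((con 1 :+ q) :≤ n) ∷ (n :* con 2883 :≤ n :* n) ∷ [] ⇒
                  X :< (con 1 :+ q) :* q)
              79574187 (894092 ∷ 5855 ∷ 313774188 ∷ 108836 ∷ [])
              (mul , *-mono-≤ le le , q≤n , *-monoʳ-≤ n n≥ , tt))
          where
          mul : 89 * (arcs g T′ * arcs h Q) ≤ n * (2 * n)
          mul = ≤-trans (≤-reflexive (sym (*-assoc 89 (arcs g T′) (arcs h Q)))) (*-mono-≤ arcs-T′ arcs-Q)

        whole-at : Next
        whole-at = build (root-at us! us-T tr T≡ ps≡ ps₁≡ ok
            (lin ((length T′) ∷ (length T) ∷ (length Q) ∷ n ∷ [])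
                  (λ t′ t q n → ((con 1 :+ t′) :≤ t) ∷ (con 89 :* t :≤ n) ∷
                      (con 18 :* n :≤ con 100 :* q :+ con 100) ∷ [] ⇒ t′ :≤ q)
                  1601 (1602 ∷ 18 ∷ 1 ∷ [])
                  (≤-reflexive (sym (↭-length T≡)) , short , roomy , tt))
            (inj₂ (product (length Q) roomy Q≤n)))
          where
          build : TreePlaced us ps us′ T y → Next
          build (treePlaced qs ps′ number ps-T pack) = next new pack
            where
            ps-T′ : ps ↭ (y ∷ qs) ++ ps′
            ps-T′ = ps-T
            new : Initial (suc i)
            new = record
              { us = us′ ; ps = ps′ ; trees = trees′ ; other = other
              ; us! = Unique-++ʳ T (Unique-resp-↭ us-T us!) ; ps! = Unique-++ʳ (y ∷ qs) (Unique-resp-↭ ps-T ps!) ;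
                  us≡ = refl
              ; len = (≤-antisym
                  (lin ((length us) ∷ (length T) ∷ (length us′) ∷ (length ps) ∷ (length qs) ∷ (length ps′) ∷ [])
                    (λ u t u′ p q p′ → (t :+ u′ :≤ u) ∷ (p :≤ (con 1 :+ q) :+ p′) ∷ ((con 1 :+ q) :≤ t) ∷ (u :≤ p) ∷
                        [] ⇒ u′ :≤ p′)
                    0 (1 ∷ 1 ∷ 1 ∷ 1 ∷ [])
                    (≤-reflexive (sym (length-⊆ {ys = T} us-T)) , ≤-reflexive (length-⊆ {ys = y ∷ qs} ps-T′) ,
                        ≤-reflexive number , ≤-reflexive len , tt))
                  (lin ((length us) ∷ (length T) ∷ (length us′) ∷ (length ps) ∷ (length qs) ∷ (length ps′) ∷ [])
                    (λ u t u′ p q p′ → (u :≤ t :+ u′) ∷ ((con 1 :+ q) :+ p′ :≤ p) ∷ (t :≤ (con 1 :+ q)) ∷ (p :≤ u) ∷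
                        [] ⇒ p′ :≤ u′)
                    0 (1 ∷ 1 ∷ 1 ∷ 1 ∷ [])
                    (≤-reflexive (length-⊆ {ys = T} us-T) , ≤-reflexive (sym (length-⊆ {ys = y ∷ qs} ps-T′)) ,
                        ≤-reflexive (sym number) , ≤-reflexive (sym len) , tt)))
              ; us≤n = (lin ((length us) ∷ (length T) ∷ (length us′) ∷ n ∷ [])
                    (λ u t u′ n → (t :+ u′ :≤ u) ∷ (u :≤ n) ∷ [] ⇒ u′ :≤ n)
                    0 (1 ∷ 1 ∷ [])
                    (≤-reflexive (sym (length-⊆ {ys = T} us-T)) , us≤n , tt))
              ; are-trees = λ j → are-trees (∈-resp-↭ (↭-sym trees≡) (there j))
              ; count = (lin (i ∷ (length trees) ∷ (length trees′) ∷ [])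
                    (λ i l l′ → (con 93 :≤ i :+ l) ∷ (l :≤ (con 1 :+ l′)) ∷ [] ⇒ con 93 :≤ (con 1 :+ i) :+ l′)
                    0 (1 ∷ 1 ∷ [])
                    (count , ≤-reflexive (↭-length trees≡) , tt))
              ; sparse = (lin ((length us) ∷ (length T) ∷ (length us′) ∷ (arcs g us) ∷ (arcs g T) ∷ (arcs g us′) ∷
                  i ∷ [])
                    (λ u t u′ a a″ a′ i → (u :≤ t :+ u′) ∷ (a″ :+ a′ :≤ a) ∷ (t :≤ (con 1 :+ a″)) ∷
                        (a :+ con 93 :≤ u :+ i) ∷ [] ⇒ a′ :+ con 93 :≤ u′ :+ (con 1 :+ i))
                    0 (1 ∷ 1 ∷ 1 ∷ 1 ∷ [])
                    (≤-reflexive (length-⊆ {ys = T} us-T) , arcs-⊆ g {ys = T} us-T , ≤-reflexive (Tree.size tr) ,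
                        sparse , tt))
              ; few = (lin ((arcs g us) ∷ (arcs g T) ∷ (arcs g us′) ∷ n ∷ [])
                    (λ a a″ a′ n → (a″ :+ a′ :≤ a) ∷ (a :+ con 93 :≤ n) ∷ [] ⇒ a′ :+ con 93 :≤ n)
                    0 (1 ∷ 1 ∷ [])
                    (arcs-⊆ g {ys = T} us-T , few , tt))
              ; heavy = (lin ((arcs h ps) ∷ (deg h ps y) ∷ (deg h (qs ++ ps′) y) ∷ (arcs h (qs ++ ps′)) ∷
                  (arcs h qs) ∷ (arcs h ps′) ∷ (i * n) ∷ n ∷ [])
                    (λ b d d₁ b₁ c b′ x n → (d₁ :+ b₁ :≤ b) ∷ (d :≤ d₁) ∷ (c :+ b′ :≤ b₁) ∷ (n :≤ con 3 :* d) ∷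
                        (con 3 :* b :+ x :< con 6 :* n) ∷ [] ⇒ con 3 :* b′ :+ (n :+ x) :< con 6 :* n)
                    0 (3 ∷ 3 ∷ 3 ∷ 1 ∷ 1 ∷ [])
                    (≤-reflexive (sym (arcs-split h h0 ps-T)) , ≤-reflexive (deg-self h h0 ps-T) ,
                        arcs-++ h qs ps′ , large , heavy , tt))
              ; long = (lin ((length us) ∷ (length T) ∷ (length us′) ∷ (i * n) ∷ n ∷ [])
                    (λ u t u′ x n → (u :≤ t :+ u′) ∷ (con 89 :* t :≤ n) ∷ (con 88 :* n :≤ con 88 :* u :+ x) ∷ [] ⇒
                        con 88 :* n :≤ con 88 :* u′ :+ (n :+ x))
                    7743 (681384 ∷ 7656 ∷ 7743 ∷ [])
                    (≤-reflexive (length-⊆ {ys = T} us-T) , short , long , tt))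
              ; tame = λ {p} p∈ → ≤-<-trans (*-monoʳ-≤ 5 (deg-⊆ h {ys = y ∷ qs} p ps-T′))
                  (tame (∈-resp-↭ (↭-sym ps-T′) (∈-++⁺ʳ (y ∷ qs) p∈)))
              }

      -- A sink at y can collide only along arcs into y, a source only along arcs out of y. The
      -- direction with fewer arcs at y is chosen, so at most half of the degree of y is lost as
      -- positions.
      choose : ∃ (λ ps₁ → ps ↭ y ∷ ps₁) → ∃ (λ trees′ → trees ↭ T ∷ trees′) → Next
      choose (ps₁ , ps≡) (trees′ , trees≡) = go (≤-total (indeg h ps₁ y) (outdeg h ps₁ y))
        where
        go : indeg h ps₁ y ≤ outdeg h ps₁ y ⊎ outdeg h ps₁ y ≤ indeg h ps₁ y → Next
        go (inj₁ le) = sink (Tree-sink g g0 tr)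
          where
          open Filtered (zeros (λ p → h p y) ps₁)
          sink : ∃ (λ x → x ∈ T × outdeg g T x ≡ 0) → Next
          sink (x , x∈ , eq) = go′ (∈⇒↭ x∈)
            where
            go′ : ∃ (λ T′ → T ↭ x ∷ T′) → Next
            go′ (T′ , T≡) = whole-at T≡ ps≡ whole trees≡ (λ t∈ p∈ → cross-out (out-zero T≡ eq t∈) (all-ins p∈))
              (lin ((length outs) ∷ (outdeg h ps₁ y) ∷ (indeg h ps₁ y) ∷ (deg h ps y) ∷ [])
                    (λ r o j d → (r :≤ j) ∷ (j :≤ o) ∷ (o :+ j :≤ d) ∷ [] ⇒ con 2 :* r :≤ d)
                    0 (2 ∷ 1 ∷ 1 ∷ [])
                    (zeros-outs (λ p → h p y) ps₁ , le , ≤-reflexive (sym (deg-self h h0 ps≡)) , tt))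
        go (inj₂ le) = source (Tree-source g g0 tr)
          where
          open Filtered (zeros (h y) ps₁)
          source : ∃ (λ x → x ∈ T × indeg g T x ≡ 0) → Next
          source (x , x∈ , eq) = go′ (∈⇒↭ x∈)
            where
            go′ : ∃ (λ T′ → T ↭ x ∷ T′) → Next
            go′ (T′ , T≡) = whole-at T≡ ps≡ whole trees≡ (λ t∈ p∈ → cross-in (in-zero T≡ eq t∈) (all-ins p∈))
              (lin ((length outs) ∷ (outdeg h ps₁ y) ∷ (indeg h ps₁ y) ∷ (deg h ps y) ∷ [])
                    (λ r o j d → (r :≤ o) ∷ (o :≤ j) ∷ (o :+ j :≤ d) ∷ [] ⇒ con 2 :* r :≤ d)
                    0 (2 ∷ 1 ∷ 1 ∷ [])
                    (zeros-outs (h y) ps₁ , le , ≤-reflexive (sym (deg-self h h0 ps≡)) , tt))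

    step : Next
    step = go (smallest trees (≤-trans (s≤s z≤n) many))
      where
      go : ∃ (λ T → T ∈ trees × length T * length trees ≤ length (concat trees)) → Next
      go (T , T∈ , size) = choose T∈ size (∈⇒↭ y∈) (∈⇒↭ T∈)

  -- `heavy` rules out six whole trees, so at most five are placed. Then all out- and indegrees of h
  -- are below n/3 and the placing of leaves begins, with the present arcs of h as budget.
  packs-initial : ∀ j (st : Initial i) → i + j ≡ 6 → Packs (Initial.us st) (Initial.ps st) none
  packs-initial {i} zero st eq = ⊥-elim (<⇒≱ heavy (≤-trans
      (≤-reflexive (cong (_* n) (≡.trans (sym eq) (+-identityʳ i)))) (m≤n+m (i * n) (3 * arcs h ps))))
    where open Initial st
  packs-initial {i} (suc j) st eq = first (search (λ p → n ≤? 3 * outdeg h ps p) ps)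
    where
    open Initial st
    large-at : ∀ {y} → y ∈ ps → n ≤ 3 * deg h ps y → n ≤ 3 * arcs h ps → Packs us ps none
    large-at y∈ le le′ = go (At.step st y∈ le le′)
      where
      go : At.Next st y∈ le le′ → Packs us ps none
      go (At.next st′ pack) = pack (packs-initial j st′ (≡.trans (sym (+-suc i j)) eq))
    first : (∃ λ p → p ∈ ps × n ≤ 3 * outdeg h ps p) ⊎ (∀ {p} → p ∈ ps → ¬ n ≤ 3 * outdeg h ps p) → Packs us ps none
    first (inj₁ (y , y∈ , le)) = large-at y∈ (≤-trans le (*-monoʳ-≤ 3 (m≤m+n (outdeg h ps y) (indeg h ps y))))
        (≤-trans le (*-monoʳ-≤ 3 (outdeg≤arcs h y∈)))
    first (inj₂ out-small) = second (search (λ p → n ≤? 3 * indeg h ps p) ps)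
      where
      second : (∃ λ p → p ∈ ps × n ≤ 3 * indeg h ps p) ⊎ (∀ {p} → p ∈ ps → ¬ n ≤ 3 * indeg h ps p) → Packs us ps none
      second (inj₁ (y , y∈ , le)) = large-at y∈ (≤-trans le (*-monoʳ-≤ 3 (m≤n+m (indeg h ps y) (outdeg h ps y))))
          (≤-trans le (*-monoʳ-≤ 3 (indeg≤arcs h y∈)))
      second (inj₂ in-small) = packs-state
          (lin ((length us) ∷ (i * n) ∷ n ∷ i ∷ [])
                (λ N x n i → (con 88 :* n :≤ con 88 :* N :+ x) ∷ (x :≤ con 5 :* n) ∷ [] ⇒
                    con 88 :* n :≤ con 88 :* (N :+ i) :+ con 5 :* n)
                0 (1 ∷ 1 ∷ [])
                (long , i≤5′ , tt))
          (lin ((length us) ∷ (i * n) ∷ n ∷ i ∷ (arcs h ps) ∷ [])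
                (λ N x n i b → (con 88 :* n :≤ con 88 :* N :+ x) ∷ (con 3 :* b :+ x :< con 6 :* n) ∷ [] ⇒
                    b :≤ con 2 :* (N :+ i))
                131 (3 ∷ 44 ∷ [])
                (long , heavy , tt))
          start (50 ∸ i) (m+[n∸m]≡n (≤-trans i≤5 (m≤m+n 5 45)))
          (lin ((i * n) ∷ n ∷ (arcs h ps) ∷ [])
                (λ x n b → (con 3 :* b :+ x :< con 6 :* n) ∷ [] ⇒ con 25 :* b :+ x :< con 50 :* n)
                2 (25 ∷ [])
                (heavy , tt))
        where
        i≤5 : i ≤ 5
        i≤5 = (lin (i ∷ j ∷ [])
              (λ i j → (i :+ (con 1 :+ j) :≤ con 6) ∷ [] ⇒ i :≤ con 5)
              0 (1 ∷ [])
              (≤-reflexive eq , tt))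
        i≤5′ : i * n ≤ 5 * n
        i≤5′ = *-monoˡ-≤ n i≤5
        0s : ∀ (xs : List V) → (∑[ _ ∈ xs ] 0) ≤ 0
        0s xs = ≤-reflexive (∑-0 xs)
        start : State (∑ ps (deg h ps)) (arcs h ps) (length us + i) i
        start = record
          { us = us ; ps = ps ; S = none ; trees = trees ; other = other ; us! = us! ; ps! = ps! ; us≡ = us≡ ; len =
              len ; us≤n = us≤n
          ; are-trees = are-trees ; count = count ; sparse = sparse
          ; half⁺ = λ p∈ → <⇒≤ (≰⇒> (out-small p∈)) ; half⁻ = λ p∈ → <⇒≤ (≰⇒> (in-small p∈))
          ; rows = λ _ → ≤-trans (*-monoʳ-≤ 3 (0s ps)) z≤n
          ; cols = λ _ → ≤-trans (0s us) z≤n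
          ; small = λ () ; fresh = λ _ _ → ≡.refl
          ; budget = ≤-reflexive (≡.trans (cong (arcs h ps +_) (≡.trans (∑-cong us (λ _ → ∑-0 ps)) (∑-0 us)))
              (+-identityʳ _))
          ; total = ≡.refl ; few = few ; low = λ p∈ → ∑-∈ (deg h ps) p∈ }

  -- At most 2n/5 arcs avoid y, so once a tree with at most n/93 vertices has taken y, a random
  -- bijection of the rest has fewer than 1/2 collisions on average. The exact bound 2n - q decides
  -- in the cases where y dominates all vertices or is dominated by all.
  module Dominant {all : List V} (all! : Unique all) (length-all : length all ≡ n) (few : arcs g all + 93 ≤ n)
    {q T us′} (all≡ : all ↭ T ++ us′) (tr : Tree g g0 T) (T≤q : length T ≤ q) (T≤ : 93 * length T ≤ n)
    (sizes : arcs h all + q < 2 * n) {y} (large : 8 * n ≤ 5 * deg h all y) {ps₁} (ps≡ : all ↭ y ∷ ps₁) where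

    private
      out in′ ρ b : ℕ
      out = outdeg h ps₁ y
      in′ = indeg h ps₁ y
      ρ   = arcs h ps₁
      b   = arcs h all

      b≡ : b ≡ out + in′ + ρ
      b≡ = arcs-split h h0 ps≡

      d≡ : deg h all y ≡ out + in′
      d≡ = deg-self h h0 ps≡

      n≡ : n ≡ suc (length ps₁)
      n≡ = ≡.trans (sym length-all) (↭-length ps≡)

      Goal : Set
      Goal = TreePlaced all all us′ T y

      independent : ∀ Q → (∀ {p} → p ∈ Q → p ∈ ps₁) → (∀ {p} → p ∈ Q → indeg h ps₁ p ≡ 0) → arcs h Q ≡ 0
      independent Q sub eq = ∑-zero-∈ Q (λ p∈ → ∑-zero-∈ Q (λ {r} r∈ → ∑≡0⇒∈ (λ p → h p r) (eq r∈) (sub p∈)))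

      sub-ins : ∀ {P : V → Set} {xs} (F : Filtered P xs) → ∀ {p} → p ∈ Filtered.ins F → p ∈ xs
      sub-ins F p∈ = ∈-resp-↭ (↭-sym (Filtered.whole F)) (∈-++⁺ˡ p∈)

      none-out : ∀ (F : Filtered (λ p → h y p ≡ 0) ps₁) → length (Filtered.ins F) ≡ 0 → length ps₁ ≤ out
      none-out F eq = (lin ((length ps₁) ∷ (length ins) ∷ (length outs) ∷ (∑[ _ ∈ outs ] 1) ∷ (∑ outs (h y)) ∷
          (∑ ins (h y)) ∷ (∑ (ins ++ outs) (h y)) ∷ (outdeg h ps₁ y) ∷ [])
            (λ l i o c s s′ s″ d → (l :≤ i :+ o) ∷ (i :≤ con 0) ∷ (o :* con 1 :≤ c) ∷ (c :≤ s) ∷ (s″ :≤ d) ∷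
                (s′ :+ s :≤ s″) ∷ [] ⇒ l :≤ d)
            0 (1 ∷ 1 ∷ 1 ∷ 1 ∷ 1 ∷ 1 ∷ [])
            (≤-reflexive (length-⊆ {ys = ins} whole) , ≤-reflexive eq , ≤-reflexive (sym (∑-const outs 1)) ,
                ∑-mono-∈ outs (λ j → n≢0⇒n>0 (all-outs j)) , ≤-reflexive (sym (∑-↭ (h y) whole)) ,
                ≤-reflexive (sym (∑-++ ins outs (h y))) , tt))
        where open Filtered F

      none-in : ∀ (F : Filtered (λ p → h p y ≡ 0) ps₁) → length (Filtered.ins F) ≡ 0 → length ps₁ ≤ in′
      none-in F eq = (lin ((length ps₁) ∷ (length ins) ∷ (length outs) ∷ (∑[ _ ∈ outs ] 1) ∷
          (∑ outs (λ p → h p y)) ∷ (∑ ins (λ p → h p y)) ∷ (∑ (ins ++ outs) (λ p → h p y)) ∷ (indeg h ps₁ y) ∷ [])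
            (λ l i o c s s′ s″ d → (l :≤ i :+ o) ∷ (i :≤ con 0) ∷ (o :* con 1 :≤ c) ∷ (c :≤ s) ∷ (s″ :≤ d) ∷
                (s′ :+ s :≤ s″) ∷ [] ⇒ l :≤ d)
            0 (1 ∷ 1 ∷ 1 ∷ 1 ∷ 1 ∷ 1 ∷ [])
            (≤-reflexive (length-⊆ {ys = ins} whole) , ≤-reflexive eq , ≤-reflexive (sym (∑-const outs 1)) ,
                ∑-mono-∈ outs (λ j → n≢0⇒n>0 (all-outs j)) , ≤-reflexive (sym (∑-↭ (λ p → h p y) whole)) ,
                ≤-reflexive (sym (∑-++ ins outs (λ p → h p y))) , tt))
        where open Filtered F

      -- If y dominates all vertices then a sink goes to y and the rest of the tree to
      -- vertices without arcs to y or from other vertices: there are at least q - 1 of them.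
      dominating : length ps₁ ≤ out → Goal
      dominating le = sink (Tree-sink g g0 tr)
        where
        F = zeros (λ p → h p y + indeg h ps₁ p) ps₁
        open Filtered F
        sink : ∃ (λ x → x ∈ T × outdeg g T x ≡ 0) → Goal
        sink (x , x∈ , eq) = go (∈⇒↭ x∈)
          where
          go : ∃ (λ T′ → T ↭ x ∷ T′) → Goal
          go (T′ , T≡) = root-at {Q = ins} all! all≡ tr T≡ ps≡ whole (λ t∈ p∈ →
              cross-out (out-zero T≡ eq t∈) (m+n≡0⇒m≡0 _ (all-ins p∈)))
            (lin ((length T) ∷ (length T′) ∷ (length ins) ∷ (length outs) ∷ (length ps₁) ∷
                (∑[ p ∈ ps₁ ] h p y + indeg h ps₁ p) ∷ in′ ∷ out ∷ ρ ∷ (∑ ps₁ (indeg h ps₁)) ∷ b ∷ q ∷ n ∷ [])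
                  (λ t t′ Q r l s i o ρ j b q n → ((con 1 :+ t′) :≤ t) ∷ (t :≤ q) ∷ (l :≤ Q :+ r) ∷ (r :≤ s) ∷
                      (s :≤ i :+ j) ∷ (j :≤ ρ) ∷ (o :+ i :+ ρ :≤ b) ∷ (l :≤ o) ∷ (b :+ q :< con 2 :* n) ∷
                      (n :≤ (con 1 :+ l)) ∷ [] ⇒ t′ :≤ Q)
                  0 (1 ∷ 1 ∷ 1 ∷ 1 ∷ 1 ∷ 1 ∷ 1 ∷ 1 ∷ 1 ∷ 2 ∷ [])
                  (≤-reflexive (sym (↭-length T≡)) , T≤q , ≤-reflexive (length-⊆ {ys = ins} whole) ,
                      zeros-outs (λ p → h p y + indeg h ps₁ p) ps₁ ,
                      ≤-reflexive (∑-+ ps₁ (λ p → h p y) (indeg h ps₁)) , ≤-reflexive (∑-indeg h ps₁) ,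
                      ≤-reflexive (sym b≡) , le , sizes , ≤-reflexive n≡ , tt))
            (inj₁ (≡.trans (cong (arcs g T′ *_) (independent ins (sub-ins F) (λ {p} p∈ →
                m+n≡0⇒n≡0 (h p y) (all-ins p∈)))) (*-zeroʳ (arcs g T′))))

      -- The mirror image of `dominating`, except that `ins` is again made independent through
      -- indegree 0, which serves for either direction at y.
      dominated : length ps₁ ≤ in′ → Goal
      dominated le = source (Tree-source g g0 tr)
        where
        F = zeros (λ p → h y p + indeg h ps₁ p) ps₁
        open Filtered F
        source : ∃ (λ x → x ∈ T × indeg g T x ≡ 0) → Goal
        source (x , x∈ , eq) = go (∈⇒↭ x∈)
          where
          go : ∃ (λ T′ → T ↭ x ∷ T′) → Goal
          go (T′ , T≡) = root-at {Q = ins} all! all≡ tr T≡ ps≡ whole (λ t∈ p∈ →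
              cross-in (in-zero T≡ eq t∈) (m+n≡0⇒m≡0 _ (all-ins p∈)))
            (lin ((length T) ∷ (length T′) ∷ (length ins) ∷ (length outs) ∷ (length ps₁) ∷
                (∑[ p ∈ ps₁ ] h y p + indeg h ps₁ p) ∷ in′ ∷ out ∷ ρ ∷ (∑ ps₁ (indeg h ps₁)) ∷ b ∷ q ∷ n ∷ [])
                  (λ t t′ Q r l s i o ρ j b q n → ((con 1 :+ t′) :≤ t) ∷ (t :≤ q) ∷ (l :≤ Q :+ r) ∷ (r :≤ s) ∷
                      (s :≤ o :+ j) ∷ (j :≤ ρ) ∷ (o :+ i :+ ρ :≤ b) ∷ (l :≤ i) ∷ (b :+ q :< con 2 :* n) ∷
                      (n :≤ (con 1 :+ l)) ∷ [] ⇒ t′ :≤ Q)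
                  0 (1 ∷ 1 ∷ 1 ∷ 1 ∷ 1 ∷ 1 ∷ 1 ∷ 1 ∷ 1 ∷ 2 ∷ [])
                  (≤-reflexive (sym (↭-length T≡)) , T≤q , ≤-reflexive (length-⊆ {ys = ins} whole) ,
                      zeros-outs (λ p → h y p + indeg h ps₁ p) ps₁ , ≤-reflexive (∑-+ ps₁ (h y) (indeg h ps₁)) ,
                      ≤-reflexive (∑-indeg h ps₁) , ≤-reflexive (sym b≡) , le , sizes , ≤-reflexive n≡ , tt))
            (inj₁ (≡.trans (cong (arcs g T′ *_) (independent ins (sub-ins F) (λ {p} p∈ →
                m+n≡0⇒n≡0 (h y p) (all-ins p∈)))) (*-zeroʳ (arcs g T′))))

      few-arcs : 5 * ρ ≤ 2 * n
      few-arcs = (lin (ρ ∷ n ∷ (deg h all y) ∷ out ∷ in′ ∷ b ∷ q ∷ [])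
            (λ ρ n d o i b q → (con 8 :* n :≤ con 5 :* d) ∷ (d :≤ o :+ i) ∷ (o :+ i :+ ρ :≤ b) ∷
                (b :+ q :< con 2 :* n) ∷ [] ⇒ con 5 :* ρ :≤ con 2 :* n)
            0 (1 ∷ 5 ∷ 5 ∷ 5 ∷ [])
            (large , ≤-reflexive d≡ , ≤-reflexive (sym b≡) , sizes , tt))

      -- Otherwise a leaf goes to y, its neighbour to a vertex p not joined to y in the relevant direction, and the rest to isolated vertices.
      leaf : (∃ λ p → p ∈ ps₁ × h y p ≡ 0) → (∃ λ p → p ∈ ps₁ × h p y ≡ 0) → Goal
      leaf (p⁺ , p⁺∈ , eq⁺) (p⁻ , p⁻∈ , eq⁻) = go (Tree-leaf g g0 tr)
        where
        go : ∃ (λ x → x ∈ T × deg g T x ≤ 1) → Goal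
        go (x , x∈ , le) = go′ (∈⇒↭ x∈)
          where
          go′ : ∃ (λ T′ → T ↭ x ∷ T′) → Goal
          go′ (T′ , T≡) = neighbour (search (λ z → 1 ≤? adjacency g g0 x z) T′)
            where
            adj-T′ : (∑[ z ∈ T′ ] adjacency g g0 x z) ≤ 1
            adj-T′ = ≤-trans (≤-reflexive (∑-+ T′ (g x) (λ z → g z x))) (≤-trans (deg-tail g x T≡) le)
            neighbour : (∃ λ z → z ∈ T′ × 1 ≤ adjacency g g0 x z) ⊎ (∀ {z} → z ∈ T′ → ¬ 1 ≤ adjacency g g0 x z) → Goal
            neighbour (inj₂ free) = root-at {Q = ins} all! all≡ tr T≡ ps≡ whole
              (λ {t} {p} t∈ _ → cong₂ _+_ (cong (_* h y p) (m+n≡0⇒m≡0 (g x t) (zero-adj t∈)))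
                  (cong (_* h p y) (m+n≡0⇒n≡0 (g x t) (zero-adj t∈))))
              (lin ((length T) ∷ (length T′) ∷ (length ins) ∷ (length outs) ∷ (length ps₁) ∷ (∑ ps₁ (deg h ps₁)) ∷
                  ρ ∷ n ∷ [])
                    (λ t t′ Q r l s ρ n → ((con 1 :+ t′) :≤ t) ∷ (con 93 :* t :≤ n) ∷ (l :≤ Q :+ r) ∷ (r :≤ s) ∷
                        (s :≤ con 2 :* ρ) ∷ (con 5 :* ρ :≤ con 2 :* n) ∷ (n :≤ (con 1 :+ l)) ∷ [] ⇒ t′ :≤ Q)
                    92 (93 ∷ 1 ∷ 5 ∷ 5 ∷ 5 ∷ 2 ∷ 5 ∷ [])
                    (≤-reflexive (sym (↭-length T≡)) , T≤ , ≤-reflexive (length-⊆ {ys = ins} whole) ,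
                        zeros-outs (deg h ps₁) ps₁ , ≤-reflexive (∑-deg h ps₁) , few-arcs , ≤-reflexive n≡ , tt))
              (inj₁ (≡.trans (cong (arcs g T′ *_) (independent ins (sub-ins F) (λ {p} p∈ →
                  m+n≡0⇒n≡0 (outdeg h ps₁ p) (all-ins p∈)))) (*-zeroʳ (arcs g T′))))
              where
              -- At most 2ρ ≤ 4n/5 vertices of `ps₁` meet an arc that avoids y, so about n/5
              -- isolated ones remain for the fewer than n/93 vertices of T′.
              F = zeros (deg h ps₁) ps₁
              open Filtered F
              zero-adj : ∀ {t} → t ∈ T′ → adjacency g g0 x t ≡ 0
              zero-adj t∈ = n≤0⇒n≡0 (s≤s⁻¹ (≰⇒> (free t∈)))
            neighbour (inj₁ (z , z∈ , pos)) = orient (g x z) ≡.refl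
              where
              at : ∀ p → p ∈ ps₁ → cross (x , y) (z , p) ≡ 0 → Goal
              at p p∈ xz = at′ (∈⇒↭ z∈) (∈⇒↭ p∈)
                where
                at′ : ∃ (λ T″ → T′ ↭ z ∷ T″) → ∃ (λ ps₂ → ps₁ ↭ p ∷ ps₂) → Goal
                at′ (T″ , T′≡) (ps₂ , ps₁≡) = found (random T″ ins
                    (lin ((length T) ∷ (length T′) ∷ (length T″) ∷ (length ins) ∷ (length outs) ∷ (length ps₁) ∷
                        (length ps₂) ∷ (∑ ps₁ (deg h ps₁)) ∷ (∑ ps₂ (deg h ps₁)) ∷ ρ ∷ n ∷ [])
                          (λ t t′ t″ Q r l l₂ s s₂ ρ n → ((con 1 :+ t′) :≤ t) ∷ ((con 1 :+ t″) :≤ t′) ∷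
                              (con 93 :* t :≤ n) ∷ (l₂ :≤ Q :+ r) ∷ (r :≤ s₂) ∷ (s₂ :≤ s) ∷ (s :≤ con 2 :* ρ) ∷
                              (con 5 :* ρ :≤ con 2 :* n) ∷ (n :≤ (con 1 :+ l)) ∷ (l :≤ (con 1 :+ l₂)) ∷ [] ⇒ t″ :≤ Q)
                          92 (93 ∷ 93 ∷ 1 ∷ 5 ∷ 5 ∷ 5 ∷ 5 ∷ 2 ∷ 5 ∷ 5 ∷ [])
                          (≤-reflexive (sym (↭-length T≡)) , ≤-reflexive (sym (↭-length T′≡)) , T≤ ,
                              ≤-reflexive (length-⊆ {ys = ins} whole) , zeros-outs (deg h ps₁) ps₂ ,
                              ∑-tail (deg h ps₁) ps₁≡ , ≤-reflexive (∑-deg h ps₁) , few-arcs , ≤-reflexive n≡ ,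
                              ≤-reflexive (↭-length ps₁≡) , tt))
                    (inj₁ (≡.trans (cong (arcs g T″ *_) (independent ins in-ps₁ (λ {r} r∈ →
                        m+n≡0⇒n≡0 (outdeg h ps₁ r) (all-ins r∈)))) (*-zeroʳ (arcs g T″)))))
                  where
                  F = zeros (deg h ps₁) ps₂
                  open Filtered F
                  in-ps₁ : ∀ {r} → r ∈ ins → r ∈ ps₁
                  in-ps₁ r∈ = ∈-resp-↭ (↭-sym ps₁≡) (there (sub-ins F r∈))
                  found : ∃ (λ al → Injects T″ ins al × Collision-free al) → Goal
                  found (al , injects rest eq seconds , free) = treePlaced (p ∷ map proj₂ al) (rest ++ outs)
                    (≡.trans (cong (λ l → suc (suc l)) (≡.trans (length-map proj₂ al)
                        (≡.trans (sym (length-map proj₁ al)) (cong length eq))))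
                        (sym (≡.trans (↭-length T≡) (cong suc (↭-length T′≡)))))
                    ps-T (place-tree {al = new} all! all≡ tr (↭-trans (prep x (prep z (↭-reflexive eq)))
                        (↭-sym (↭-trans T≡ (prep x T′≡)))) ps-T clean)
                    where
                    new = (x , y) ∷ (z , p) ∷ al
                    ps-T : all ↭ y ∷ p ∷ map proj₂ al ++ rest ++ outs
                    ps-T = ↭-trans ps≡ (prep y (↭-trans ps₁≡ (prep p
                        (↭-trans whole (↭-trans (++⁺ʳ outs seconds)
                        (↭-reflexive (++-assoc (map proj₂ al) rest outs)))))))
                    first∈ : ∀ {e} → e ∈ al → proj₁ e ∈ T″
                    first∈ j = subst (_ ∈_) eq (∈-map⁺ proj₁ j)
                    second∈ : ∀ {e} → e ∈ al → proj₂ e ∈ ins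
                    second∈ j = ∈-resp-↭ (↭-sym seconds) (∈-++⁺ˡ (∈-map⁺ proj₂ j))
                    off₁ : ∀ {e} → e ∈ al → adjacency g g0 x (proj₁ e) ≡ 0
                    off₁ {e} j = n≤0⇒n≡0 (lin ((∑ T′ (adjacency g g0 x)) ∷ (adjacency g g0 x z) ∷
                        (∑ T″ (adjacency g g0 x)) ∷ (adjacency g g0 x (proj₁ e)) ∷ [])
                          (λ s a s″ w → (s :≤ con 1) ∷ (a :+ s″ :≤ s) ∷ (con 1 :≤ a) ∷ (w :≤ s″) ∷ [] ⇒ w :≤ con 0)
                          0 (1 ∷ 1 ∷ 1 ∷ 1 ∷ [])
                          (adj-T′ , ≤-reflexive (sym (∑-↭ (adjacency g g0 x) T′≡)) , pos ,
                              ∑-∈ (adjacency g g0 x) (first∈ j) , tt))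
                    cross₁ : ∀ {e} → e ∈ al → cross (x , y) e ≡ 0
                    cross₁ {t , r} j = cong₂ _+_ (cong (_* h y r) (m+n≡0⇒m≡0 (g x t) (off₁ j)))
                        (cong (_* h r y) (m+n≡0⇒n≡0 (g x t) (off₁ j)))
                    cross₂ : ∀ {e} → e ∈ al → cross (z , p) e ≡ 0
                    cross₂ {t , r} j = cong₂ _+_
                      (≡.trans (cong (g z t *_) (∑≡0⇒∈ (λ w → h w r)
                          (m+n≡0⇒n≡0 (outdeg h ps₁ r) (all-ins (second∈ j))) p∈)) (*-zeroʳ (g z t)))
                      (≡.trans (cong (g t z *_) (∑≡0⇒∈ (h r) (m+n≡0⇒m≡0 (outdeg h ps₁ r) (all-ins (second∈ j))) p∈))
                          (*-zeroʳ (g t z)))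
                    clean : Collision-free new
                    clean (here ≡.refl) (here ≡.refl) = cong (_* h y y) (g0 x)
                    clean (here ≡.refl) (there (here ≡.refl)) = m+n≡0⇒m≡0 _ xz
                    clean (here ≡.refl) (there (there j)) = m+n≡0⇒m≡0 _ (cross₁ j)
                    clean (there (here ≡.refl)) (here ≡.refl) = m+n≡0⇒n≡0 (gh (x , y) (z , p)) xz
                    clean (there (here ≡.refl)) (there (here ≡.refl)) = cong (_* h p p) (g0 z)
                    clean (there (here ≡.refl)) (there (there j)) = m+n≡0⇒m≡0 _ (cross₂ j)
                    clean {e} (there (there j)) (here ≡.refl) = m+n≡0⇒n≡0 (gh (x , y) e) (cross₁ j)
                    clean {e} (there (there j)) (there (here ≡.refl)) = m+n≡0⇒n≡0 (gh (z , p) e) (cross₂ j)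
                    clean (there (there j)) (there (there k)) = free j k
              total≤1 : g x z + g z x ≤ 1
              total≤1 = ≤-trans (∑-∈ (adjacency g g0 x) z∈) adj-T′
              -- A single arc joins x and z. If it enters x, z goes to p⁻, which has no arc to y; if
              -- it leaves x, z goes to p⁺, to which y has no arc.
              orient : ∀ a → g x z ≡ a → Goal
              orient zero    eq = at p⁻ p⁻∈ (cross-out eq eq⁻)
              orient (suc a) eq = at p⁺ p⁺∈ (cross-in (n≤0⇒n≡0 (lin (a ∷ (g x z) ∷ (g z x) ∷ [])
                    (λ a v w → (v :+ w :≤ con 1) ∷ ((con 1 :+ a) :≤ v) ∷ [] ⇒ w :≤ con 0)
                    0 (1 ∷ 1 ∷ [])
                    (total≤1 , ≤-reflexive (sym eq) , tt))) eq⁺)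

      place-T : Goal
      place-T = go (zeros (h y) ps₁) (zeros (λ p → h p y) ps₁)
        where
        go : Filtered (λ p → h y p ≡ 0) ps₁ → Filtered (λ p → h p y ≡ 0) ps₁ → Goal
        go F@(filtered [] _ _ _ _) _ = dominating (none-out F ≡.refl)
        go (filtered (_ ∷ _) _ _ _ _) F@(filtered [] _ _ _ _) = dominated (none-in F ≡.refl)
        go F@(filtered (p ∷ _) _ _ a _) F′@(filtered (p′ ∷ _) _ _ a′ _) =
          leaf (p , sub-ins F (here ≡.refl) , a (here ≡.refl)) (p′ , sub-ins F′ (here ≡.refl) , a′ (here ≡.refl))

    packs-dominant : Packs all all none
    packs-dominant = go place-T
      where
      go : Goal → Packs all all none
      go (treePlaced qs ps′ number ps-T pack) = pack (pack-rest us′ ps′ same (product (length ps′) big ps′≤n))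
        where
        same : length us′ ≡ length ps′
        same = (≤-antisym
            (lin ((length all) ∷ (length T) ∷ (length us′) ∷ (length qs) ∷ (length ps′) ∷ [])
              (λ l t u′ k p′ → (t :+ u′ :≤ l) ∷ (l :≤ (con 1 :+ k) :+ p′) ∷ ((con 1 :+ k) :≤ t) ∷ [] ⇒ u′ :≤ p′)
              0 (1 ∷ 1 ∷ 1 ∷ [])
              (≤-reflexive (sym (length-⊆ {ys = T} all≡)) , ≤-reflexive (length-⊆ {ys = y ∷ qs} ps-T) ,
                  ≤-reflexive number , tt))
            (lin ((length all) ∷ (length T) ∷ (length us′) ∷ (length qs) ∷ (length ps′) ∷ [])
              (λ l t u′ k p′ → (l :≤ t :+ u′) ∷ ((con 1 :+ k) :+ p′ :≤ l) ∷ (t :≤ (con 1 :+ k)) ∷ [] ⇒ p′ :≤ u′)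
              0 (1 ∷ 1 ∷ 1 ∷ [])
              (≤-reflexive (length-⊆ {ys = T} all≡) , ≤-reflexive (sym (length-⊆ {ys = y ∷ qs} ps-T)) ,
                  ≤-reflexive (sym number) , tt)))
        big : 92 * n ≤ 93 * length ps′
        big = (lin ((length all) ∷ (length T) ∷ n ∷ (length qs) ∷ (length ps′) ∷ [])
              (λ l t n k p′ → (n :≤ l) ∷ (l :≤ (con 1 :+ k) :+ p′) ∷ ((con 1 :+ k) :≤ t) ∷ (con 93 :* t :≤ n) ∷ [] ⇒
                  con 92 :* n :≤ con 93 :* p′)
              0 (93 ∷ 93 ∷ 93 ∷ 1 ∷ [])
              (≤-reflexive (sym length-all) , ≤-reflexive (length-⊆ {ys = y ∷ qs} ps-T) , ≤-reflexive number , T≤ , tt))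
        ps′≤n : length ps′ ≤ n
        ps′≤n = (lin ((length all) ∷ n ∷ (length qs) ∷ (length ps′) ∷ [])
              (λ l n k p′ → (l :≤ n) ∷ ((con 1 :+ k) :+ p′ :≤ l) ∷ [] ⇒ p′ :≤ n)
              0 (1 ∷ 1 ∷ [])
              (≤-reflexive length-all , ≤-reflexive (sym (length-⊆ {ys = y ∷ qs} ps-T)) , tt))
        arcs-ps′ : arcs h ps′ ≤ ρ
        arcs-ps′ = (lin (b ∷ (deg h all y) ∷ (deg h (qs ++ ps′) y) ∷ (arcs h (qs ++ ps′)) ∷ (arcs h qs) ∷
            (arcs h ps′) ∷ ρ ∷ out ∷ in′ ∷ [])
              (λ b d d₁ b₁ c b′ ρ o i → (d₁ :+ b₁ :≤ b) ∷ (d :≤ d₁) ∷ (o :+ i :≤ d) ∷ (b :≤ o :+ i :+ ρ) ∷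
                  (c :+ b′ :≤ b₁) ∷ [] ⇒ b′ :≤ ρ)
              0 (1 ∷ 1 ∷ 1 ∷ 1 ∷ 1 ∷ [])
              (≤-reflexive (sym (arcs-split h h0 ps-T)) , ≤-reflexive (deg-self h h0 ps-T) , ≤-reflexive (sym d≡) ,
                  ≤-reflexive b≡ , arcs-++ h qs ps′ , tt))
        arcs-us′ : arcs g us′ ≤ n
        arcs-us′ = (lin ((arcs g all) ∷ (arcs g T) ∷ (arcs g us′) ∷ n ∷ [])
              (λ a t u n → (t :+ u :≤ a) ∷ (a :+ con 93 :≤ n) ∷ [] ⇒ u :≤ n)
              0 (1 ∷ 1 ∷ [])
              (arcs-⊆ g {ys = T} all≡ , few , tt))
        product : ∀ k → 92 * n ≤ 93 * k → k ≤ n → arcs g us′ * arcs h ps′ < k * (k ∸ 1)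
        product zero    le _ = ⊥-elim (<⇒≱ n≥ (lin (n ∷ [])
              (λ n → (con 92 :* n :≤ con 93 :* con 0) ∷ [] ⇒ n :≤ con 2882)
              91 (1 ∷ [])
              (le , tt)))
        product (suc k) le k≤n = (lin (n ∷ k ∷ (arcs g us′ * arcs h ps′) ∷ [])
              (λ n k X → (con 5 :* X :≤ n :* (con 2 :* n)) ∷
                  (con 92 :* n :* (con 92 :* n) :≤ con 93 :* (con 1 :+ k) :* (con 93 :* (con 1 :+ k))) ∷
                  ((con 1 :+ k) :≤ n) ∷ (n :* con 2883 :≤ n :* n) ∷ [] ⇒ X :< (con 1 :+ k) :* k)
              121965314 (24393063 ∷ 5771 ∷ 171878694 ∷ 59618 ∷ [])
              (mul , *-mono-≤ le le , k≤n , *-monoʳ-≤ n n≥ , tt))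
          where
          mul : 5 * (arcs g us′ * arcs h ps′) ≤ n * (2 * n)
          mul = ≤-trans (≤-reflexive (≤-antisym
              (lin ((arcs g us′) ∷ (arcs h ps′) ∷ [])
                (λ u p → [] ⇒ con 5 :* (u :* p) :≤ u :* (con 5 :* p))
                0 []
                tt)
              (lin ((arcs g us′) ∷ (arcs h ps′) ∷ [])
                (λ u p → [] ⇒ u :* (con 5 :* p) :≤ con 5 :* (u :* p))
                0 []
                tt)))
            (*-mono-≤ arcs-us′ (≤-trans (*-monoʳ-≤ 5 arcs-ps′) few-arcs))

-- Digraphs and their weight functions

sum-map : ∀ {A : Set} (f : A → ℕ) xs → sum (map f xs) ≡ ∑ xs f
sum-map f []       = ≡.refl
sum-map f (x ∷ xs) = cong (f x +_) (sum-map f xs)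

weight : ∀ {n} → Digraph n → Fin n → Fin n → ℕ
weight D u v = if arc D u v then 1 else 0

weight≤1 : ∀ {n} (D : Digraph n) u v → weight D u v ≤ 1
weight≤1 D u v with arc D u v
... | true  = ≤-refl
... | false = z≤n

weight-loop : ∀ {n} (D : Digraph n) u → weight D u u ≡ 0
weight-loop D u = cong (λ b → if b then 1 else 0) (loopless D u)

arcCount≡ : ∀ {n} (D : Digraph n) → arcCount D ≡ arcs (weight D) (allFin n)
arcCount≡ {n} D = ≡.trans (sum-map _ (allFin n)) (∑-cong (allFin n) (λ u → sum-map (weight D u) (allFin n)))

unique-image : ∀ {A B : Set} (f : A → B) {xs x y} → Unique (map f xs) → x ∈ xs → y ∈ xs → f x ≡ f y → x ≡ y
unique-image f _       (here ≡.refl) (here ≡.refl) _  = ≡.refl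
unique-image f u       (here ≡.refl) (there j)     eq = ⊥-elim (Unique-∉ u (∈-map⁺ f j) eq)
unique-image f u       (there i)     (here ≡.refl) eq = ⊥-elim (Unique-∉ u (∈-map⁺ f i) (sym eq))
unique-image f (_ ∷ u) (there i)     (there j)     eq = unique-image f u i j eq

Packs⇒Pack : ∀ {n} (D D′ : Digraph n) {S} → Packing.Packs (weight D) (weight D′) (allFin n) (allFin n) S → Pack D D′
Packs⇒Pack {n} D D′ (Packing.packs al firsts seconds _ clean) = f , injective , collision
  where
  entry : ∀ u → ∃ λ e → e ∈ al × u ≡ proj₁ e
  entry u = ∈-map⁻ proj₁ (∈-resp-↭ (↭-sym firsts) (∈-allFin u))
  f : Fin n → Fin n
  f u = proj₂ (proj₁ (entry u))
  injective : ∀ {u v} → f u ≡ f v → u ≡ v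
  injective {u} {v} eq = go (entry u) (entry v) eq
    where
    go : (a : ∃ λ e → e ∈ al × u ≡ proj₁ e) (b : ∃ λ e → e ∈ al × v ≡ proj₁ e) → proj₂ (proj₁ a) ≡ proj₂ (proj₁ b) →
        u ≡ v
    go (_ , i , p) (_ , j , q) eq =
      ≡.trans p (≡.trans (cong proj₁ (unique-image proj₂ (Unique-resp-↭ (↭-sym seconds) (allFin⁺ n)) i j eq)) (sym q))
  collision : ∀ u v → arc D u v ≡ true → arc D′ (f u) (f v) ≡ false
  collision u v = go (entry u) (entry v)
    where
    go : (a : ∃ λ e → e ∈ al × u ≡ proj₁ e) (b : ∃ λ e → e ∈ al × v ≡ proj₁ e) → arc D u v ≡ true →
        arc D′ (proj₂ (proj₁ a)) (proj₂ (proj₁ b)) ≡ false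
    go ((_ , p) , i , ≡.refl) ((_ , q) , j , ≡.refl) a with arc D′ p q in eq
    ... | false = ≡.refl
    ... | true  = ⊥-elim (1+n≢0 (≡.trans (sym (cong₂ _*_ (weight-arc D a) (weight-arc D′ eq))) (clean i j)))
      where
      weight-arc : ∀ (D : Digraph n) {u v} → arc D u v ≡ true → weight D u v ≡ 1
      weight-arc D eq = cong (λ b → if b then 1 else 0) eq

module _ (m n : ℕ) .{{_ : NonZero m}} (m≥ : 93 ≤ m) (n≥31m : 31 * m ≤ n) where

  packs : ∀ i → i < 2 * n ∸ (n / m) → (D D′ : Digraph n) → arcCount D ≡ n ∸ m → arcCount D′ ≡ i → Pack D D′
  packs i i< D D′ D≡ D′≡ = Packs⇒Pack D D′ (by-degree (search (λ y → 8 * n ≤? 5 * deg h all y) all))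
    where
    g h : Fin n → Fin n → ℕ
    g = weight D
    h = weight D′
    all = allFin n
    q = n / m
    n≥ : 2883 ≤ n
    n≥ = ≤-trans (*-monoʳ-≤ 31 m≥) n≥31m
    m≤n : m ≤ n
    m≤n = ≤-trans (m≤m+n m (30 * m)) n≥31m
    length-all : length all ≡ n
    length-all = length-tabulate {n = n} id
    arcs-g : arcs g all + m ≡ n
    arcs-g = ≡.trans (cong (_+ m) (≡.trans (sym (arcCount≡ D)) D≡)) (m∸n+n≡m m≤n)
    arcs-h : arcs h all + q < 2 * n
    arcs-h = ≰⇒> (λ le → <⇒≱ i< (≤-trans (m≤n+o⇒m∸n≤o (2 * n) q (≤-trans le (≤-reflexive (+-comm (arcs h all) q))))
      (≤-reflexive (≡.trans (sym (arcCount≡ D′)) D′≡))))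
    open Whole g h (weight≤1 D) (weight≤1 D′) (weight-loop D) (weight-loop D′) n≥
    open Forest (all-trees g (weight-loop D) all ∈-allFin)
    many : m ≤ length trees
    many = (lin ((length all) ∷ (arcs g all) ∷ (length trees) ∷ m ∷ n ∷ [])
          (λ l a t m n → (n :≤ l) ∷ (l :≤ a :+ t) ∷ (a :+ m :≤ n) ∷ [] ⇒ m :≤ t)
          0 (1 ∷ 1 ∷ 1 ∷ [])
          (≤-reflexive (sym length-all) , count , ≤-reflexive arcs-g , tt))
    few : arcs g all + 93 ≤ n
    few = (lin ((arcs g all) ∷ m ∷ n ∷ [])
          (λ a m n → (a :+ m :≤ n) ∷ (con 93 :≤ m) ∷ [] ⇒ a :+ con 93 :≤ n)
          0 (1 ∷ 1 ∷ [])
          (≤-reflexive arcs-g , m≥ , tt))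
    by-degree : (∃ λ y → y ∈ all × 8 * n ≤ 5 * deg h all y) ⊎ (∀ {y} → y ∈ all → ¬ 8 * n ≤ 5 * deg h all y) →
        Packs all all none
    by-degree (inj₂ low) = packs-initial 6 initial ≡.refl
      where
      initial : Initial 0
      initial = record
        { us = all ; ps = all ; trees = trees ; other = other ; us! = allFin⁺ n ; ps! = allFin⁺ n ; us≡ = cover ;
            len = ≡.refl
        ; us≤n = ≤-reflexive length-all ; are-trees = are-trees ; count = ≤-trans m≥ many
        ; sparse = (lin ((arcs g all) ∷ (length all) ∷ n ∷ [])
              (λ a l n → (a :+ con 93 :≤ n) ∷ (n :≤ l) ∷ [] ⇒ a :+ con 93 :≤ l :+ con 0)
              0 (1 ∷ 1 ∷ [])
              (few , ≤-reflexive (sym length-all) , tt))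
        ; few = few
        ; heavy = (lin ((arcs h all) ∷ q ∷ n ∷ [])
              (λ b q n → (b :+ q :< con 2 :* n) ∷ [] ⇒ con 3 :* b :+ con 0 :< con 6 :* n)
              0 (3 ∷ [])
              (arcs-h , tt))
        ; long = (lin ((length all) ∷ n ∷ [])
              (λ l n → (n :≤ l) ∷ [] ⇒ con 88 :* n :≤ con 88 :* l :+ con 0)
              0 (88 ∷ [])
              (≤-reflexive (sym length-all) , tt))
        ; tame = λ p∈ → ≰⇒> (low p∈) }
    by-degree (inj₁ (y , y∈ , large)) = go (smallest trees (≤-trans (s≤s z≤n) (≤-trans m≥ many))) (∈⇒↭ y∈)
      where
      go : ∃ (λ T → T ∈ trees × length T * length trees ≤ length (concat trees)) → ∃ (λ ps₁ → all ↭ y ∷ ps₁) →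
          Packs all all none
      go (T , T∈ , size) (_ , all≡y) = go′ (∈⇒↭ T∈)
        where
        T≤n : m * length T ≤ n
        T≤n = (lin (m ∷ (length T) ∷ (length T * length trees) ∷ (length (concat trees)) ∷ (length other) ∷
            (length all) ∷ n ∷ [])
              (λ m t x c o l n → (t :* m :≤ x) ∷ (x :≤ c) ∷ (c :+ o :≤ l) ∷ (l :≤ n) ∷ [] ⇒ m :* t :≤ n)
              0 (1 ∷ 1 ∷ 1 ∷ 1 ∷ [])
              (*-monoʳ-≤ (length T) many , size , ≤-reflexive (sym (length-⊆ {ys = concat trees} cover)) ,
                  ≤-reflexive length-all , tt))
        go′ : ∃ (λ trees′ → trees ↭ T ∷ trees′) → Packs all all none
        go′ (trees′ , trees≡) = Dominant.packs-dominant (allFin⁺ n) length-all few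
          (↭-trans cover (↭-trans (++⁺ʳ other (concat-↭ trees≡)) (↭-reflexive (++-assoc T (concat trees′) other))))
          (are-trees T∈) (≤-/ m T≤n) (≤-trans (*-monoˡ-≤ (length T) m≥) T≤n) arcs-h large all≡y

  optimal : ∀ i → i < 2 * n ∸ (n / m) → ¬ NonPackable n (n ∸ m) i
  optimal i i< (D , D′ , D≡ , D′≡ , ¬pack) = ¬pack (packs i i< D D′ D≡ D′≡)

-- The extremal pair of digraphs

module LowerBound where

  open import Data.Fin using (zero; suc; fromℕ<; punchOut)
  open import Data.Fin.Properties using (toℕ<n; toℕ-injective; toℕ-fromℕ<; injective⇒≤; punchOut-injective; any?)
  open import Data.List.Properties using (map-tabulate)
  open import Data.Nat.DivMod using (m<n⇒m%n≡m; [m+kn]%n≡m%n)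
  open import Relation.Nullary.Decidable using (dec-true; dec-false)

  ∑-allFin : ∀ k (f : Fin (suc k) → ℕ) → ∑ (allFin (suc k)) f ≡ f zero + ∑ (allFin k) (λ u → f (suc u))
  ∑-allFin k f = cong (f zero +_) (≡.trans (cong (λ us → ∑ us f) (sym (map-tabulate id suc))) (∑-map suc (allFin k) f))

  count-< : ∀ {k} c → c ≤ k → (∑[ u ∈ allFin k ] (if toℕ u <ᵇ c then 1 else 0)) ≡ c
  count-< {k}     zero    _        = ∑-0 (allFin k)
  count-< {suc k} (suc c) (s≤s le) = ≡.trans (∑-allFin k (λ u → if toℕ u <ᵇ suc c then 1 else 0))
      (cong suc (count-< c le))

  count-≥ : ∀ k c → (∑[ u ∈ allFin k ] (if toℕ u <ᵇ c then 0 else 1)) ≡ k ∸ c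
  count-≥ zero    c       = sym (0∸n≡0 c)
  count-≥ (suc k) zero    = ≡.trans (∑-const (allFin (suc k)) 1)
      (≡.trans (*-identityʳ _) (length-tabulate {n = suc k} id))
  count-≥ (suc k) (suc c) = ≡.trans (∑-allFin k (λ u → if toℕ u <ᵇ suc c then 0 else 1)) (count-≥ k c)

  count-≡ : ∀ {k} c → c < k → (∑[ u ∈ allFin k ] (if toℕ u ≡ᵇ c then 1 else 0)) ≡ 1
  count-≡ {suc k} zero    _        = ≡.trans (∑-allFin k (λ u → if toℕ u ≡ᵇ 0 then 1 else 0))
      (cong suc (∑-0 (allFin k)))
  count-≡ {suc k} (suc c) (s≤s lt) = ≡.trans (∑-allFin k (λ u → if toℕ u ≡ᵇ suc c then 1 else 0)) (count-≡ c lt)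

  module Stars (m n : ℕ) .{{_ : NonZero m}} (m≤n : m ≤ n) where

    -- The vertices below m are the centres. Residues modulo m make the stars as equal as possible,
    -- so each centre receives at least ⌊n/m⌋ - 1 arcs.
    stars : Digraph n
    stars .arc u v = if toℕ u <ᵇ m then false else (toℕ v ≡ᵇ toℕ u % m)
    stars .loopless u with toℕ u <? m
    ... | yes lt = cong (λ b → if b then false else (toℕ u ≡ᵇ toℕ u % m)) (dec-true (toℕ u <? m) lt)
    ... | no ¬lt = ≡.trans (cong (λ b → if b then false else (toℕ u ≡ᵇ toℕ u % m)) (dec-false (toℕ u <? m) ¬lt))
      (dec-false (toℕ u ≟ toℕ u % m) (λ eq → ¬lt (subst (_< m) (sym eq) (m%n<n (toℕ u) m))))

    star-arc : ∀ {u v} → m ≤ toℕ u → toℕ v ≡ toℕ u % m → arc stars u v ≡ true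
    star-arc {u} {v} le eq = ≡.trans (cong (λ b → if b then false else (toℕ v ≡ᵇ toℕ u % m))
        (dec-false (toℕ u <? m) (≤⇒≯ le))) (dec-true (toℕ v ≟ toℕ u % m) eq)

    stars-count : arcCount stars ≡ n ∸ m
    stars-count = ≡.trans (arcCount≡ stars) (≡.trans (∑-cong (allFin n) row) (count-≥ n m))
      where
      row : ∀ u → ∑ (allFin n) (weight stars u) ≡ (if toℕ u <ᵇ m then 0 else 1)
      row u with toℕ u <ᵇ m
      ... | true  = ∑-0 (allFin n)
      ... | false = count-≡ (toℕ u % m) (<-≤-trans (m%n<n (toℕ u) m) m≤n)

  hub : ∀ k → ℕ → Digraph (suc k)
  hub k c .arc zero    zero    = false
  hub k c .arc zero    (suc v) = true
  hub k c .arc (suc u) zero    = toℕ u <ᵇ c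
  hub k c .arc (suc u) (suc v) = false
  hub k c .loopless zero    = ≡.refl
  hub k c .loopless (suc u) = ≡.refl

  hub-count : ∀ k c → c ≤ k → arcCount (hub k c) ≡ k + c
  hub-count k c le = ≡.trans (arcCount≡ (hub k c)) (≡.trans
      (∑-allFin k (outdeg (weight (hub k c)) (allFin (suc k)))) (cong₂ _+_
    (≡.trans (∑-allFin k (weight (hub k c) zero)) (≡.trans (∑-const (allFin k) 1)
        (≡.trans (*-identityʳ _) (length-tabulate {n = k} id))))
    (≡.trans (∑-cong (allFin k) row) (count-< c le))))
    where
    row : ∀ u → outdeg (weight (hub k c)) (allFin (suc k)) (suc u) ≡ (if toℕ u <ᵇ c then 1 else 0)
    row u = ≡.trans (∑-allFin k (weight (hub k c) (suc u)))
        (≡.trans (cong (weight (hub k c) (suc u) zero +_) (∑-0 (allFin k))) (+-identityʳ _))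

  hub-out : ∀ {k c} {p : Fin (suc k)} → arc (hub k c) zero p ≡ false → p ≡ zero
  hub-out {p = zero}  _  = ≡.refl
  hub-out {p = suc p} ()

  hub-in : ∀ {k c} {p : Fin (suc k)} → p ≢ zero → arc (hub k c) p zero ≡ false → ∃ λ w → p ≡ suc w × c ≤ toℕ w
  hub-in {p = zero}  p≢0 _ = ⊥-elim (p≢0 ≡.refl)
  hub-in {c = c} {p = suc w} _ eq = w , ≡.refl , ≮⇒≥ (λ lt → contradict (≡.trans (sym (dec-true (toℕ w <? c) lt)) eq))
    where
    contradict : true ≢ false
    contradict ()

  -- An injection that misses p would yield, with p punched out, an injection of `Fin (suc k)` into
  -- `Fin k`.
  hit : ∀ {k} (f : Fin (suc k) → Fin (suc k)) → (∀ {u v} → f u ≡ f v → u ≡ v) → ∀ p → ∃ λ u → f u ≡ p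
  hit {k} f injective p = go (any? (λ u → f u Fin.≟ p))
    where
    go : Dec (∃ λ u → f u ≡ p) → ∃ λ u → f u ≡ p
    go (yes found) = found
    go (no missed) = ⊥-elim (1+n≰n (injective⇒≤ {f = λ u → punchOut (avoid u)} (λ {u} {v} eq →
        injective (punchOut-injective (avoid u) (avoid v) eq))))
      where
      avoid : ∀ u → p ≢ f u
      avoid u eq = missed (u , sym eq)

  -- The vertex sent to 0 has to be the centre of a star; its r + 1 first neighbours then
  -- have to be sent to the r vertices without arcs to 0.
  module _ (m k r : ℕ) .{{_ : NonZero m}} (fits : (2 + r) * m ≤ suc k) where

    private
      -- With n = suc k and q = 2 + r this is n - q + 1. Then the hub digraph has k + c = 2n - q
      -- arcs, and r = q - 2 of the other vertices have no arc to vertex 0.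
      c : ℕ
      c = suc (suc k ∸ (2 + r))

      m≤n : m ≤ suc k
      m≤n = ≤-trans (m≤m+n m (suc r * m)) fits

      q≤n : 2 + r ≤ suc k
      q≤n = ≤-trans (m≤m*n (2 + r) m) fits

      c+r : c + r ≡ k
      c+r = suc-injective (≡.trans (cong suc (sym (+-suc (k ∸ suc r) r))) (cong suc (m∸n+n≡m (s≤s⁻¹ q≤n))))

      open Stars m (suc k) m≤n

    ¬pack : ¬ Pack stars (hub k c)
    ¬pack (f , injective , free) = go (hit f injective zero)
      where
      go : ∃ (λ x → f x ≡ zero) → ⊥
      go (x , fx≡0) = 1+n≰n (injective⇒≤ {f = slot} slot-injective)
        where
        no-out : ∀ {v} → arc stars x v ≡ true → v ≡ x
        no-out {v} a = injective (≡.trans (hub-out {c = c}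
            (subst (λ p → arc (hub k c) p (f v) ≡ false) fx≡0 (free x v a))) (sym fx≡0))
        -- A vertex that is not a centre has an arc to its centre, and the image of that centre
        -- would have to be a vertex other than 0 that 0 does not dominate.
        centre : toℕ x < m
        centre = ≰⇒> λ le → <⇒≱ (m%n<n (toℕ x) m) (≤-trans le
            (≤-reflexive (≡.trans (cong toℕ (sym (no-out (star-arc le to)))) to)))
          where
          to : toℕ (fromℕ< (<-≤-trans (m%n<n (toℕ x) m) m≤n)) ≡ toℕ x % m
          to = toℕ-fromℕ< (<-≤-trans (m%n<n (toℕ x) m) m≤n)
        -- The neighbours x + m, ..., x + (r + 1)m of x exist because x < m and (2 + r)m ≤ n.
        position : Fin (suc r) → ℕ
        position j = toℕ x + suc (toℕ j) * m
        position< : ∀ j → position j < suc k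
        position< j = <-≤-trans (+-mono-<-≤ centre (*-monoˡ-≤ m (toℕ<n j))) fits
        leaf : Fin (suc r) → Fin (suc k)
        leaf j = fromℕ< (position< j)
        toℕ-leaf : ∀ j → toℕ (leaf j) ≡ position j
        toℕ-leaf j = toℕ-fromℕ< (position< j)
        leaf-arc : ∀ j → arc stars (leaf j) x ≡ true
        leaf-arc j = star-arc (≤-trans (≤-trans (m≤m+n m (toℕ j * m)) (m≤n+m (suc (toℕ j) * m) (toℕ x)))
            (≤-reflexive (sym (toℕ-leaf j))))
          (sym (≡.trans (cong (_% m) (toℕ-leaf j)) (≡.trans ([m+kn]%n≡m%n (toℕ x) (suc (toℕ j)) m) (m<n⇒m%n≡m centre))))
        leaf≢x : ∀ j → leaf j ≢ x
        leaf≢x j eq = <⇒≢ (<-≤-trans (m<m+n (toℕ x) (>-nonZero⁻¹ m)) (+-monoʳ-≤ (toℕ x) (m≤m+n m (toℕ j * m))))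
            (≡.trans (cong toℕ (sym eq)) (toℕ-leaf j))
        image : ∀ j → ∃ λ w → f (leaf j) ≡ suc w × c ≤ toℕ w
        image j = hub-in {c = c} (λ eq → leaf≢x j (injective (≡.trans eq (sym fx≡0))))
            (subst (λ p → arc (hub k c) (f (leaf j)) p ≡ false) fx≡0 (free (leaf j) x (leaf-arc j)))
        slot< : ∀ j → toℕ (proj₁ (image j)) ∸ c < r
        slot< j = <-≤-trans (∸-monoˡ-< {n = c} (toℕ<n (proj₁ (image j))) (proj₂ (proj₂ (image j))))
            (≤-reflexive (≡.trans (cong (_∸ c) (sym c+r)) (m+n∸m≡n c r)))
        slot : Fin (suc r) → Fin r
        slot j = fromℕ< (slot< j)
        slot-injective : ∀ {i j} → slot i ≡ slot j → i ≡ j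
        slot-injective {i} {j} eq = toℕ-injective (suc-injective
            (*-cancelʳ-≡ (suc (toℕ i)) (suc (toℕ j)) m (+-cancelˡ-≡ (toℕ x) _ _
          (≡.trans (sym (toℕ-leaf i)) (≡.trans (cong toℕ (injective same)) (toℕ-leaf j))))))
          where
          same : f (leaf i) ≡ f (leaf j)
          same = ≡.trans (proj₁ (proj₂ (image i))) (≡.trans
              (cong suc (toℕ-injective (∸-cancelʳ-≡ (proj₂ (proj₂ (image i))) (proj₂ (proj₂ (image j)))
            (≡.trans (sym (toℕ-fromℕ< (slot< i))) (≡.trans (cong toℕ eq) (toℕ-fromℕ< (slot< j)))))))
                (sym (proj₁ (proj₂ (image j)))))

    non-packable : NonPackable (suc k) (suc k ∸ m) (2 * suc k ∸ (2 + r))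
    non-packable = stars , hub k c , stars-count , ≡.trans (hub-count k c (≤-trans (m≤m+n c r) (≤-reflexive c+r)))
        total , ¬pack
      where
      total : k + c ≡ 2 * suc k ∸ (2 + r)
      total = ≡.trans (+-suc k _) (≡.trans (sym (+-∸-assoc (suc k) q≤n))
          (cong (λ l → suc k + l ∸ (2 + r)) (sym (+-identityʳ (suc k)))))

  lower : ∀ m n q .{{_ : NonZero m}} → 2 ≤ q → q * m ≤ n → NonPackable n (n ∸ m) (2 * n ∸ q)
  lower m       n       1             (s≤s ())
  lower (suc m) zero    (suc (suc r)) _ ()
  lower m       (suc k) (suc (suc r)) _ fits = non-packable m k r fits

open LowerBound using (lower)

theorem2 : (m n : ℕ) → .{{_ : NonZero m}} → 93 ≤ m → 31 * m ≤ n →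
    IsMu n (n ∸ m) (2 * n ∸ (n / m))
theorem2 m n m≥ n≥31m =
  lower m n (n / m) (≤-/ m (≤-trans (≤-reflexive (*-comm m 2)) (≤-trans (*-monoˡ-≤ m (m≤m+n 2 29)) n≥31m)))
      (m/n*n≤m n m) ,
  optimal m n m≥ n≥31m
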